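{- Let $m\geqslant 2$ and $k\geqslant 2$. For every length $n\geqslant 2m^k$, writing $\lambda=n \bmod m^k$ and $\lambda=\nu m^{k-1}+\mu$ with $0\leqslant \nu<m$ and $0\leqslant\mu<m^{k-1}$, we have \[ b^{(k)}_{\mathbf{t}_m}(n)=(m^{k-1}-1)(m^3-m^2+m)+\begin{cases} b^{(1)}_{\mathbf{t}_m}(m+\nu), & \text{if }\mu=0;\\ m, & \text{otherwise.}\end{cases}\] In particular, $\left(b^{(k)}_{\mathbf{t}_m}(n)\right)_{n\geqslant 2m^k}$ is periodic with period $m^k$.
   Context: Let $\mathcal{A}_m=\{0,1,\ldots,m-1\}$, identified with $\mathbb{Z}/m\mathbb{Z}$ (all letter arithmetic is modulo $m$). Let $\sigma_m(i)=i\,(i+1)\cdots(i+m-1)$ define a morphism on $\mathcal{A}_m^*$, and let $\mathbf{t}_m=\lim_{j\to\infty}\sigma_m^j(0)$. For words $u,w$, $\binom{u}{w}$ denotes the number of occurrences of $w$ as a (not necessarily contiguous) subword of $u$. Words $u,v$ are $k$-binomially equivalent, $u\sim_k v$, if $\binom{u}{x}=\binom{v}{x}$ for all words $x$ of length at most $k$; $\sim_1$ is abelian equivalence. $b^{(k)}_{\mathbf{t}_m}(n)$ denotes the number of $\sim_k$-classes among the factors (contiguous blocks) of length $n$ of $\mathbf{t}_m$; $b^{(1)}_{\mathbf{t}_m}$ is the abelian complexity. -}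

module Defs where

open import Data.Nat using (ℕ; zero; suc; _+_; _*_; _∸_; _^_; _≤_; _<_)
open import Data.Nat.DivMod using (_%_; _/_)
open import Data.List using (List; []; _∷_; _++_; concatMap; length; take; drop; replicate)
open import Data.Fin using (Fin; toℕ)
open import Data.Product using (Σ; ∃; _×_; _,_)
open import Relation.Binary.PropositionalEquality using (_≡_; _≢_)
open import Relation.Nullary using (¬_; yes; no)
open import Data.Nat using (_≟_)

-- total versions of mod / div (value irrelevant when the divisor is 0)
_mod_ : ℕ → ℕ → ℕ
a mod zero = a
a mod suc b = a % suc b

_div_ : ℕ → ℕ → ℕ
a div zero = zero
a div suc b = a / suc b

-- letters of A_m are the naturals 0..m-1, arithmetic modulo m
-- σ_m(i) = i (i+1) ... (i+m-1)
σ-letter : ℕ → ℕ → List ℕ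
σ-letter m i = go m
  where
  go : ℕ → List ℕ
  go zero = []
  go (suc r) = go r ++ ((i + r) mod m ∷ [])

σ : ℕ → List ℕ → List ℕ
σ m = concatMap (σ-letter m)

σ^ : ℕ → ℕ → List ℕ → List ℕ
σ^ m zero w = w
σ^ m (suc j) w = σ m (σ^ m j w)

nth : List ℕ → ℕ → ℕ
nth [] _ = zero
nth (x ∷ xs) zero = x
nth (x ∷ xs) (suc n) = nth xs n

-- t_m = lim σ_m^j(0); its n-th letter is read off σ_m^(n+1)(0),
-- a prefix of t_m of length m^(n+1) > n (for m ≥ 2)
t : ℕ → ℕ → ℕ
t m n = nth (σ^ m (suc n) (0 ∷ [])) n

factor : ℕ → ℕ → ℕ → List ℕ
factor m i n = go i n
  where
  go : ℕ → ℕ → List ℕ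
  go j zero = []
  go j (suc r) = t m j ∷ go (suc j) r

binom : List ℕ → List ℕ → ℕ
binom u [] = 1
binom [] (b ∷ w) = 0
binom (a ∷ u) (b ∷ w) with a ≟ b
... | yes _ = binom u (b ∷ w) + binom u w
... | no _  = binom u (b ∷ w)

-- k-binomial equivalence (letters outside the alphabet occur in neither word,
-- so quantifying over all lists of naturals is equivalent)
_∼[_]_ : List ℕ → ℕ → List ℕ → Set
u ∼[ k ] v = (x : List ℕ) → length x ≤ k → binom u x ≡ binom v x

HasClassCount : ℕ → ℕ → ℕ → ℕ → Set
HasClassCount m k n N =
  Σ (Fin N → ℕ) λ pos →
    ((a b : Fin N) → a ≢ b → ¬ (factor m (pos a) n ∼[ k ] factor m (pos b) n))
    × ((i : ℕ) → ∃ λ a → factor m i n ∼[ k ] factor m (pos a) n)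

{-# OPTIONS --safe #-}
-- The letter of t_m at position p is the base-m digit sum of p modulo m.
-- Write K = k - 1 and M = m ^ K, and cut a factor at the multiples of M into a proper
-- suffix of a block σ^K(x), whole blocks σ^K(z), and a proper prefix of a block σ^K(y).
-- Its k-binomial class is determined by, and determines, the two cut lengths, the letters
-- x and y of the blocks that are really cut, and the abelian class of z.
--
-- Determined by: the blocks σ^K(a) are pairwise K-binomially equivalent, so a subword of
-- length K + 1 tells blocks apart only when it lies within one of them.
--
-- Determines: u ∼_k v makes all moments Σ q^e over the positions q of a given letter agree
-- for e < k. With X the cyclic shift of letters and Q marking positions, the generating
-- function of σ(a) is X^a (Q^m - 1) / (X Q - 1), so multiplying by X Q - 1 reduces a factor
-- to its block boundaries. The moments of degree 0 and 1 of these boundary terms reveal the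
-- cut of the first σ-level; what remains are the moments of degree < k - 1 of the desubstituted
-- factor, and the argument repeats.
--
-- Counting: z is described up to abelian equivalence by the letter A after the preceding one,
-- its distance α to the next σ-block boundary and the following letter, through
-- X^A - X^(A+α) + X^(B+α) - X^(B+|z|). If both ends are cut there are m (1 + (m - 1) m) classes for
-- each cut length; if exactly one end is cut, A - B and α become interchangeable and unordered
-- pairs are counted instead.
module Submission where

open import Defs
open import Data.Empty using (⊥-elim)
open import Data.Fin using (Fin; toℕ; fromℕ<; zero; suc)
open import Data.Fin.Properties using (+↔⊎; *↔×; toℕ<n; toℕ-injective; toℕ-fromℕ<; any?; all?)
open import Data.List using (List; []; _∷_; _++_; length)
open import Data.List.Properties using (length-++)
open import Data.List.Relation.Unary.All using (All; []; _∷_)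
open import Data.Nat
open import Data.Nat.DivMod using (_%_; _/_; m≡m%n+[m/n]*n; m%n<n; m<n⇒m%n≡m; %-distribˡ-+; [m+kn]%n≡m%n; m%n%n≡m%n)
open import Data.Nat.Properties
open import Data.Nat.Tactic.RingSolver using (solve-∀)
open import Data.Product using (Σ; ∃; ∃₂; _×_; _,_; proj₁; proj₂)
open import Data.Sum using (_⊎_; inj₁; inj₂)
open import Data.Unit using (⊤; tt)
open import Function using (_∘_; case_of_; _↔_; Inverse)
open import Relation.Binary.Definitions using (tri<; tri≈; tri>)
open import Relation.Binary.PropositionalEquality
open import Relation.Binary.Structures using (IsDecEquivalence)
open import Relation.Nullary using (¬_; Dec; yes; no)
open ≡-Reasoning
open ≤-Reasoning using (begin-strict_; step-<; step-≤) renaming (begin_ to begin-≤_; _∎ to _□)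

-- The bound 2 m^k ≤ n makes the cut visible. Removing the cut ends at one σ-level costs at most 2
-- (m - 1) letters, so at least three whole σ-blocks remain at every level; t_m has no letter three
-- times in a row, so no single letter can account for all whole blocks, and this strict inequality
-- decides how boundary terms must cancel. Each descent costs one degree, because the whole blocks
-- enter only through (Q^m - 1) W. Hence k degrees pay for k - 1 levels and leave degree 0, the
-- abelian class. The length n fixes the right cut once the left one is known, so only the left cuts
-- 0 and μ leave an end uncut. If μ = 0 they coincide, and the abelian count is not evaluated but
-- carried over from length m + ν, since it depends on the number of blocks only modulo m. Otherwise
-- the two one-sided counts add up to one generic count plus m. Identities between polynomials in X
-- (with X^m = 1) and Q are kept in ℕ: negative terms stand on the other side, `δ j a` is the
-- coefficient of X^j in X^a, and f s replaces Q^s.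

∑ : ℕ → (ℕ → ℕ) → ℕ
∑ zero    f = 0
∑ (suc n) f = f 0 + ∑ n (f ∘ suc)

∑-cong : ∀ n {f g : ℕ → ℕ} → (∀ s → s < n → f s ≡ g s) → ∑ n f ≡ ∑ n g
∑-cong zero    h = refl
∑-cong (suc n) h = cong₂ _+_ (h 0 z<s) (∑-cong n (λ s s<n → h (suc s) (s<s s<n)))

+-interchange : ∀ a b c d → (a + b) + (c + d) ≡ (a + c) + (b + d)
+-interchange = solve-∀

∑-+ : ∀ n (f g : ℕ → ℕ) → ∑ n (λ s → f s + g s) ≡ ∑ n f + ∑ n g
∑-+ zero    f g = refl
∑-+ (suc n) f g = trans (cong (f 0 + g 0 +_) (∑-+ n (f ∘ suc) (g ∘ suc)))
                        (+-interchange (f 0) (g 0) _ _)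

∑-* : ∀ n c (f : ℕ → ℕ) → ∑ n (λ s → c * f s) ≡ c * ∑ n f
∑-* zero    c f = sym (*-zeroʳ c)
∑-* (suc n) c f = trans (cong (c * f 0 +_) (∑-* n c (f ∘ suc))) (sym (*-distribˡ-+ c (f 0) _))

∑-zero : ∀ n → ∑ n (λ _ → 0) ≡ 0
∑-zero zero    = refl
∑-zero (suc n) = ∑-zero n

∑-split : ∀ a b (f : ℕ → ℕ) → ∑ (a + b) f ≡ ∑ a f + ∑ b (λ s → f (a + s))
∑-split zero    b f = refl
∑-split (suc a) b f = trans (cong (f 0 +_) (∑-split a b (f ∘ suc))) (sym (+-assoc (f 0) _ _))

∑-last : ∀ n (f : ℕ → ℕ) → ∑ (suc n) f ≡ ∑ n f + f n
∑-last zero    f = +-identityʳ (f 0)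
∑-last (suc n) f = trans (cong (f 0 +_) (∑-last n (f ∘ suc))) (sym (+-assoc (f 0) _ _))

∑-swap : ∀ n k (f : ℕ → ℕ → ℕ) → ∑ n (λ s → ∑ k (f s)) ≡ ∑ k (λ r → ∑ n (λ s → f s r))
∑-swap zero    k f = sym (∑-zero k)
∑-swap (suc n) k f = trans (cong (∑ k (f 0) +_) (∑-swap n k (f ∘ suc)))
                           (sym (∑-+ k (f 0) (λ r → ∑ n (λ s → f (suc s) r))))

∑-blocks : ∀ g m (f : ℕ → ℕ) → ∑ (g * m) f ≡ ∑ g (λ h → ∑ m (λ r → f (h * m + r)))
∑-blocks zero    m f = refl
∑-blocks (suc g) m f = trans (∑-split m (g * m) f) (cong (∑ m f +_)
  (trans (∑-blocks g m (λ s → f (m + s)))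
         (∑-cong g (λ h _ → ∑-cong m (λ r _ → cong f (sym (+-assoc m (h * m) r)))))))

mod≡% : ∀ a b .{{_ : NonZero b}} → a mod b ≡ a % b
mod≡% a (suc b) = refl

divMod : ∀ M .{{_ : NonZero M}} n → ∃₂ λ q s → n ≡ q * M + s × s < M
divMod M n = n / M , n % M , trans (m≡m%n+[m/n]*n n M) (+-comm (n % M) _) , m%n<n n M

nth-++ˡ : ∀ u v q → q < length u → nth (u ++ v) q ≡ nth u q
nth-++ˡ (x ∷ u) v zero    _         = refl
nth-++ˡ (x ∷ u) v (suc q) (s≤s q<u) = nth-++ˡ u v q q<u

nth-++ʳ : ∀ u v q → nth (u ++ v) (length u + q) ≡ nth v q
nth-++ʳ []      v q = refl
nth-++ʳ (x ∷ u) v q = nth-++ʳ u v q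

-- The local functions of `σ-letter` and `factor` cannot be named from outside;
-- their names are recovered as solutions of metavariables.
mutual
  σ-run : ℕ → ℕ → ℕ → List ℕ
  σ-run = _

  σ-letter-unfold : ∀ m i → σ-letter (suc m) i ≡ σ-run (suc m) i m ++ ((i + m) mod suc m ∷ [])
  σ-letter-unfold m i with (i + m) mod suc m | suc m
  ... | _ | _ = refl

mutual
  factor-run : ℕ → ℕ → ℕ → ℕ → ℕ → List ℕ
  factor-run = _

  factor-unfold : ∀ m i n → factor m i (suc n) ≡ t m i ∷ factor-run m i (suc n) (suc i) n
  factor-unfold m i n with suc n | suc i
  ... | _ | _ = refl

-- `factor-run` carries the arguments `i` and `n` of `factor` that its local function captures; only
-- `j` and `r` drive the recursion.
factor-run-irr : ∀ m i n i′ n′ j r → factor-run m i n j r ≡ factor-run m i′ n′ j r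
factor-run-irr m i n i′ n′ j zero    = refl
factor-run-irr m i n i′ n′ j (suc r) = cong (t m j ∷_) (factor-run-irr m i n i′ n′ (suc j) r)

factor-suc : ∀ m i n → factor m i (suc n) ≡ t m i ∷ factor m (suc i) n
factor-suc m i n = cong (t m i ∷_) (factor-run-irr m i (suc n) (suc i) n (suc i) n)

factor-++ : ∀ m i a b → factor m i (a + b) ≡ factor m i a ++ factor m (i + a) b
factor-++ m i zero    b = cong (λ j → factor m j b) (sym (+-identityʳ i))
factor-++ m i (suc a) b = begin
  factor m i (suc (a + b))                               ≡⟨ factor-suc m i (a + b) ⟩
  t m i ∷ factor m (suc i) (a + b)                       ≡⟨ cong (t m i ∷_) (factor-++ m (suc i) a b) ⟩
  t m i ∷ factor m (suc i) a ++ factor m (suc i + a) b   ≡⟨ cong₂ _++_ (sym (factor-suc m i a)) (cong (λ j → factor m j b) (sym (+-suc i a))) ⟩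
  factor m i (suc a) ++ factor m (i + suc a) b           ∎

factor-cong : ∀ m i i′ n → (∀ s → s < n → t m (i + s) ≡ t m (i′ + s)) → factor m i n ≡ factor m i′ n
factor-cong m i i′ zero    h = refl
factor-cong m i i′ (suc n) h = begin
  factor m i (suc n)           ≡⟨ factor-suc m i n ⟩
  t m i ∷ factor m (suc i) n   ≡⟨ cong₂ _∷_ head tail ⟩
  t m i′ ∷ factor m (suc i′) n ≡⟨ sym (factor-suc m i′ n) ⟩
  factor m i′ (suc n)          ∎
  where
  head = subst₂ (λ a b → t m a ≡ t m b) (+-identityʳ i) (+-identityʳ i′) (h 0 z<s)
  tail = factor-cong m (suc i) (suc i′) n λ s s<n →
    subst₂ (λ a b → t m a ≡ t m b) (+-suc i s) (+-suc i′ s) (h (suc s) (s<s s<n))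

-- Arithmetic modulo m and the indicator of a residue class.

module Residues (m : ℕ) .{{_ : NonZero m}} where

  infix 4 _≈_ _≉_
  _≈_ _≉_ : ℕ → ℕ → Set
  a ≈ b = a % m ≡ b % m
  a ≉ b = ¬ a ≈ b

  _≈?_ : ∀ a b → Dec (a ≈ b)
  a ≈? b = a % m ≟ b % m

  ≈-reflexive : ∀ {a b} → a ≡ b → a ≈ b
  ≈-reflexive = cong (_% m)

  %-≈ : ∀ a → a % m ≈ a
  %-≈ a = m%n%n≡m%n a m

  +-cong-≈ : ∀ {a a′ b b′} → a ≈ a′ → b ≈ b′ → a + b ≈ a′ + b′
  +-cong-≈ {a} {a′} {b} {b′} p q = begin
    (a + b) % m             ≡⟨ %-distribˡ-+ a b m ⟩
    (a % m + b % m) % m     ≡⟨ cong₂ (λ x y → (x + y) % m) p q ⟩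
    (a′ % m + b′ % m) % m   ≡⟨ sym (%-distribˡ-+ a′ b′ m) ⟩
    (a′ + b′) % m           ∎

  +k*m-≈ : ∀ a k → a + k * m ≈ a
  +k*m-≈ a k = [m+kn]%n≡m%n a k m

  +m-≈ : ∀ a → a + m ≈ a
  +m-≈ a = trans (≈-reflexive (cong (a +_) (sym (*-identityˡ m)))) (+k*m-≈ a 1)

  -- Stands for -c modulo m, since c + c * (m - 1) = c * m; subtraction stays inside ℕ.
  neg : ℕ → ℕ
  neg c = c * pred m

  +-neg : ∀ a c → a + c + neg c ≈ a
  +-neg a c = trans (≈-reflexive (trans (+-assoc a c (neg c)) (cong (a +_) eq))) (+k*m-≈ a c)
    where
    eq : c + c * pred m ≡ c * m
    eq = trans (sym (*-suc c (pred m))) (cong (c *_) (suc-pred m))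

  +-cancelʳ-≈ : ∀ c {a b} → a + c ≈ b + c → a ≈ b
  +-cancelʳ-≈ c {a} {b} p = begin
    a % m               ≡⟨ +-neg a c ⟨
    (a + c + neg c) % m ≡⟨ +-cong-≈ {a + c} {b + c} {neg c} p refl ⟩
    (b + c + neg c) % m ≡⟨ +-neg b c ⟩
    b % m               ∎

  +-cancelˡ-≈ : ∀ c {a b} → c + a ≈ c + b → a ≈ b
  +-cancelˡ-≈ c {a} {b} p = +-cancelʳ-≈ c (trans (≈-reflexive (+-comm a c)) (trans p (≈-reflexive (+-comm c b))))

  small-≈ : ∀ {a b} → a < m → b < m → a ≈ b → a ≡ b
  small-≈ a<m b<m p = trans (sym (m<n⇒m%n≡m a<m)) (trans p (m<n⇒m%n≡m b<m))

  divMod-unique : ∀ {g g′ e e′} → e < m → e′ < m → g * m + e ≡ g′ * m + e′ → g ≡ g′ × e ≡ e′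
  divMod-unique {g} {g′} {e} {e′} e<m e′<m eq =
    *-cancelʳ-≡ g g′ m (+-cancelʳ-≡ e _ _ (trans eq (cong (g′ * m +_) (sym e≡e′)))) , e≡e′
    where
    reduce : ∀ g e → g * m + e ≈ e
    reduce g e = trans (≈-reflexive (+-comm (g * m) e)) (+k*m-≈ e g)
    e≡e′ : e ≡ e′
    e≡e′ = small-≈ e<m e′<m (trans (sym (reduce g e)) (trans (≈-reflexive eq) (reduce g′ e′)))

  abstract
    -- Coefficient of X^j in X^a when X^m = 1. It is `abstract` so that goals stay in terms of `δ`;
    -- the three lemmas of this block are the only access to its definition.
    δ : ℕ → ℕ → ℕ
    δ j a with a ≈? j
    ... | yes _ = 1
    ... | no  _ = 0

    δ-yes : ∀ {j a} → a ≈ j → δ j a ≡ 1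
    δ-yes {j} {a} p with a ≈? j
    ... | yes _ = refl
    ... | no ¬p = ⊥-elim (¬p p)

    δ-no : ∀ {j a} → a ≉ j → δ j a ≡ 0
    δ-no {j} {a} ¬p with a ≈? j
    ... | yes p = ⊥-elim (¬p p)
    ... | no _  = refl

    δ-≤1 : ∀ j a → δ j a ≤ 1
    δ-≤1 j a with a ≈? j
    ... | yes _ = ≤-refl
    ... | no _  = z≤n

  δ-cong : ∀ {j j′ a a′} → (a ≈ j → a′ ≈ j′) → (a′ ≈ j′ → a ≈ j) → δ j a ≡ δ j′ a′
  δ-cong {j} {j′} {a} {a′} f g with a ≈? j
  ... | yes p = trans (δ-yes {j} {a} p) (sym (δ-yes {j′} {a′} (f p)))
  ... | no ¬p = trans (δ-no {j} {a} ¬p) (sym (δ-no {j′} {a′} (¬p ∘ g)))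

  δ-congʳ : ∀ {j a a′} → a ≈ a′ → δ j a ≡ δ j a′
  δ-congʳ {j} {a} {a′} p = δ-cong {j} {j} {a} {a′} (trans (sym p)) (trans p)

  δ-congˡ : ∀ {j j′ a} → j ≈ j′ → δ j a ≡ δ j′ a
  δ-congˡ {j} {j′} {a} p = δ-cong {j} {j′} {a} {a} (λ q → trans q p) (λ q → trans q (sym p))

  δ-suc : ∀ j a → δ (suc j) (suc a) ≡ δ j a
  δ-suc j a = δ-cong {suc j} {j} {suc a} {a} (+-cancelˡ-≈ 1 {a} {j}) (+-cong-≈ {1} {1} {a} {j} refl)

  -- Sliding the window by one trades `φ y` for `φ (y + m)`, and these are equal.
  ∑-cyclic : ∀ (φ : ℕ → ℕ) → (∀ {a b} → a ≈ b → φ a ≡ φ b) → ∀ y → ∑ m (λ r → φ (y + r)) ≡ ∑ m φ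
  ∑-cyclic φ resp zero    = refl
  ∑-cyclic φ resp (suc y) = +-cancelˡ-≡ (φ y) _ _ (begin
    φ y + ∑ m (λ r → φ (suc y + r))
      ≡⟨ cong₂ _+_ (cong φ (sym (+-identityʳ y))) (∑-cong m (λ r _ → cong φ (sym (+-suc y r)))) ⟩
    ∑ (suc m) (λ r → φ (y + r))              ≡⟨ ∑-last m (λ r → φ (y + r)) ⟩
    ∑ m (λ r → φ (y + r)) + φ (y + m)        ≡⟨ cong₂ _+_ (∑-cyclic φ resp y) (resp (+m-≈ y)) ⟩
    ∑ m φ + φ y                              ≡⟨ +-comm (∑ m φ) (φ y) ⟩
    φ y + ∑ m φ                              ∎)

  -- Once the sum is rotated to start at `a`, only its first term survives.
  ∑-δ* : ∀ (φ : ℕ → ℕ) → (∀ {a b} → a ≈ b → φ a ≡ φ b) → ∀ a → ∑ m (λ j → φ j * δ j a) ≡ φ a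
  ∑-δ* φ resp a = begin
    ∑ m (λ j → φ j * δ j a)       ≡⟨ ∑-cyclic (λ j → φ j * δ j a) (λ {x} {y} p → cong₂ _*_ (resp p) (δ-congˡ {x} {y} {a} p)) a ⟨
    ∑ m (λ r → ψ r)               ≡⟨ cong (λ k → ∑ k ψ) (suc-pred m) ⟨
    ψ 0 + ∑ (pred m) (ψ ∘ suc)    ≡⟨ cong₂ _+_ ψ0 (trans (∑-cong (pred m) ψsuc) (∑-zero (pred m))) ⟩
    φ a + 0                       ≡⟨ +-identityʳ (φ a) ⟩
    φ a                           ∎
    where
    ψ : ℕ → ℕ
    ψ r = φ (a + r) * δ (a + r) a
    ψ0 : ψ 0 ≡ φ a
    ψ0 = trans (cong₂ _*_ (cong φ (+-identityʳ a)) (δ-yes {a + 0} {a} (≈-reflexive (sym (+-identityʳ a))))) (*-identityʳ (φ a))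
    ψsuc : ∀ s → s < pred m → ψ (suc s) ≡ 0
    ψsuc s s<m-1 = trans (cong (φ (a + suc s) *_) (δ-no {a + suc s} {a} λ p →
        case small-≈ (≤-<-trans z≤n s+1<m) s+1<m (+-cancelˡ-≈ a {0} {suc s} (trans (≈-reflexive (+-identityʳ a)) p)) of λ ()))
      (*-zeroʳ (φ (a + suc s)))
      where
      s+1<m : suc s < m
      s+1<m = subst (suc s <_) (suc-pred m) (s<s s<m-1)

-- Subword counts of concatenations.

conv : (List ℕ → ℕ) → (List ℕ → ℕ) → List ℕ → ℕ
conv F G []      = F [] * G []
conv F G (b ∷ x) = F [] * G (b ∷ x) + conv (λ y → F (b ∷ y)) G x

conv-cong : ∀ {F F′ G G′} x →
  (∀ y → length y ≤ length x → F y ≡ F′ y) → (∀ y → length y ≤ length x → G y ≡ G′ y) →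
  conv F G x ≡ conv F′ G′ x
conv-cong []      f g = cong₂ _*_ (f [] z≤n) (g [] z≤n)
conv-cong (b ∷ x) f g = cong₂ _+_ (cong₂ _*_ (f [] z≤n) (g (b ∷ x) ≤-refl))
  (conv-cong x (λ y y≤x → f (b ∷ y) (s≤s y≤x)) (λ y y≤x → g y (m≤n⇒m≤1+n y≤x)))

conv-+ˡ : ∀ F F′ G x → conv (λ y → F y + F′ y) G x ≡ conv F G x + conv F′ G x
conv-+ˡ F F′ G []      = *-distribʳ-+ (G []) (F []) (F′ [])
conv-+ˡ F F′ G (b ∷ x) = trans
  (cong₂ _+_ (*-distribʳ-+ (G (b ∷ x)) (F []) (F′ [])) (conv-+ˡ (F ∘ (b ∷_)) (F′ ∘ (b ∷_)) G x))
  (+-interchange (F [] * G (b ∷ x)) (F′ [] * G (b ∷ x)) _ _)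

conv-0ˡ : ∀ G x → conv (λ _ → 0) G x ≡ 0
conv-0ˡ G []      = refl
conv-0ˡ G (b ∷ x) = conv-0ˡ G x

binom-[] : ∀ u → binom u [] ≡ 1
binom-[] []      = refl
binom-[] (a ∷ u) = refl

-- `conv F G x` is the sum of F y * G z over all cuts x = y ++ z; an occurrence of x in u ++ v cuts
-- x at the place where it passes from u to v.
binom-++ : ∀ u v x → binom (u ++ v) x ≡ conv (binom u) (binom v) x
binom-++ []      v []      = sym (trans (+-identityʳ _) (binom-[] v))
binom-++ []      v (b ∷ x) = sym (trans (cong₂ _+_ (+-identityʳ _) (conv-0ˡ (binom v) x)) (+-identityʳ _))
binom-++ (a ∷ u) v []      = sym (trans (+-identityʳ _) (binom-[] v))
binom-++ (a ∷ u) v (b ∷ x) with a ≟ b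
... | yes refl = begin
  binom (u ++ v) (a ∷ x) + binom (u ++ v) x
    ≡⟨ cong₂ _+_ (binom-++ u v (a ∷ x)) (binom-++ u v x) ⟩
  binom u [] * binom v (a ∷ x) + conv (λ y → binom u (a ∷ y)) (binom v) x + conv (binom u) (binom v) x
    ≡⟨ +-assoc (binom u [] * binom v (a ∷ x)) _ _ ⟩
  binom u [] * binom v (a ∷ x) + (conv (λ y → binom u (a ∷ y)) (binom v) x + conv (binom u) (binom v) x)
    ≡⟨ cong₂ _+_ (cong (_* binom v (a ∷ x)) (binom-[] u)) (sym (conv-+ˡ (λ y → binom u (a ∷ y)) (binom u) (binom v) x)) ⟩
  1 * binom v (a ∷ x) + conv (λ y → binom u (a ∷ y) + binom u y) (binom v) x ∎
... | no a≢b = begin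
  binom (u ++ v) (b ∷ x)
    ≡⟨ binom-++ u v (b ∷ x) ⟩
  binom u [] * binom v (b ∷ x) + conv (λ y → binom u (b ∷ y)) (binom v) x
    ≡⟨ cong₂ _+_ (cong (_* binom v (b ∷ x)) (binom-[] u)) refl ⟩
  1 * binom v (b ∷ x) + conv (λ y → binom u (b ∷ y)) (binom v) x ∎

∼-refl : ∀ {k u} → u ∼[ k ] u
∼-refl x _ = refl

∼-sym : ∀ {k u v} → u ∼[ k ] v → v ∼[ k ] u
∼-sym p x h = sym (p x h)

∼-++ : ∀ {k u u′ v v′} → u ∼[ k ] u′ → v ∼[ k ] v′ → (u ++ v) ∼[ k ] (u′ ++ v′)
∼-++ {k} {u} {u′} {v} {v′} p q x x≤k = begin
  binom (u ++ v) x               ≡⟨ binom-++ u v x ⟩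
  conv (binom u) (binom v) x     ≡⟨ conv-cong x (λ y h → p y (≤-trans h x≤k)) (λ y h → q y (≤-trans h x≤k)) ⟩
  conv (binom u′) (binom v′) x   ≡⟨ binom-++ u′ v′ x ⟨
  binom (u′ ++ v′) x             ∎

-- Only the cut that puts all of x on the right can feed G a word of length K + 1; its weight is
-- `F []`.
conv-topʳ : ∀ K F {G G′} → (∀ y → length y ≤ K → G y ≡ G′ y) → ∀ x → length x ≤ suc K →
  conv F G x + F [] * G′ x ≡ conv F G′ x + F [] * G x
conv-topʳ K F {G} {G′} h []      _ = +-comm (F [] * G []) (F [] * G′ [])
conv-topʳ K F {G} {G′} h (b ∷ x) (s≤s x≤K) = trans
  (cong (λ c → F [] * G (b ∷ x) + c + F [] * G′ (b ∷ x)) (conv-cong {F = λ y → F (b ∷ y)} x (λ _ _ → refl) (λ y y≤x → h y (≤-trans y≤x x≤K))))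
  (exchange (F [] * G (b ∷ x)) _ (F [] * G′ (b ∷ x)))
  where
  exchange : ∀ a b c → a + b + c ≡ c + b + a
  exchange = solve-∀

-- The mirror image, with weight `G []`. Since `conv` peels letters off the left, each step replaces
-- F by F ∘ (b ∷_) and lowers K by one.
conv-topˡ : ∀ K {F F′} G → (∀ y → length y ≤ K → F y ≡ F′ y) → ∀ x → length x ≤ suc K →
  conv F G x + F′ x * G [] ≡ conv F′ G x + F x * G []
conv-topˡ K {F} {F′} G h []      _ = +-comm (F [] * G []) (F′ [] * G [])
conv-topˡ zero {F} {F′} G h (b ∷ []) _ = trans
  (cong (λ c → c * G (b ∷ []) + F (b ∷ []) * G [] + F′ (b ∷ []) * G []) (h [] z≤n))
  (exchange (F′ [] * G (b ∷ [])) (F (b ∷ []) * G []) _)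
  where
  exchange : ∀ a b c → a + b + c ≡ a + c + b
  exchange = solve-∀
conv-topˡ zero G h (b ∷ c ∷ x) (s≤s ())
conv-topˡ (suc K) {F} {F′} G h (b ∷ x) (s≤s x≤K) = begin
  F [] * G (b ∷ x) + conv (F ∘ (b ∷_)) G x + F′ (b ∷ x) * G []
    ≡⟨ +-assoc (F [] * G (b ∷ x)) _ _ ⟩
  F [] * G (b ∷ x) + (conv (F ∘ (b ∷_)) G x + F′ (b ∷ x) * G [])
    ≡⟨ cong₂ _+_ (cong (_* G (b ∷ x)) (h [] z≤n)) (conv-topˡ K G (λ y y≤K → h (b ∷ y) (s≤s y≤K)) x x≤K) ⟩
  F′ [] * G (b ∷ x) + (conv (F′ ∘ (b ∷_)) G x + F (b ∷ x) * G [])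
    ≡⟨ +-assoc (F′ [] * G (b ∷ x)) _ _ ⟨
  F′ [] * G (b ∷ x) + conv (F′ ∘ (b ∷_)) G x + F (b ∷ x) * G [] ∎

cat : (ℕ → List ℕ) → ℕ → (ℕ → ℕ) → List ℕ
cat B zero    z = []
cat B (suc g) z = B (z 0) ++ cat B g (z ∘ suc)

cat-∼-low : ∀ {K B} → (∀ y y′ → B y ∼[ K ] B y′) → ∀ g z z′ → cat B g z ∼[ K ] cat B g z′
cat-∼-low {K} h zero    z z′ = ∼-refl {K} {[]}
cat-∼-low {K} {B} h (suc g) z z′ = ∼-++ {K} {B (z 0)} {B (z′ 0)} (h (z 0) (z′ 0)) (cat-∼-low h g (z ∘ suc) (z′ ∘ suc))

-- Since all B y agree up to length K, a subword of length K + 1 distinguishes the blocks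
-- only when it lies inside a single one.
cat-binom : ∀ {K B} → (∀ y y′ → B y ∼[ K ] B y′) → ∀ g z x → length x ≤ suc K →
  binom (cat B g z) x + g * binom (B 0) x ≡ binom (cat B g (λ _ → 0)) x + ∑ g (λ h → binom (B (z h)) x)
cat-binom h zero    z x _ = refl
-- `G′ x` is added on both sides so that the exchanges `eq₁` (first block to `B 0`) and `eq₂`
-- (remaining blocks to copies of `B 0`) can be stated without subtraction.
cat-binom {K} {B} h (suc g) z x x≤K = +-cancelʳ-≡ (G′ x) _ _ (begin
  binom (B (z 0) ++ cat B g (z ∘ suc)) x + (B₀ x + g * B₀ x) + G′ x
    ≡⟨ cong (λ c → c + (B₀ x + g * B₀ x) + G′ x) (binom-++ (B (z 0)) (cat B g (z ∘ suc)) x) ⟩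
  conv F G x + (B₀ x + g * B₀ x) + G′ x
    ≡⟨ r₁ (conv F G x) (B₀ x) (g * B₀ x) (G′ x) ⟩
  (conv F G x + B₀ x) + G′ x + g * B₀ x
    ≡⟨ cong (λ c → c + G′ x + g * B₀ x) eq₁ ⟩
  (conv B₀ G x + F x) + G′ x + g * B₀ x
    ≡⟨ r₂ (conv B₀ G x) (F x) (G′ x) (g * B₀ x) ⟩
  (conv B₀ G x + G′ x) + F x + g * B₀ x
    ≡⟨ cong (λ c → c + F x + g * B₀ x) eq₂ ⟩
  (conv B₀ G′ x + G x) + F x + g * B₀ x
    ≡⟨ r₃ (conv B₀ G′ x) (G x) (F x) (g * B₀ x) ⟩
  conv B₀ G′ x + F x + (G x + g * B₀ x)
    ≡⟨ cong (conv B₀ G′ x + F x +_) (cat-binom h g (z ∘ suc) x x≤K) ⟩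
  conv B₀ G′ x + F x + (G′ x + ∑ g (λ k → binom (B (z (suc k))) x))
    ≡⟨ r₄ (conv B₀ G′ x) (F x) (G′ x) _ ⟩
  conv B₀ G′ x + (F x + ∑ g (λ k → binom (B (z (suc k))) x)) + G′ x
    ≡⟨ cong (λ c → c + (F x + ∑ g (λ k → binom (B (z (suc k))) x)) + G′ x) (binom-++ (B 0) (cat B g (λ _ → 0)) x) ⟨
  binom (B 0 ++ cat B g (λ _ → 0)) x + (F x + ∑ g (λ k → binom (B (z (suc k))) x)) + G′ x ∎)
  where
  F B₀ G G′ : List ℕ → ℕ
  F  = binom (B (z 0))
  B₀ = binom (B 0)
  G  = binom (cat B g (z ∘ suc))
  G′ = binom (cat B g (λ _ → 0))
  eq₁ : conv F G x + B₀ x ≡ conv B₀ G x + F x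
  eq₁ = subst₂ _≡_ (cong (conv F G x +_) (unit B₀)) (cong (conv B₀ G x +_) (unit F)) (conv-topˡ K G (h (z 0) 0) x x≤K)
    where
    unit : ∀ H → H x * G [] ≡ H x
    unit H = trans (cong (H x *_) (binom-[] (cat B g (z ∘ suc)))) (*-identityʳ (H x))
  eq₂ : conv B₀ G x + G′ x ≡ conv B₀ G′ x + G x
  eq₂ = subst₂ _≡_ (cong (conv B₀ G x +_) (unit G′)) (cong (conv B₀ G′ x +_) (unit G))
          (conv-topʳ K B₀ (cat-∼-low h g (z ∘ suc) (λ _ → 0)) x x≤K)
    where
    unit : ∀ H → B₀ [] * H x ≡ H x
    unit H = trans (cong (_* H x) (binom-[] (B 0))) (*-identityˡ (H x))
  r₁ : ∀ a b c d → a + (b + c) + d ≡ a + b + d + c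
  r₁ = solve-∀
  r₂ : ∀ a b c d → a + b + c + d ≡ a + c + b + d
  r₂ = solve-∀
  r₃ : ∀ a b c d → a + b + c + d ≡ a + c + (b + d)
  r₃ = solve-∀
  r₄ : ∀ a b c d → a + b + (c + d) ≡ a + (b + d) + c
  r₄ = solve-∀

-- Newton expansions and finite differences.

-- f is an integer-valued polynomial of degree at most d with natural iterated differences.
Poly : ℕ → (ℕ → ℕ) → Set
Poly zero    f = ∀ q → f q ≡ f 0
Poly (suc d) f = Σ (ℕ → ℕ) λ g → Poly d g × (∀ q → f (suc q) ≡ f q + g q)

Poly-suc : ∀ d {f} → Poly d f → Poly d (f ∘ suc)
Poly-suc zero    p q = trans (p (suc q)) (sym (p 1))
Poly-suc (suc d) (g , pg , Δ) = g ∘ suc , Poly-suc d pg , Δ ∘ suc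

Poly-+ : ∀ d {f f′} → Poly d f → Poly d f′ → Poly d (λ q → f q + f′ q)
Poly-+ zero    p p′ q = cong₂ _+_ (p q) (p′ q)
Poly-+ (suc d) {f} {f′} (g , pg , Δ) (g′ , pg′ , Δ′) =
  (λ q → g q + g′ q) , Poly-+ d pg pg′ , λ q → trans (cong₂ _+_ (Δ q) (Δ′ q)) (+-interchange (f q) (g q) (f′ q) (g′ q))

-- Discrete product rule: the difference of (q + c) f q is f q + (q + 1 + c) g q, where g is the
-- difference of f.
Poly-linear : ∀ d c {f} → Poly d f → Poly (suc d) (λ q → (q + c) * f q)
Poly-linear zero    c {f} p = f , p , λ q → trans (cong (suc (q + c) *_) (trans (p (suc q)) (sym (p q)))) (+-comm (f q) _)
Poly-linear (suc d) c {f} (g , pg , Δ) =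
  (λ q → f q + (q + suc c) * g q) , Poly-+ (suc d) {f} (g , pg , Δ) (Poly-linear d (suc c) pg) ,
  λ q → trans (cong (suc (q + c) *_) (Δ q)) (eq q c (f q) (g q))
  where
  eq : ∀ q c a b → suc (q + c) * (a + b) ≡ (q + c) * a + (a + (q + suc c) * b)
  eq = solve-∀

Poly-power : ∀ e c → Poly e (λ q → (q + c) ^ e)
Poly-power zero    c q = refl
Poly-power (suc e) c = Poly-linear e c (Poly-power e c)

-- Newton's forward formula, the sum of (Δ^e f)(0) * ρ e for e ≤ d; here ρ e takes the place of the
-- binomial coefficient of q over e.
expand : ∀ d {f} → Poly d f → (ℕ → ℕ) → ℕ
expand zero    {f} _            ρ = f 0 * ρ 0
expand (suc d) {f} (g , pg , _) ρ = f 0 * ρ 0 + expand d pg (ρ ∘ suc)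

expand-cong : ∀ d {f} (p : Poly d f) {ρ ρ′} → (∀ e → e ≤ d → ρ e ≡ ρ′ e) → expand d p ρ ≡ expand d p ρ′
expand-cong zero    {f} p h = cong (f 0 *_) (h 0 z≤n)
expand-cong (suc d) {f} (g , pg , _) h = cong₂ _+_ (cong (f 0 *_) (h 0 z≤n)) (expand-cong d pg (λ e e≤d → h (suc e) (s≤s e≤d)))

expand-0 : ∀ d {f} (p : Poly d f) {ρ} → (∀ e → ρ e ≡ 0) → expand d p ρ ≡ 0
expand-0 zero    {f} p h = trans (cong (f 0 *_) (h 0)) (*-zeroʳ (f 0))
expand-0 (suc d) {f} (g , pg , _) h = cong₂ _+_ (trans (cong (f 0 *_) (h 0)) (*-zeroʳ (f 0))) (expand-0 d pg (h ∘ suc))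

expand-+ : ∀ d {f} (p : Poly d f) ρ ρ′ → expand d p (λ e → ρ e + ρ′ e) ≡ expand d p ρ + expand d p ρ′
expand-+ zero    {f} p ρ ρ′ = *-distribˡ-+ (f 0) (ρ 0) (ρ′ 0)
expand-+ (suc d) {f} (g , pg , _) ρ ρ′ = trans
  (cong₂ _+_ (*-distribˡ-+ (f 0) (ρ 0) (ρ′ 0)) (expand-+ d pg (ρ ∘ suc) (ρ′ ∘ suc)))
  (+-interchange (f 0 * ρ 0) (f 0 * ρ′ 0) _ _)

-- Passing from f q to f (q + 1) turns (Δ^e f)(0) into (Δ^e f)(0) + (Δ^(e+1) f)(0).
expand-suc : ∀ d {f} (p : Poly (suc d) f) ρ →
  expand (suc d) (Poly-suc (suc d) p) ρ ≡ expand (suc d) p ρ + expand d (proj₁ (proj₂ p)) ρ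
expand-suc zero {f} (g , pg , Δ) ρ = trans
  (cong₂ (λ a b → a * ρ 0 + b * ρ 1) (Δ 0) (pg 1))
  (eq (f 0) (g 0) (ρ 0) (ρ 1))
  where
  eq : ∀ a b c d → (a + b) * c + b * d ≡ a * c + b * d + b * c
  eq = solve-∀
expand-suc (suc d) {f} (g , pg , Δ) ρ = trans
  (cong₂ (λ a b → a * ρ 0 + b) (Δ 0) (expand-suc d pg (ρ ∘ suc)))
  (eq (f 0) (g 0) (ρ 0) _ _)
  where
  eq : ∀ a b c d e → (a + b) * c + (d + e) ≡ a * c + d + (b * c + e)
  eq = solve-∀

-- Polynomials of degree below d with natural coefficients, given inductively so that a property of
-- the powers H ^ i with i < d extends to them by recursion.
data Low (d : ℕ) : (ℕ → ℕ) → Set where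
  low-0   : Low d (λ _ → 0)
  low-^   : ∀ {i} → i < d → Low d (_^ i)
  low-+   : ∀ {F G} → Low d F → Low d G → Low d (λ H → F H + G H)
  low-*   : ∀ a {F} → Low d F → Low d (λ H → a * F H)
  low-ext : ∀ {F G} → (∀ H → F H ≡ G H) → Low d F → Low d G

low-suc : ∀ {d F} → Low d F → Low (suc d) F
low-suc low-0         = low-0
low-suc (low-^ i<d)   = low-^ (m≤n⇒m≤1+n i<d)
low-suc (low-+ p q)   = low-+ (low-suc p) (low-suc q)
low-suc (low-* a p)   = low-* a (low-suc p)
low-suc (low-ext h p) = low-ext h (low-suc p)

low-shift : ∀ {d F} → Low d F → Low (suc d) (λ H → H * F H)
low-shift low-0         = low-ext (λ H → sym (*-zeroʳ H)) low-0
low-shift (low-^ i<d)   = low-^ (s≤s i<d)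
low-shift (low-+ {F} {G} p q) = low-ext (λ H → sym (*-distribˡ-+ H (F H) (G H))) (low-+ (low-shift p) (low-shift q))
low-shift (low-* a {F} p) = low-ext (λ H → eq a H (F H)) (low-* a (low-shift p))
  where
  eq : ∀ a H x → a * (H * x) ≡ H * (a * x)
  eq = solve-∀
low-shift (low-ext h p) = low-ext (λ H → cong (H *_) (h H)) (low-shift p)

-- What remains of (H + 1)^(e+1) after H^(e+1) and (e + 1) H^e; the recursion follows multiplication
-- by H + 1, so that the degree stays visibly below e.
pow-tail : ℕ → ℕ → ℕ
pow-tail zero    H = 0
pow-tail (suc e) H = H * pow-tail e H + (pow-tail e H + suc e * H ^ e)

pow-tail-low : ∀ e → Low e (pow-tail e)
pow-tail-low zero    = low-0
pow-tail-low (suc e) = low-+ (low-shift (pow-tail-low e)) (low-+ (low-suc (pow-tail-low e)) (low-* (suc e) (low-^ ≤-refl)))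

suc-^ : ∀ e H → suc H ^ suc e ≡ H ^ suc e + (suc e * H ^ e + pow-tail e H)
suc-^ zero    H = eq H
  where
  eq : ∀ H → suc H * 1 ≡ H * 1 + (1 * 1 + 0)
  eq = solve-∀
suc-^ (suc e) H = trans (cong (suc H *_) (suc-^ e H)) (eq e H (H ^ e) (pow-tail e H))
  where
  eq : ∀ e H p l → suc H * (H * p + (suc e * p + l)) ≡ H * (H * p) + (suc (suc e) * (H * p) + (H * l + (l + suc e * p)))
  eq = solve-∀

-- The two equations say P - Q = R - L and P - Q = R′ - L′ without subtraction.
cross : ∀ P Q {L R L′ R′} → P + L ≡ Q + R → P + L′ ≡ Q + R′ → L + R′ ≡ L′ + R
cross P Q {L} {R} {L′} {R′} p p′ = +-cancelˡ-≡ (P + Q) _ _ (begin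
  P + Q + (L + R′)     ≡⟨ +-interchange P Q L R′ ⟩
  P + L + (Q + R′)     ≡⟨ cong₂ _+_ p (sym p′) ⟩
  Q + R + (P + L′)     ≡⟨ eq Q R P L′ ⟩
  P + Q + (L′ + R)     ∎)
  where
  eq : ∀ Q R P L → Q + R + (P + L) ≡ P + Q + (L + R)
  eq = solve-∀

^-distribʳ-* : ∀ E a b → (a * b) ^ E ≡ a ^ E * b ^ E
^-distribʳ-* zero    a b = refl
^-distribʳ-* (suc E) a b = trans (cong (a * b *_) (^-distribʳ-* E a b)) (eq a b (a ^ E) (b ^ E))
  where
  eq : ∀ a b x y → a * b * (x * y) ≡ a * x * (b * y)
  eq = solve-∀

-- Counting the classes of a relation on a subset.

record ClassCount {X : Set} (P : X → Set) (_~_ : X → X → Set) (N : ℕ) : Set where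
  field
    rep      : Fin N → X
    rep∈     : ∀ a → P (rep a)
    distinct : ∀ a b → rep a ~ rep b → a ≡ b
    cover    : ∀ x → P x → ∃ λ a → x ~ rep a

open ClassCount

from-index : ∀ {X Y : Set} {P : X → Set} {_~_ : X → X → Set} {N} → Fin N ↔ Y → (f : Y → X) → (∀ y → P (f y)) →
  (∀ y y′ → f y ~ f y′ → y ≡ y′) → (∀ x → P x → ∃ λ y → x ~ f y) → ClassCount P _~_ N
from-index {_~_ = _~_} Y↔ f f∈ inj cov = record
  { rep      = f ∘ to
  ; rep∈     = f∈ ∘ to
  ; distinct = λ a b h → trans (sym (strictlyInverseʳ a)) (trans (cong from (inj (to a) (to b) h)) (strictlyInverseʳ b))
  ; cover    = λ x px → let (y , h) = cov x px in from y , subst (λ y → x ~ f y) (sym (strictlyInverseˡ y)) h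
  }
  where open Inverse Y↔

module _ {X : Set} {_~_ : X → X → Set} where

  single : ∀ {P : X → Set} x₀ → P x₀ → (∀ x → P x → x ~ x₀) → ClassCount P _~_ 1
  single x₀ p₀ h = record
    { rep = λ _ → x₀ ; rep∈ = λ _ → p₀ ; distinct = λ { zero zero _ → refl } ; cover = λ x px → zero , h x px }

  none : ∀ {P : X → Set} → (∀ x → ¬ P x) → ClassCount P _~_ 0
  none h = record { rep = λ () ; rep∈ = λ () ; distinct = λ () ; cover = λ x px → ⊥-elim (h x px) }

  restrict : ∀ {P Q : X → Set} {N} → (∀ x → P x → Q x) → (∀ x → Q x → P x) → ClassCount P _~_ N → ClassCount Q _~_ N
  restrict f g c = record
    { rep = rep c ; rep∈ = λ a → f _ (rep∈ c a) ; distinct = distinct c ; cover = λ x qx → cover c x (g x qx) }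

  rerelate : ∀ {P : X → Set} {_≋_ : X → X → Set} {N} → (∀ x y → x ~ y → x ≋ y) → (∀ x y → x ≋ y → x ~ y) →
    ClassCount P _~_ N → ClassCount P _≋_ N
  rerelate to from c = record
    { rep = rep c ; rep∈ = rep∈ c ; distinct = λ a b h → distinct c a b (from _ _ h)
    ; cover = λ x px → let (a , h) = cover c x px in a , to _ _ h }

  union : ∀ {P Q : X → Set} {N N′} → (∀ {x y} → x ~ y → y ~ x) → (∀ x y → P x → Q y → ¬ x ~ y) →
    ClassCount P _~_ N → ClassCount Q _~_ N′ → ClassCount (λ x → P x ⊎ Q x) _~_ (N + N′)
  union {P} {Q} {N} {N′} ~-sym apart c c′ = from-index +↔⊎ f f∈ inj cov
    where
    f : Fin N ⊎ Fin N′ → X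
    f (inj₁ a) = rep c a
    f (inj₂ b) = rep c′ b
    f∈ : ∀ y → P (f y) ⊎ Q (f y)
    f∈ (inj₁ a) = inj₁ (rep∈ c a)
    f∈ (inj₂ b) = inj₂ (rep∈ c′ b)
    inj : ∀ y y′ → f y ~ f y′ → y ≡ y′
    inj (inj₁ a) (inj₁ b) h = cong inj₁ (distinct c a b h)
    inj (inj₂ a) (inj₂ b) h = cong inj₂ (distinct c′ a b h)
    inj (inj₁ a) (inj₂ b) h = ⊥-elim (apart _ _ (rep∈ c a) (rep∈ c′ b) h)
    inj (inj₂ a) (inj₁ b) h = ⊥-elim (apart _ _ (rep∈ c b) (rep∈ c′ a) (~-sym h))
    cov : ∀ x → P x ⊎ Q x → ∃ λ y → x ~ f y
    cov x (inj₁ px) = let (a , h) = cover c x px in inj₁ a , h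
    cov x (inj₂ qx) = let (b , h) = cover c′ x qx in inj₂ b , h

  -- A correspondence total on both sides replaces a bijection: one object may have several partners
  -- in either direction, as long as `Rel` matches the two relations.
  transfer : ∀ {Z : Set} {P : X → Set} {Q : Z → Set} {_≋_ : Z → Z → Set} (Rel : X → Z → Set) →
    (∀ x → P x → ∃ λ z → Q z × Rel x z) → (∀ z → Q z → ∃ λ x → P x × Rel x z) →
    (∀ {x x′ z z′} → Rel x z → Rel x′ z′ → x ~ x′ → z ≋ z′) →
    (∀ {x x′ z z′} → Rel x z → Rel x′ z′ → z ≋ z′ → x ~ x′) →
    ∀ {N} → ClassCount P _~_ N → ClassCount Q _≋_ N
  transfer Rel right left to from c = record
    { rep      = λ a → proj₁ (image a)
    ; rep∈     = λ a → proj₁ (proj₂ (image a))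
    ; distinct = λ a b h → distinct c a b (from (proj₂ (proj₂ (image a))) (proj₂ (proj₂ (image b))) h)
    ; cover    = λ z qz → let (x , px , r) = left z qz ; (a , h) = cover c x px in a , to r (proj₂ (proj₂ (image a))) h
    }
    where
    image = λ a → right (rep c a) (rep∈ c a)

  -- The index `r` is an invariant of the relation, so the slices `Q r` contribute independently.
  range : (Q : ℕ → X → Set) → (∀ {x y} → x ~ y → y ~ x) → (∀ {r r′ x y} → Q r x → Q r′ y → x ~ y → r ≡ r′) →
    ∀ {N} lo c → (∀ r → lo ≤ r → r < lo + c → ClassCount (Q r) _~_ N) →
    ClassCount (λ x → ∃ λ r → lo ≤ r × r < lo + c × Q r x) _~_ (c * N)
  range Q ~-sym apart lo zero    h = none λ { x (r , lo≤r , r<lo , _) → <⇒≱ r<lo (≤-trans (≤-reflexive (+-identityʳ lo)) lo≤r) }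
  range Q ~-sym apart lo (suc c) h = restrict to from (union ~-sym
    (λ { x y q (r , lo<r , _ , q′) x~y → <-irrefl (apart q q′ x~y) lo<r })
    (h lo ≤-refl (m<m+n lo z<s))
    (range Q ~-sym apart (suc lo) c (λ r lo<r r< → h r (<⇒≤ lo<r) (subst (r <_) (sym (+-suc lo c)) r<))))
    where
    to : ∀ x → Q lo x ⊎ (∃ λ r → suc lo ≤ r × r < suc lo + c × Q r x) → ∃ λ r → lo ≤ r × r < lo + suc c × Q r x
    to x (inj₁ q)                   = lo , ≤-refl , m<m+n lo z<s , q
    to x (inj₂ (r , lo<r , r< , q)) = r , <⇒≤ lo<r , subst (r <_) (sym (+-suc lo c)) r< , q
    from : ∀ x → (∃ λ r → lo ≤ r × r < lo + suc c × Q r x) → Q lo x ⊎ (∃ λ r → suc lo ≤ r × r < suc lo + c × Q r x)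
    from x (r , lo≤r , r< , q) with lo ≟ r
    ... | yes refl = inj₁ q
    ... | no lo≢r  = inj₂ (r , ≤∧≢⇒< lo≤r lo≢r , subst (r <_) (+-suc lo c) r< , q)

-- A representative is dropped when it is equivalent to one already kept. The size N is not
-- computed; the abelian complexity enters the theorem only through its existence.
finite : ∀ {X : Set} {_~_ : X → X → Set} → IsDecEquivalence _~_ →
  ∀ S (f : Fin S → X) → ∃ λ N → ClassCount (λ x → ∃ λ s → x ~ f s) _~_ N
finite eq zero    f = 0 , none λ { x (() , _) }
finite {X} {_~_} eq (suc S) f with finite eq S (f ∘ suc)
... | N , c with any? (λ a → IsDecEquivalence._≟_ eq (f zero) (rep c a))
...   | yes (a , h) = N , record
  { rep = rep c ; rep∈ = λ b → let (s , p) = rep∈ c b in suc s , p ; distinct = distinct c ; cover = cov }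
  where
  open IsDecEquivalence eq using () renaming (trans to ~-trans)
  cov : ∀ x → (∃ λ s → x ~ f s) → ∃ λ b → x ~ rep c b
  cov x (zero  , p) = a , ~-trans p h
  cov x (suc s , p) = cover c x (s , p)
...   | no ¬h = suc N , restrict to from (union ~-sym apart (single (f zero) ~-refl (λ _ p → p)) c)
  where
  open IsDecEquivalence eq using () renaming (refl to ~-refl; sym to ~-sym; trans to ~-trans)
  apart : ∀ x y → x ~ f zero → (∃ λ s → y ~ f (suc s)) → ¬ x ~ y
  apart x y p q x~y = let (a , r) = cover c y q in ¬h (a , ~-trans (~-sym p) (~-trans x~y r))
  to : ∀ x → x ~ f zero ⊎ (∃ λ s → x ~ f (suc s)) → ∃ λ s → x ~ f s
  to x (inj₁ p)       = zero , p
  to x (inj₂ (s , p)) = suc s , p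
  from : ∀ x → (∃ λ s → x ~ f s) → x ~ f zero ⊎ (∃ λ s → x ~ f (suc s))
  from x (zero  , p) = inj₁ p
  from x (suc s , p) = inj₂ (s , p)

triangle : ℕ → ℕ
triangle zero    = 0
triangle (suc n) = suc n + triangle n

2*triangle : ∀ n → 2 * triangle n ≡ n * suc n
2*triangle zero    = refl
2*triangle (suc n) = trans (*-distribˡ-+ 2 (suc n) (triangle n)) (trans (cong (2 * suc n +_) (2*triangle n)) (eq n))
  where
  eq : ∀ n → 2 * suc n + n * suc n ≡ suc n * suc (suc n)
  eq = solve-∀

-- Normal forms of unordered pairs, repetition allowed, from {1, ..., n}.
Sorted : ℕ → ℕ × ℕ → Set
Sorted n (γ , α) = 1 ≤ γ × γ ≤ α × α ≤ n

sorted-count : ∀ n → ClassCount (Sorted n) _≡_ (triangle n)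
sorted-count zero    = none λ { (γ , α) (1≤γ , γ≤α , α≤0) → <⇒≱ (<-≤-trans 1≤γ γ≤α) α≤0 }
sorted-count (suc n) = restrict to from (union sym
  (λ { x y (p , _) (_ , _ , α≤n) refl → <-irrefl refl (subst (_≤ n) p α≤n) }) top (sorted-count n))
  where
  Top : ℕ × ℕ → Set
  Top (γ , α) = α ≡ suc n × 1 ≤ γ × γ ≤ suc n
  top : ClassCount Top _≡_ (suc n)
  top = record
    { rep      = λ a → suc (toℕ a) , suc n
    ; rep∈     = λ a → refl , s≤s z≤n , toℕ<n a
    ; distinct = λ a b h → toℕ-injective (suc-injective (cong proj₁ h))
    ; cover    = λ { (suc γ , _) (refl , _ , γ<n) → fromℕ< γ<n , cong (λ x → suc x , suc n) (sym (toℕ-fromℕ< γ<n)) }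
    }
  to : ∀ x → Top x ⊎ Sorted n x → Sorted (suc n) x
  to x (inj₁ (refl , 1≤γ , γ≤)) = 1≤γ , γ≤ , ≤-refl
  to x (inj₂ (1≤γ , γ≤α , α≤n)) = 1≤γ , γ≤α , m≤n⇒m≤1+n α≤n
  from : ∀ x → Sorted (suc n) x → Top x ⊎ Sorted n x
  from (γ , α) (1≤γ , γ≤α , α≤) with α ≟ suc n
  ... | yes refl = inj₁ (refl , 1≤γ , γ≤α)
  ... | no α≢    = inj₂ (1≤γ , γ≤α , s≤s⁻¹ (≤∧≢⇒< α≤ α≢))

-- The letters of t_m as digit sums.

module ThueMorse (m : ℕ) .{{_ : NonZero m}} (2≤m : 2 ≤ m) where
  open Residues m public

  length-σ-run : ∀ i r → length (σ-run m i r) ≡ r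
  length-σ-run i zero    = refl
  length-σ-run i (suc r) = trans (length-++ (σ-run m i r)) (trans (+-comm _ 1) (cong suc (length-σ-run i r)))

  σ-letter≡σ-run : ∀ i → σ-letter m i ≡ σ-run m i m
  σ-letter≡σ-run i = helper m
    where
    helper : ∀ m → σ-letter m i ≡ σ-run m i m
    helper zero    = refl
    helper (suc m) = refl

  nth-σ-run : ∀ i r s → s < r → nth (σ-run m i r) s ≡ (i + s) % m
  nth-σ-run i (suc r) s s<1+r with s ≟ r
  ... | yes refl = begin
      nth (σ-run m i r ++ ((i + r) mod m ∷ [])) r
        ≡⟨ cong (nth (σ-run m i (suc r))) (trans (sym (+-identityʳ r)) (cong (_+ 0) (sym (length-σ-run i r)))) ⟩
      nth (σ-run m i r ++ ((i + r) mod m ∷ [])) (length (σ-run m i r) + 0)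
        ≡⟨ nth-++ʳ (σ-run m i r) _ 0 ⟩
      (i + r) mod m  ≡⟨ mod≡% (i + r) m ⟩
      (i + r) % m    ∎
  ... | no s≢r = trans (nth-++ˡ (σ-run m i r) _ s (subst (s <_) (sym (length-σ-run i r)) s<r)) (nth-σ-run i r s s<r)
    where s<r = ≤∧≢⇒< (s≤s⁻¹ s<1+r) s≢r

  length-σ-letter : ∀ i → length (σ-letter m i) ≡ m
  length-σ-letter i = trans (cong length (σ-letter≡σ-run i)) (length-σ-run i m)

  length-σ : ∀ w → length (σ m w) ≡ length w * m
  length-σ []      = refl
  length-σ (x ∷ w) = trans (length-++ (σ-letter m x)) (cong₂ _+_ (length-σ-letter x) (length-σ w))

  length-σ^ : ∀ j → length (σ^ m j (0 ∷ [])) ≡ m ^ j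
  length-σ^ zero    = refl
  length-σ^ (suc j) = trans (length-σ (σ^ m j (0 ∷ []))) (trans (cong (_* m) (length-σ^ j)) (*-comm (m ^ j) m))

  nth-σ : ∀ w q s → q < length w → s < m → nth (σ m w) (q * m + s) ≡ (nth w q + s) % m
  nth-σ (x ∷ w) zero    s _ s<m =
    trans (nth-++ˡ (σ-letter m x) _ s (subst (s <_) (sym (length-σ-letter x)) s<m))
          (trans (cong (λ u → nth u s) (σ-letter≡σ-run x)) (nth-σ-run x m s s<m))
  nth-σ (x ∷ w) (suc q) s (s≤s q<w) s<m = begin
    nth (σ-letter m x ++ σ m w) (m + q * m + s)
      ≡⟨ cong (nth (σ-letter m x ++ σ m w)) (trans (+-assoc m (q * m) s) (cong (_+ (q * m + s)) (sym (length-σ-letter x)))) ⟩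
    nth (σ-letter m x ++ σ m w) (length (σ-letter m x) + (q * m + s))
      ≡⟨ nth-++ʳ (σ-letter m x) (σ m w) (q * m + s) ⟩
    nth (σ m w) (q * m + s)  ≡⟨ nth-σ w q s q<w s<m ⟩
    (nth w q + s) % m        ∎

  quot< : ∀ q s j → q * m + s < m ^ suc j → q < m ^ j
  quot< q s j h = *-cancelʳ-< _ _ _ (subst (q * m <_) (*-comm m (m ^ j)) (≤-<-trans (m≤m+n (q * m) s) h))

  σ^-stable : ∀ j n → n < m ^ j → nth (σ^ m (suc j) (0 ∷ [])) n ≡ nth (σ^ m j (0 ∷ [])) n
  σ^-stable zero    zero _ = trans (nth-σ (0 ∷ []) 0 0 z<s (<-trans z<s 2≤m)) (m<n⇒m%n≡m (<-trans z<s 2≤m))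
  σ^-stable zero    (suc n) (s≤s ())
  σ^-stable (suc j) n n<m^j with divMod m n
  ... | q , s , refl , s<m = begin
    nth (σ m (σ^ m (suc j) (0 ∷ []))) (q * m + s)
      ≡⟨ nth-σ (σ^ m (suc j) (0 ∷ [])) q s (subst (q <_) (sym (length-σ^ (suc j))) (<-≤-trans q<m^j (m≤n*m (m ^ j) m))) s<m ⟩
    (nth (σ^ m (suc j) (0 ∷ [])) q + s) % m
      ≡⟨ cong (λ x → (x + s) % m) (σ^-stable j q q<m^j) ⟩
    (nth (σ^ m j (0 ∷ [])) q + s) % m
      ≡⟨ nth-σ (σ^ m j (0 ∷ [])) q s (subst (q <_) (sym (length-σ^ j)) q<m^j) s<m ⟨
    nth (σ m (σ^ m j (0 ∷ []))) (q * m + s) ∎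
    where q<m^j = quot< q s j n<m^j

  n<m^n : ∀ n → n < m ^ n
  n<m^n zero    = z<s
  n<m^n (suc n) = <-≤-trans (s<s (n<m^n n)) (≤-trans (+-mono-≤ (≤-trans z<s (n<m^n n)) (≤-reflexive (sym (+-identityʳ (m ^ n))))) (*-monoˡ-≤ (m ^ n) 2≤m))

  -- `t` reads its n-th letter off the iterate n + 1; stability moves this to any iterate that is
  -- long enough, in either direction.
  σ^-limit : ∀ j n → n < m ^ j → nth (σ^ m j (0 ∷ [])) n ≡ t m n
  σ^-limit j n n<m^j with ≤-total j (suc n)
  ... | inj₁ j≤n = helper (suc n ∸ j) (m∸n+n≡m j≤n)
    where
    helper : ∀ d → ∀ {J} → d + j ≡ J → nth (σ^ m j (0 ∷ [])) n ≡ nth (σ^ m J (0 ∷ [])) n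
    helper zero    refl = refl
    helper (suc d) refl = trans (helper d refl) (sym (σ^-stable (d + j) n (<-≤-trans n<m^j (^-monoʳ-≤ m (m≤n+m j d)))))
  ... | inj₂ n<j = helper (j ∸ suc n) (m∸n+n≡m n<j)
    where
    helper : ∀ d → ∀ {J} → d + suc n ≡ J → nth (σ^ m J (0 ∷ [])) n ≡ t m n
    helper zero    refl = refl
    helper (suc d) refl = trans (σ^-stable (d + suc n) n (<-≤-trans (n<m^n n) (^-monoʳ-≤ m (≤-trans (n≤1+n n) (m≤n+m (suc n) d))))) (helper d refl)

  T : ℕ → ℕ
  T = t m

  -- t_m is a fixed point of σ: its letter at N is read off σ (σ^N(0)), so the letter of its block
  -- is read off σ^N(0).
  T-block : ∀ q s → s < m → T (q * m + s) ≡ (T q + s) % m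
  T-block q s s<m = begin
    nth (σ m (σ^ m N (0 ∷ []))) N  ≡⟨ nth-σ (σ^ m N (0 ∷ [])) q s q<len s<m ⟩
    (nth (σ^ m N (0 ∷ [])) q + s) % m  ≡⟨ cong (λ x → (x + s) % m) (σ^-limit N q (<-≤-trans (n<m^n q) (^-monoʳ-≤ m q≤N))) ⟩
    (T q + s) % m ∎
    where
    N = q * m + s
    q≤N : q ≤ N
    q≤N = ≤-trans (m≤m*n q m) (m≤m+n (q * m) s)
    q<len : q < length (σ^ m N (0 ∷ []))
    q<len = subst (q <_) (sym (length-σ^ N)) (<-≤-trans (n<m^n q) (^-monoʳ-≤ m q≤N))

  T<m : ∀ n → T n < m
  T<m n with divMod m n
  ... | q , s , refl , s<m = subst (_< m) (sym (T-block q s s<m)) (m%n<n (T q + s) m)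

  T-block-≈ : ∀ q s → s < m → T (q * m + s) ≈ T q + s
  T-block-≈ q s s<m = trans (≈-reflexive (T-block q s s<m)) (%-≈ (T q + s))

  T-small : ∀ s → s < m → T s ≡ s
  T-small s s<m = begin
    T s           ≡⟨ T-block 0 s s<m ⟩
    (T 0 + s) % m ≡⟨ cong (λ x → (x + s) % m) (σ^-stable 0 0 z<s) ⟩
    s % m         ≡⟨ m<n⇒m%n≡m s<m ⟩
    s             ∎

  T-cong : ∀ a b → T a ≈ T b → T a ≡ T b
  T-cong a b = small-≈ (T<m a) (T<m b)

  -- The letter at a position is its base-m digit sum; splitting the digits at level K adds.
  T-level : ∀ K q s → s < m ^ K → T (q * m ^ K + s) ≈ T q + T s
  T-level zero    q zero _ = ≈-reflexive (trans (cong T (trans (+-identityʳ _) (*-identityʳ q)))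
                                               (trans (sym (+-identityʳ (T q))) (cong (T q +_) (sym (T-small 0 (<-trans z<s 2≤m))))))
  T-level zero    q (suc s) (s≤s ())
  T-level (suc K) q s s<M with divMod m s
  ... | s₁ , s₀ , refl , s₀<m = begin
    T (q * m ^ suc K + (s₁ * m + s₀)) % m ≡⟨ ≈-reflexive (cong T (rearrange q m (m ^ K) s₁ s₀)) ⟩
    T ((q * m ^ K + s₁) * m + s₀) % m     ≡⟨ T-block-≈ (q * m ^ K + s₁) s₀ s₀<m ⟩
    (T (q * m ^ K + s₁) + s₀) % m         ≡⟨ +-cong-≈ {b = s₀} (T-level K q s₁ (quot< s₁ s₀ K s<M)) refl ⟩
    (T q + T s₁ + s₀) % m                 ≡⟨ ≈-reflexive (+-assoc (T q) (T s₁) s₀) ⟩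
    (T q + (T s₁ + s₀)) % m               ≡⟨ +-cong-≈ {T q} refl (sym (T-block-≈ s₁ s₀ s₀<m)) ⟩
    (T q + T (s₁ * m + s₀)) % m           ∎
    where
    rearrange : ∀ q m M a b → q * (m * M) + (a * m + b) ≡ (q * M + a) * m + b
    rearrange = solve-∀

  -- Cutting factors into blocks: equal data give equivalent factors.

  count : ℕ → (ℕ → ℕ) → ℕ → ℕ
  count g z j = ∑ g (λ h → δ j (z h))

  ∑-by-letters : ∀ (φ : ℕ → ℕ) → (∀ {a b} → a ≈ b → φ a ≡ φ b) → ∀ g z →
    ∑ g (φ ∘ z) ≡ ∑ m (λ j → φ j * count g z j)
  ∑-by-letters φ resp g z = begin
    ∑ g (φ ∘ z)                                 ≡⟨ ∑-cong g (λ h _ → sym (∑-δ* φ resp (z h))) ⟩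
    ∑ g (λ h → ∑ m (λ j → φ j * δ j (z h)))     ≡⟨ ∑-swap g m (λ h j → φ j * δ j (z h)) ⟩
    ∑ m (λ j → ∑ g (λ h → φ j * δ j (z h)))     ≡⟨ ∑-cong m (λ j _ → ∑-* g (φ j) (λ h → δ j (z h))) ⟩
    ∑ m (λ j → φ j * count g z j)               ∎

  -- By `cat-binom` the part that depends on z is a sum over its letters, so it sees only how often
  -- each letter occurs.
  cat-∼ : ∀ {K B} → (∀ y y′ → B y ∼[ K ] B y′) → (∀ {y y′} → y ≈ y′ → B y ≡ B y′) →
    ∀ g z z′ → (∀ j → count g z j ≡ count g z′ j) → cat B g z ∼[ suc K ] cat B g z′
  cat-∼ {K} {B} h resp g z z′ same x x≤K = +-cancelʳ-≡ (g * binom (B 0) x) _ _ (begin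
    binom (cat B g z) x + g * binom (B 0) x         ≡⟨ cat-binom h g z x x≤K ⟩
    R + ∑ g (φ ∘ z)                                 ≡⟨ cong (R +_) (∑-by-letters φ resp′ g z) ⟩
    R + ∑ m (λ j → φ j * count g z j)               ≡⟨ cong (R +_) (∑-cong m (λ j _ → cong (φ j *_) (same j))) ⟩
    R + ∑ m (λ j → φ j * count g z′ j)              ≡⟨ cong (R +_) (∑-by-letters φ resp′ g z′) ⟨
    R + ∑ g (φ ∘ z′)                                ≡⟨ cat-binom h g z′ x x≤K ⟨
    binom (cat B g z′) x + g * binom (B 0) x        ∎)
    where
    R = binom (cat B g (λ _ → 0)) x
    φ : ℕ → ℕ
    φ y = binom (B y) x
    resp′ : ∀ {a b} → a ≈ b → φ a ≡ φ b
    resp′ {a} {b} p = cong (λ u → binom u x) (resp {a} {b} p)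

  -- σ^K(y)
  blk : ℕ → ℕ → List ℕ
  blk zero    y = y % m ∷ []
  blk (suc K) y = cat (blk K) m (y +_)

  cat-cong : ∀ {B} g {z z′} → (∀ h → h < g → B (z h) ≡ B (z′ h)) → cat B g z ≡ cat B g z′
  cat-cong zero    h = refl
  cat-cong (suc g) h = cong₂ _++_ (h 0 z<s) (cat-cong g (λ k k<g → h (suc k) (s<s k<g)))

  blk-resp : ∀ K {y y′} → y ≈ y′ → blk K y ≡ blk K y′
  blk-resp zero    p = cong (_∷ []) p
  blk-resp (suc K) {y} {y′} p = cat-cong m (λ h _ → blk-resp K (+-cong-≈ {y} {y′} {h} p refl))

  -- σ^(K+1)(y) is a product of σ^K-blocks in which every letter of the alphabet occurs once,
  -- whatever y is; `cat-∼` then gains one level.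
  blk-∼ : ∀ K y y′ → blk K y ∼[ K ] blk K y′
  blk-∼ zero    y y′ []      _ = refl
  blk-∼ (suc K) y y′ = cat-∼ (blk-∼ K) (λ {a} {b} → blk-resp K {a} {b}) m (y +_) (y′ +_) λ j →
    trans (∑-cyclic (δ j) (λ {a} {b} → δ-congʳ {j} {a} {b}) y) (sym (∑-cyclic (δ j) (λ {a} {b} → δ-congʳ {j} {a} {b}) y′))

  mutual
    factor-blk : ∀ K p y → (∀ s → s < m ^ K → T (p + s) ≈ y + T s) → factor m p (m ^ K) ≡ blk K y
    factor-blk zero    p y h = cong (_∷ []) (begin
      T p        ≡⟨ cong T (+-identityʳ p) ⟨
      T (p + 0)  ≡⟨ m<n⇒m%n≡m (T<m (p + 0)) ⟨
      T (p + 0) % m ≡⟨ h 0 z<s ⟩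
      (y + T 0) % m ≡⟨ cong (λ x → (y + x) % m) (T-small 0 (<-trans z<s 2≤m)) ⟩
      (y + 0) % m   ≡⟨ ≈-reflexive (+-identityʳ y) ⟩
      y % m         ∎)
    factor-blk (suc K) p y h = factor-cat K m p (y +_) λ r s r<m s<M → begin
      T (p + (r * m ^ K + s)) % m   ≡⟨ h (r * m ^ K + s) (bound r s r<m s<M) ⟩
      (y + T (r * m ^ K + s)) % m   ≡⟨ +-cong-≈ {y} refl (T-level K r s s<M) ⟩
      (y + (T r + T s)) % m         ≡⟨ ≈-reflexive (trans (sym (+-assoc y (T r) (T s))) (cong (λ x → y + x + T s) (T-small r r<m))) ⟩
      (y + r + T s) % m             ∎
      where
      bound : ∀ r s → r < m → s < m ^ K → r * m ^ K + s < m * m ^ K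
      bound r s r<m s<M = <-≤-trans (+-monoʳ-< (r * m ^ K) s<M) (≤-trans (≤-reflexive (+-comm (r * m ^ K) (m ^ K))) (*-monoˡ-≤ (m ^ K) r<m))

    factor-cat : ∀ K g p z → (∀ h s → h < g → s < m ^ K → T (p + (h * m ^ K + s)) ≈ z h + T s) →
      factor m p (g * m ^ K) ≡ cat (blk K) g z
    factor-cat K zero    p z h = refl
    factor-cat K (suc g) p z h = begin
      factor m p (m ^ K + g * m ^ K)                           ≡⟨ factor-++ m p (m ^ K) (g * m ^ K) ⟩
      factor m p (m ^ K) ++ factor m (p + m ^ K) (g * m ^ K)
        ≡⟨ cong₂ _++_ (factor-blk K p (z 0) (λ s s<M → h 0 s z<s s<M))
             (factor-cat K g (p + m ^ K) (z ∘ suc) (λ k s k<g s<M → trans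
               (≈-reflexive (cong T (trans (+-assoc p (m ^ K) _) (cong (p +_) (sym (+-assoc (m ^ K) (k * m ^ K) s))))))
               (h (suc k) s (s<s k<g) s<M))) ⟩
      blk K (z 0) ++ cat (blk K) g (z ∘ suc)                   ∎

  record Agree (ā b g q q′ : ℕ) : Set where
    constructor agree
    field
      left  : ā ≢ 0 → T (pred q) ≡ T (pred q′)
      right : b ≢ 0 → T (q + g) ≡ T (q′ + g)
      mid   : ∀ j → count g (T ∘ (q +_)) j ≡ count g (T ∘ (q′ +_)) j

  -- The factor of length n at i consists of the last ā letters of a block of length M,
  -- of g whole blocks starting at block number q, and of the first b letters of a block.
  record Shape (M n ā b g i q : ℕ) : Set where
    constructor shape
    field
      start : i + ā ≡ q * M
      ā<    : ā < M
      len   : n ≡ ā + g * M + b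
      b<    : b < M

  Same : ℕ → ℕ → ℕ → ℕ → Set
  Same K n i i′ = ∃₂ λ ā b → ∃ λ g → ∃₂ λ q q′ →
    Shape (m ^ K) n ā b g i q × Shape (m ^ K) n ā b g i′ q′ × Agree ā b g q q′

  -- The cut ends are equal as words, because the letter at offset s of block q is T q + T s modulo
  -- m; only the whole blocks need `cat-∼`.
  Same⇒∼ : ∀ {K n i i′} → Same K n i i′ → factor m i n ∼[ suc K ] factor m i′ n
  Same⇒∼ {K} {n} {i} {i′} (ā , b , g , q , q′ , shape st ā< len b< , shape st′ _ _ _ , agree left right mid) =
    subst₂ (λ u v → u ∼[ suc K ] v) (sym (split i)) (sym (split i′))
      (∼-++ {suc K} {factor m i ā} {factor m i′ ā} (≡⇒∼ leftEq)
        (∼-++ {suc K} {factor m (i + ā) (g * M)} {factor m (i′ + ā) (g * M)}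
          (subst₂ (λ u v → u ∼[ suc K ] v) (sym (middle i q st)) (sym (middle i′ q′ st′)) midEq) (≡⇒∼ rightEq)))
    where
    M = m ^ K
    ≡⇒∼ : ∀ {u v} → u ≡ v → u ∼[ suc K ] v
    ≡⇒∼ {u} refl = ∼-refl {suc K} {u}
    split : ∀ i → factor m i n ≡ factor m i ā ++ (factor m (i + ā) (g * M) ++ factor m (i + ā + g * M) b)
    split i = begin
      factor m i n ≡⟨ cong (factor m i) (trans len (+-assoc ā (g * M) b)) ⟩
      factor m i (ā + (g * M + b)) ≡⟨ factor-++ m i ā (g * M + b) ⟩
      factor m i ā ++ factor m (i + ā) (g * M + b) ≡⟨ cong (factor m i ā ++_) (factor-++ m (i + ā) (g * M) b) ⟩
      factor m i ā ++ (factor m (i + ā) (g * M) ++ factor m (i + ā + g * M) b) ∎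
    middle : ∀ i q → i + ā ≡ q * M → factor m (i + ā) (g * M) ≡ cat (blk K) g (T ∘ (q +_))
    middle i q st = factor-cat K g (i + ā) (T ∘ (q +_)) λ h s _ s<M →
      trans (≈-reflexive (cong T (trans (cong (_+ (h * M + s)) st) (regroup q h M s)))) (T-level K (q + h) s s<M)
      where
      regroup : ∀ q h M s → q * M + (h * M + s) ≡ (q + h) * M + s
      regroup = solve-∀
    midEq : cat (blk K) g (T ∘ (q +_)) ∼[ suc K ] cat (blk K) g (T ∘ (q′ +_))
    midEq = cat-∼ (blk-∼ K) (λ {a} {b} → blk-resp K {a} {b}) g _ _ mid
    rightEq : factor m (i + ā + g * M) b ≡ factor m (i′ + ā + g * M) b
    rightEq = factor-cong m _ _ b λ s s<b → T-cong (i + ā + g * M + s) (i′ + ā + g * M + s) (begin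
      T (i + ā + g * M + s) % m   ≡⟨ value i q s st s<b ⟩
      (T (q + g) + T s) % m       ≡⟨ cong (λ x → (x + T s) % m) (right (λ { refl → case s<b of λ () })) ⟩
      (T (q′ + g) + T s) % m      ≡⟨ value i′ q′ s st′ s<b ⟨
      T (i′ + ā + g * M + s) % m  ∎)
      where
      value : ∀ i q s → i + ā ≡ q * M → s < b → T (i + ā + g * M + s) ≈ T (q + g) + T s
      value i q s st s<b = trans (≈-reflexive (cong T (cong (_+ s) (trans (cong (_+ g * M) st) (sym (*-distribʳ-+ M q g))))))
                                 (T-level K (q + g) s (<-trans s<b b<))
    leftEq : factor m i ā ≡ factor m i′ ā
    leftEq = factor-cong m _ _ ā λ s s<ā → T-cong (i + s) (i′ + s) (begin
      T (i + s) % m                     ≡⟨ value i q s st s<ā ⟩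
      (T (pred q) + T (M ∸ ā + s)) % m  ≡⟨ cong (λ x → (x + T (M ∸ ā + s)) % m) (left (λ { refl → case s<ā of λ () })) ⟩
      (T (pred q′) + T (M ∸ ā + s)) % m ≡⟨ value i′ q′ s st′ s<ā ⟨
      T (i′ + s) % m                    ∎)
      where
      value : ∀ i q s → i + ā ≡ q * M → s < ā → T (i + s) ≈ T (pred q) + T (M ∸ ā + s)
      -- q = 0 forces ā = 0, so no s lies below ā.
      value i zero    s st s<ā = ⊥-elim (n≮0 (subst (s <_) (m+n≡0⇒n≡0 i st) s<ā))
      value i (suc q) s st s<ā = trans (≈-reflexive (cong T i+s)) (T-level K q (M ∸ ā + s) (<-≤-trans (+-monoʳ-< (M ∸ ā) s<ā) (≤-reflexive (m∸n+n≡m (<⇒≤ ā<)))))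
        where
        i+s : i + s ≡ q * M + (M ∸ ā + s)
        i+s = trans (cong (_+ s) (+-cancelʳ-≡ ā i (q * M + (M ∸ ā))
                (trans st (trans (+-comm M (q * M)) (trans (cong (q * M +_) (sym (m∸n+n≡m (<⇒≤ ā<)))) (sym (+-assoc (q * M) (M ∸ ā) ā)))))))
              (+-assoc (q * M) (M ∸ ā) s)

  -- Moments of the positions of a letter.

  mom : ℕ → (ℕ → ℕ) → ℕ → (ℕ → ℕ) → ℕ
  mom j f n z = ∑ n (λ s → δ j (z s) * f s)

  momList : ℕ → (ℕ → ℕ) → List ℕ → ℕ
  momList j f []      = 0
  momList j f (a ∷ u) = δ j a * f 0 + momList j (f ∘ suc) u

  momList-factor : ∀ j f i n → momList j f (factor m i n) ≡ mom j f n (T ∘ (i +_))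
  momList-factor j f i zero    = refl
  momList-factor j f i (suc n) = begin
    momList j f (factor m i (suc n))                           ≡⟨ cong (momList j f) (factor-suc m i n) ⟩
    δ j (T i) * f 0 + momList j (f ∘ suc) (factor m (suc i) n)
      ≡⟨ cong₂ _+_ (cong (λ x → δ j (T x) * f 0) (sym (+-identityʳ i))) (momList-factor j (f ∘ suc) (suc i) n) ⟩
    δ j (T (i + 0)) * f 0 + mom j (f ∘ suc) n (T ∘ (suc i +_))
      ≡⟨ cong (δ j (T (i + 0)) * f 0 +_) (∑-cong n (λ s _ → cong (λ x → δ j (T x) * f (suc s)) (sym (+-suc i s)))) ⟩
    mom j f (suc n) (T ∘ (i +_)) ∎

  factor-letters : ∀ i n → All (_< m) (factor m i n)
  factor-letters i zero    = []
  factor-letters i (suc n) = subst (All (_< m)) (sym (factor-suc m i n)) (T<m i ∷ factor-letters (suc i) n)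

  -- For F = `binom u` this counts the occurrences of j in u together with e chosen positions before
  -- it: the sum, over the positions q of j, of the binomial coefficients of q over e. Only words of
  -- length e + 1 are involved.
  ending : ℕ → ℕ → (List ℕ → ℕ) → ℕ
  ending j zero    F = F (j ∷ [])
  ending j (suc e) F = ∑ m (λ b → ending j e (λ w → F (b ∷ w)))

  ending-cong : ∀ j e {F G} → (∀ w → length w ≤ suc e → F w ≡ G w) → ending j e F ≡ ending j e G
  ending-cong j zero    h = h (j ∷ []) ≤-refl
  ending-cong j (suc e) h = ∑-cong m (λ b _ → ending-cong j e (λ w w≤ → h (b ∷ w) (s≤s w≤)))

  ending-+ : ∀ j e F G → ending j e (λ w → F w + G w) ≡ ending j e F + ending j e G
  ending-+ j zero    F G = refl
  ending-+ j (suc e) F G = trans (∑-cong m (λ b _ → ending-+ j e (F ∘ (b ∷_)) (G ∘ (b ∷_)))) (∑-+ m _ _)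

  ending-* : ∀ j e c F → ending j e (λ w → c * F w) ≡ c * ending j e F
  ending-* j zero    c F = refl
  ending-* j (suc e) c F = trans (∑-cong m (λ b _ → ending-* j e c (F ∘ (b ∷_)))) (∑-* m c _)

  ending-0 : ∀ j e → ending j e (binom []) ≡ 0
  ending-0 j zero    = refl
  ending-0 j (suc e) = trans (∑-cong m (λ b _ → zeros e)) (∑-zero m)
    where
    zeros : ∀ e → ending j e (λ _ → 0) ≡ 0
    zeros zero    = refl
    zeros (suc e) = trans (∑-cong m (λ b _ → zeros e)) (∑-zero m)

  binom-∷ : ∀ {a b} u w → a < m → b < m → binom (a ∷ u) (b ∷ w) ≡ binom u (b ∷ w) + δ b a * binom u w
  binom-∷ {a} {b} u w a<m b<m with a ≟ b
  ... | yes refl = cong (binom u (b ∷ w) +_) (sym (trans (cong (_* binom u w) (δ-yes {b} {b} refl)) (*-identityˡ _)))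
  ... | no a≢b   = sym (trans (cong (λ d → binom u (b ∷ w) + d * binom u w) (δ-no {b} {a} (a≢b ∘ small-≈ a<m b<m))) (+-identityʳ _))

  -- Pascal's rule: the leading letter of a ∷ u either is not among the chosen positions or is the
  -- first of them.
  ending-∷ : ∀ j e {a} u → a < m → ending j (suc e) (binom (a ∷ u)) ≡ ending j (suc e) (binom u) + ending j e (binom u)
  ending-∷ j e {a} u a<m = begin
    ∑ m (λ b → ending j e (λ w → binom (a ∷ u) (b ∷ w)))
      ≡⟨ ∑-cong m (λ b b<m → ending-cong j e (λ w _ → binom-∷ u w a<m b<m)) ⟩
    ∑ m (λ b → ending j e (λ w → binom u (b ∷ w) + δ b a * binom u w))
      ≡⟨ ∑-cong m (λ b _ → trans (ending-+ j e (λ w → binom u (b ∷ w)) (λ w → δ b a * binom u w))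
                                 (cong (ending j e (λ w → binom u (b ∷ w)) +_) (trans (ending-* j e (δ b a) (binom u)) (*-comm (δ b a) _)))) ⟩
    ∑ m (λ b → ending j e (λ w → binom u (b ∷ w)) + ending j e (binom u) * δ b a)
      ≡⟨ ∑-+ m _ _ ⟩
    ending j (suc e) (binom u) + ∑ m (λ b → ending j e (binom u) * δ b a)
      ≡⟨ cong (ending j (suc e) (binom u) +_) (∑-δ* (λ _ → ending j e (binom u)) (λ _ → refl) a) ⟩
    ending j (suc e) (binom u) + ending j e (binom u) ∎

  -- Newton's expansion of f, applied to the positions of the letter j.
  momList-expand : ∀ d {f} (p : Poly d f) {j} → j < m → ∀ {u} → All (_< m) u →
    momList j f u ≡ expand d p (λ e → ending j e (binom u))
  momList-expand d p {j} j<m {[]} [] = sym (expand-0 d p (ending-0 j))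
  momList-expand zero {f} p {j} j<m {a ∷ u} (a<m ∷ u<m) = begin
    δ j a * f 0 + momList j (f ∘ suc) u
      ≡⟨ cong (δ j a * f 0 +_) (momList-expand zero {f ∘ suc} (Poly-suc zero {f} p) j<m u<m) ⟩
    δ j a * f 0 + f 1 * binom u (j ∷ [])
      ≡⟨ cong (λ x → δ j a * f 0 + x * binom u (j ∷ [])) (p 1) ⟩
    δ j a * f 0 + f 0 * binom u (j ∷ [])
      ≡⟨ eq (δ j a) (f 0) (binom u (j ∷ [])) ⟩
    f 0 * (binom u (j ∷ []) + δ j a * 1)
      ≡⟨ cong (λ x → f 0 * (binom u (j ∷ []) + δ j a * x)) (binom-[] u) ⟨
    f 0 * (binom u (j ∷ []) + δ j a * binom u [])
      ≡⟨ cong (f 0 *_) (binom-∷ u [] a<m j<m) ⟨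
    f 0 * binom (a ∷ u) (j ∷ []) ∎
    where
    eq : ∀ d f b → d * f + f * b ≡ f * (b + d * 1)
    eq = solve-∀
  momList-expand (suc d) {f} p@(g , pg , Δ) {j} j<m {a ∷ u} (a<m ∷ u<m) = begin
    δ j a * f 0 + momList j (f ∘ suc) u
      ≡⟨ cong (δ j a * f 0 +_) (trans (momList-expand (suc d) (Poly-suc (suc d) p) j<m u<m) (expand-suc d p ρ)) ⟩
    δ j a * f 0 + (f 0 * binom u (j ∷ []) + expand d pg (ρ ∘ suc) + expand d pg ρ)
      ≡⟨ eq (δ j a) (f 0) (binom u (j ∷ [])) _ _ ⟩
    f 0 * (binom u (j ∷ []) + δ j a * 1) + (expand d pg (ρ ∘ suc) + expand d pg ρ)
      ≡⟨ cong₂ _+_ (cong (f 0 *_) (trans (cong (λ x → binom u (j ∷ []) + δ j a * x) (sym (binom-[] u))) (sym (binom-∷ u [] a<m j<m))))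
           (trans (sym (expand-+ d pg (ρ ∘ suc) ρ)) (expand-cong d pg (λ e _ → sym (ending-∷ j e u a<m)))) ⟩
    f 0 * binom (a ∷ u) (j ∷ []) + expand d pg (λ e → ending j (suc e) (binom (a ∷ u))) ∎
    where
    ρ : ℕ → ℕ
    ρ e = ending j e (binom u)
    eq : ∀ d f b x y → d * f + (f * b + x + y) ≡ f * (b + d * 1) + (x + y)
    eq = solve-∀

  -- The shift c is free so that the family is closed under f ∘ suc and positions can be measured
  -- relative to a σ-block boundary. The added 1 makes m * suc c exceed any partial block α, so that
  -- the shift `c₀` of `descend` exists.
  power : ℕ → ℕ → ℕ → ℕ
  power e c s = (s + suc c) ^ e

  MomentsAgree : ℕ → ℕ → (ℕ → ℕ) → (ℕ → ℕ) → Set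
  MomentsAgree k n z z′ = ∀ e → e < k → ∀ c j → mom j (power e c) n z ≡ mom j (power e c) n z′

  -- Newton's formula writes a moment of degree e through subwords of length at most e + 1, hence at
  -- most k.
  ∼⇒MomentsAgree : ∀ k n i i′ → factor m i n ∼[ k ] factor m i′ n → MomentsAgree k n (T ∘ (i +_)) (T ∘ (i′ +_))
  ∼⇒MomentsAgree k n i i′ h e e<k c j = begin
    mom j f n (T ∘ (i +_))    ≡⟨ reduce i ⟩
    momList r f (factor m i n)
      ≡⟨ momList-expand e (Poly-power e (suc c)) (m%n<n j m) (factor-letters i n) ⟩
    expand e (Poly-power e (suc c)) (λ d → ending r d (binom (factor m i n)))
      ≡⟨ expand-cong e (Poly-power e (suc c)) (λ d d≤e → ending-cong r d (λ w w≤ → h w (≤-trans w≤ (≤-trans (s≤s d≤e) e<k)))) ⟩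
    expand e (Poly-power e (suc c)) (λ d → ending r d (binom (factor m i′ n)))
      ≡⟨ momList-expand e (Poly-power e (suc c)) (m%n<n j m) (factor-letters i′ n) ⟨
    momList r f (factor m i′ n) ≡⟨ reduce i′ ⟨
    mom j f n (T ∘ (i′ +_))   ∎
    where
    f = power e c
    -- `ending` uses its argument as an actual letter, so the residue j is replaced by its
    -- representative.
    r = j % m
    reduce : ∀ i → mom j f n (T ∘ (i +_)) ≡ momList r f (factor m i n)
    reduce i = trans (∑-cong n (λ s _ → cong (_* f s) (δ-congˡ {j} {r} {T (i + s)} (sym (%-≈ j))))) (sym (momList-factor r f i n))

  -- Boundary terms of the generating function.

  0<m : 0 < m
  0<m = <-trans z<s 2≤m

  -- (X Q - 1) times the sum of X^(y+r) Q^r over r < c is X^(y+c) Q^c - X^y. The coefficient of X^j′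
  -- is taken, and f s replaces Q^s.
  telescope : ∀ {j j′} → suc j ≈ j′ → ∀ c (z : ℕ → ℕ) y (f : ℕ → ℕ) → (∀ r → r < c → z r ≈ y + r) →
    ∑ c (λ r → δ j′ (z r) * f r) + δ j′ (y + c) * f c ≡
    ∑ c (λ r → δ j (z r) * f (suc r)) + δ j′ y * f 0
  telescope {j} {j′} j⁺ zero    z y f h = cong (λ x → δ j′ x * f 0) (+-identityʳ y)
  telescope {j} {j′} j⁺ (suc c) z y f h = begin
    ∑ (suc c) L + δ j′ (y + suc c) * f (suc c)
      ≡⟨ cong₂ _+_ (∑-last c L) (cong (_* f (suc c)) last) ⟩
    ∑ c L + δ j′ (z c) * f c + δ j (z c) * f (suc c)
      ≡⟨ cong (λ x → ∑ c L + x * f c + δ j (z c) * f (suc c)) (δ-congʳ {j′} {z c} {y + c} zc) ⟩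
    ∑ c L + δ j′ (y + c) * f c + δ j (z c) * f (suc c)
      ≡⟨ cong (_+ δ j (z c) * f (suc c)) (telescope {j} {j′} j⁺ c z y f (λ r r<c → h r (m≤n⇒m≤1+n r<c))) ⟩
    ∑ c R + δ j′ y * f 0 + δ j (z c) * f (suc c)
      ≡⟨ eq (∑ c R) _ _ ⟩
    ∑ c R + δ j (z c) * f (suc c) + δ j′ y * f 0
      ≡⟨ cong (_+ δ j′ y * f 0) (∑-last c R) ⟨
    ∑ (suc c) R + δ j′ y * f 0 ∎
    where
    L R : ℕ → ℕ
    L r = δ j′ (z r) * f r
    R r = δ j (z r) * f (suc r)
    zc : z c ≈ y + c
    zc = h c ≤-refl
    last : δ j′ (y + suc c) ≡ δ j (z c)
    last = trans (cong (δ j′) (+-suc y c)) (trans (δ-congˡ {j′} {suc j} {suc (y + c)} (sym j⁺)) (trans (δ-suc j (y + c)) (δ-congʳ {j} {y + c} {z c} (sym zc))))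
    eq : ∀ a b c → a + b + c ≡ a + c + b
    eq = solve-∀

  -- Multiplying the generating function of a word by (X Q - 1) leaves only the terms at
  -- the boundaries of the σ-blocks.
  boundary : ∀ {j j′} → suc j ≈ j′ → ∀ f α g e n a (z w : ℕ → ℕ) → n ≡ α + g * m + e →
    (∀ s → s < α → z s ≈ a + s) →
    (∀ h r → h < g → r < m → z (α + (h * m + r)) ≈ w h + r) →
    (∀ s → s < e → z (α + g * m + s) ≈ w g + s) →
    mom j′ f n z + (δ j′ (a + α) * f α + mom j′ (λ h → f (α + h * m + m)) g w + δ j′ (w g + e) * f n) ≡
    mom j (f ∘ suc) n z + (δ j′ a * f 0 + mom j′ (λ h → f (α + h * m)) g w + δ j′ (w g) * f (α + g * m))
  boundary {j} {j′} j⁺ f α g e n a z w refl pre mid post = begin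
    mom j′ f n z + (X + W⁺ + C)    ≡⟨ cong (_+ (X + W⁺ + C)) (cut j′ f) ⟩
    P + Q + R + (X + W⁺ + C)            ≡⟨ eq P Q R X W⁺ C ⟩
    (P + X) + (Q + W⁺) + (R + C)        ≡⟨ cong₂ _+_ (cong₂ _+_ pre-eq mid-eq) post-eq ⟩
    (P′ + A) + (Q′ + W) + (R′ + Y)      ≡⟨ eq P′ Q′ R′ A W Y ⟨
    P′ + Q′ + R′ + (A + W + Y)          ≡⟨ cong (_+ (A + W + Y)) (cut j (f ∘ suc)) ⟨
    mom j (f ∘ suc) n z + (A + W + Y)   ∎
    where
    part₁ part₂ part₃ : ℕ → (ℕ → ℕ) → ℕ
    part₁ j f = ∑ α (λ s → δ j (z s) * f s)
    part₂ j f = ∑ (g * m) (λ s → δ j (z (α + s)) * f (α + s))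
    part₃ j f = ∑ e (λ s → δ j (z (α + g * m + s)) * f (α + g * m + s))
    cut : ∀ j f → mom j f n z ≡ part₁ j f + part₂ j f + part₃ j f
    cut j f = trans (∑-split (α + g * m) e _) (cong (_+ part₃ j f) (∑-split α (g * m) _))
    P = part₁ j′ f ; P′ = part₁ j (f ∘ suc)
    Q = part₂ j′ f ; Q′ = part₂ j (f ∘ suc)
    R = part₃ j′ f ; R′ = part₃ j (f ∘ suc)
    X = δ j′ (a + α) * f α
    A = δ j′ a * f 0
    W⁺ = mom j′ (λ h → f (α + h * m + m)) g w
    W = mom j′ (λ h → f (α + h * m)) g w
    C = δ j′ (w g + e) * f n
    Y = δ j′ (w g) * f (α + g * m)
    eq : ∀ P Q R X W C → P + Q + R + (X + W + C) ≡ (P + X) + (Q + W) + (R + C)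
    eq = solve-∀
    pre-eq : P + X ≡ P′ + A
    pre-eq = telescope {j} {j′} j⁺ α z a f pre
    post-eq : R + C ≡ R′ + Y
    post-eq = begin
      R + C ≡⟨ telescope {j} {j′} j⁺ e (λ s → z (α + g * m + s)) (w g) (λ s → f (α + g * m + s)) post ⟩
      ∑ e (λ s → δ j (z (α + g * m + s)) * f (α + g * m + suc s)) + δ j′ (w g) * f (α + g * m + 0)
        ≡⟨ cong₂ _+_ (∑-cong e (λ s _ → cong (λ x → δ j (z (α + g * m + s)) * f x) (+-suc (α + g * m) s)))
                     (cong (λ x → δ j′ (w g) * f x) (+-identityʳ (α + g * m))) ⟩
      R′ + Y ∎
    blocks : ∀ j f → part₂ j f ≡ ∑ g (λ h → ∑ m (λ r → δ j (z (α + (h * m + r))) * f (α + (h * m + r))))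
    blocks j f = ∑-blocks g m (λ s → δ j (z (α + s)) * f (α + s))
    mid-eq : Q + W⁺ ≡ Q′ + W
    mid-eq = begin
      Q + W⁺ ≡⟨ cong (_+ W⁺) (blocks j′ f) ⟩
      _ + W⁺ ≡⟨ ∑-+ g _ _ ⟨
      ∑ g (λ h → ∑ m (λ r → δ j′ (z (α + (h * m + r))) * f (α + (h * m + r))) + δ j′ (w h) * f (α + h * m + m))
        ≡⟨ ∑-cong g block ⟩
      ∑ g (λ h → ∑ m (λ r → δ j (z (α + (h * m + r))) * f (suc (α + (h * m + r)))) + δ j′ (w h) * f (α + h * m))
        ≡⟨ ∑-+ g _ _ ⟩
      _ + W ≡⟨ cong (_+ W) (blocks j (f ∘ suc)) ⟨
      Q′ + W ∎
      where
      block : ∀ h → h < g →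
        ∑ m (λ r → δ j′ (z (α + (h * m + r))) * f (α + (h * m + r))) + δ j′ (w h) * f (α + h * m + m) ≡
        ∑ m (λ r → δ j (z (α + (h * m + r))) * f (suc (α + (h * m + r)))) + δ j′ (w h) * f (α + h * m)
      block h h<g = begin
        ∑ m (λ r → δ j′ (z (α + (h * m + r))) * f (α + (h * m + r))) + δ j′ (w h) * f (α + h * m + m)
          ≡⟨ cong₂ (λ x y → ∑ m (λ r → δ j′ (z (α + (h * m + r))) * f (α + (h * m + r))) + x * f y)
               (δ-congʳ {j′} {w h} {w h + m} (sym (+m-≈ (w h)))) (+-assoc α (h * m) m) ⟩
        ∑ m (λ r → δ j′ (z (α + (h * m + r))) * f (α + (h * m + r))) + δ j′ (w h + m) * f (α + (h * m + m))
          ≡⟨ telescope {j} {j′} j⁺ m (λ r → z (α + (h * m + r))) (w h) (λ r → f (α + (h * m + r))) (λ r r<m → mid h r h<g r<m) ⟩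
        ∑ m (λ r → δ j (z (α + (h * m + r))) * f (α + (h * m + suc r))) + δ j′ (w h) * f (α + (h * m + 0))
          ≡⟨ cong₂ _+_ (∑-cong m (λ r _ → cong (λ x → δ j (z (α + (h * m + r))) * f x)
                          (trans (cong (α +_) (+-suc (h * m) r)) (+-suc α (h * m + r)))))
                       (cong (λ x → δ j′ (w h) * f (α + x)) (+-identityʳ (h * m))) ⟩
        ∑ m (λ r → δ j (z (α + (h * m + r))) * f (suc (α + (h * m + r)))) + δ j′ (w h) * f (α + h * m) ∎

  -- The first letter of the factor when α is nonzero, at offset m - α of the block of `T (pred h)`.
  -- For α = 0 it is congruent to that block letter.
  letter-a : ℕ → ℕ → ℕ
  letter-a α h = T (pred h) + (m ∸ α)

  -- The letter that would continue the block cut at the right end, at offset e.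
  letter-c : ℕ → ℕ → ℕ → ℕ
  letter-c e g h = T (h + g) + e

  a+α≈x : ∀ {α} → α < m → ∀ h → letter-a α h + α ≈ T (pred h)
  a+α≈x {α} α<m h = trans (≈-reflexive (trans (+-assoc (T (pred h)) (m ∸ α) α) (cong (T (pred h) +_) (m∸n+n≡m (<⇒≤ α<m))))) (+m-≈ (T (pred h)))

  start-letters : ∀ {n α e g i h} → Shape m n α e g i h → ∀ s → s < α → T (i + s) ≈ letter-a α h + s
  start-letters {h = zero} (shape st _ _ _) s s<α = ⊥-elim (n≮0 (subst (s <_) (m+n≡0⇒n≡0 _ st) s<α))
  start-letters {n} {α} {e} {g} {i} {suc h} (shape st α<m _ _) s s<α = begin
    T (i + s) % m                  ≡⟨ ≈-reflexive (cong T i+s) ⟩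
    T (h * m + (m ∸ α + s)) % m    ≡⟨ T-block-≈ h (m ∸ α + s) (<-≤-trans (+-monoʳ-< (m ∸ α) s<α) (≤-reflexive (m∸n+n≡m (<⇒≤ α<m)))) ⟩
    (T h + (m ∸ α + s)) % m        ≡⟨ ≈-reflexive (+-assoc (T h) (m ∸ α) s) ⟨
    (T h + (m ∸ α) + s) % m        ∎
    where
    i+s : i + s ≡ h * m + (m ∸ α + s)
    i+s = trans (cong (_+ s) (+-cancelʳ-≡ α i (h * m + (m ∸ α))
            (trans st (trans (+-comm m (h * m)) (trans (cong (h * m +_) (sym (m∸n+n≡m (<⇒≤ α<m)))) (sym (+-assoc (h * m) (m ∸ α) α)))))))
          (+-assoc (h * m) (m ∸ α) s)

  block-letters : ∀ {n α e g i h} → Shape m n α e g i h → ∀ k r → r < m → T (i + (α + (k * m + r))) ≈ T (h + k) + r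
  block-letters {α = α} {i = i} {h = h} (shape st _ _ _) k r r<m =
    trans (≈-reflexive (cong T (trans (sym (+-assoc i α _)) (trans (cong (_+ (k * m + r)) st) (eq h k m r))))) (T-block-≈ (h + k) r r<m)
    where
    eq : ∀ h k m r → h * m + (k * m + r) ≡ (h + k) * m + r
    eq = solve-∀

  boundary-T : ∀ {n α e g i h} → Shape m n α e g i h → ∀ {j j′} → suc j ≈ j′ → ∀ f →
    mom j′ f n (T ∘ (i +_)) + (δ j′ (T (pred h)) * f α + mom j′ (λ k → f (α + k * m + m)) g (T ∘ (h +_)) + δ j′ (letter-c e g h) * f n) ≡
    mom j (f ∘ suc) n (T ∘ (i +_)) + (δ j′ (letter-a α h) * f 0 + mom j′ (λ k → f (α + k * m)) g (T ∘ (h +_)) + δ j′ (T (h + g)) * f (α + g * m))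
  boundary-T {n} {α} {e} {g} {i} {h} sh@(shape st α<m len e<m) {j} {j′} j⁺ f = trans
    (cong (λ d → mom j′ f n (T ∘ (i +_)) + (d * f α + mom j′ (λ k → f (α + k * m + m)) g (T ∘ (h +_)) + δ j′ (letter-c e g h) * f n))
      (δ-congʳ {j′} {T (pred h)} {letter-a α h + α} (sym (a+α≈x α<m h))))
    (boundary {j} {j′} j⁺ f α g e n (letter-a α h) (T ∘ (i +_)) (T ∘ (h +_)) len
      (start-letters sh) (λ k r _ r<m → block-letters sh k r r<m)
      (λ s s<e → trans (≈-reflexive (cong (λ x → T (i + x)) (+-assoc α (g * m) s))) (block-letters sh g s (<-trans s<e e<m))))

  -- `hi` - `lo` is the coefficient of X^j in (X Q - 1) times the generating function of the factor:
  -- each piece has its right end in `hi` and its left end in `lo`.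
  hi lo : (f : ℕ → ℕ) (n α e g h j : ℕ) → ℕ
  hi f n α e g h j = δ j (T (pred h)) * f α + mom j (λ k → f (α + k * m + m)) g (T ∘ (h +_)) + δ j (letter-c e g h) * f n
  lo f n α e g h j = δ j (letter-a α h) * f 0 + mom j (λ k → f (α + k * m)) g (T ∘ (h +_)) + δ j (T (h + g)) * f (α + g * m)

  -- For either factor, `hi` - `lo` is the same difference of two moments, one of the letter j - 1
  -- with shift c + 1 and one of the letter j with shift c.
  boundaries-agree : ∀ {n α e g i h α′ e′ g′ i′ h′ k} → Shape m n α e g i h → Shape m n α′ e′ g′ i′ h′ →
    MomentsAgree k n (T ∘ (i +_)) (T ∘ (i′ +_)) → ∀ E → E < k → ∀ c j → let f = power E c in
    hi f n α e g h j + lo f n α′ e′ g′ h′ j ≡ hi f n α′ e′ g′ h′ j + lo f n α e g h j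
  boundaries-agree {n} {α} {e} {g} {i} {h} {α′} {e′} {g′} {i′} {h′} sh sh′ same E E<k c j = cross
    (mom j f n (T ∘ (i +_))) (mom j₀ (f ∘ suc) n (T ∘ (i +_)))
    (boundary-T sh {j₀} {j} j⁺ f)
    (subst₂ (λ P Q → P + hi f n α′ e′ g′ h′ j ≡ Q + lo f n α′ e′ g′ h′ j)
      (sym (same E E<k c j)) (trans (shift i′) (trans (sym (same E E<k (suc c) j₀)) (sym (shift i))))
      (boundary-T sh′ {j₀} {j} j⁺ f))
    where
    f = power E c
    j₀ = j + pred m
    j⁺ : suc j₀ ≈ j
    j⁺ = trans (≈-reflexive (trans (sym (+-suc j (pred m))) (cong (j +_) (suc-pred m)))) (+m-≈ j)
    shift : ∀ i → mom j₀ (f ∘ suc) n (T ∘ (i +_)) ≡ mom j₀ (power E (suc c)) n (T ∘ (i +_))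
    shift i = ∑-cong n (λ s _ → cong (λ x → δ j₀ (T (i + s)) * x ^ E) (sym (+-suc s (suc c))))

  -- Recovering the cut of the first σ-level.

  module TwoShapes {n α e g i h α′ e′ g′ i′ h′} (sh : Shape m n α e g i h) (sh′ : Shape m n α′ e′ g′ i′ h′)
    (same : MomentsAgree 2 n (T ∘ (i +_)) (T ∘ (i′ +_))) where

    a x y c a′ x′ y′ c′ : ℕ
    a = letter-a α h ; x = T (pred h) ; y = T (h + g) ; c = letter-c e g h
    a′ = letter-a α′ h′ ; x′ = T (pred h′) ; y′ = T (h′ + g′) ; c′ = letter-c e′ g′ h′

    W W′ : ℕ → ℕ
    W  j = m * count g (T ∘ (h +_)) j
    W′ j = m * count g′ (T ∘ (h′ +_)) j

    -- In degree 0 each whole block contributes equally to `hi` and `lo`, so only the four end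
    -- letters of each factor remain.
    zeroth : ∀ j → δ j x + δ j c + (δ j a′ + δ j y′) ≡ δ j x′ + δ j c′ + (δ j a + δ j y)
    zeroth j = +-cancelʳ-≡ (U + U′) _ _ (begin
      δ j x + δ j c + (δ j a′ + δ j y′) + (U + U′)  ≡⟨ eq (δ j x) (δ j c) (δ j a′) (δ j y′) U U′ ⟩
      hi f n α e g h j + lo f n α′ e′ g′ h′ j        ≡⟨ boundaries-agree sh sh′ same 0 z<s 0 j ⟩
      hi f n α′ e′ g′ h′ j + lo f n α e g h j        ≡⟨ eq (δ j x′) (δ j c′) (δ j a) (δ j y) U′ U ⟨
      δ j x′ + δ j c′ + (δ j a + δ j y) + (U′ + U)   ≡⟨ cong (δ j x′ + δ j c′ + (δ j a + δ j y) +_) (+-comm U′ U) ⟩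
      δ j x′ + δ j c′ + (δ j a + δ j y) + (U + U′)   ∎)
      where
      f = power 0 0
      U = mom j (λ _ → 1) g (T ∘ (h +_))
      U′ = mom j (λ _ → 1) g′ (T ∘ (h′ +_))
      eq : ∀ x c a y U U′ → x + c + (a + y) + (U + U′) ≡ x * 1 + U + c * 1 + (a * 1 + U′ + y * 1)
      eq = solve-∀

    -- In degree 1 the two ends of a whole block lie m apart, which leaves m times the letter count;
    -- the constants due to the shift are removed by `zeroth`.
    first : ∀ j → α * δ j x + W j + n * δ j c + (α′ + g′ * m) * δ j y′ ≡
                  α′ * δ j x′ + W′ j + n * δ j c′ + (α + g * m) * δ j y
    first j = +-cancelʳ-≡ (δ j x + δ j c + (δ j a′ + δ j y′) + (V + V′)) _ _ (begin
      α * δ j x + W j + n * δ j c + (α′ + g′ * m) * δ j y′ + (δ j x + δ j c + (δ j a′ + δ j y′) + (V + V′))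
        ≡⟨ eq (δ j x) (δ j c) (δ j a′) (δ j y′) V V′ (W j) α n (α′ + g′ * m) ⟩
      δ j x * f α + (V + W j) + δ j c * f n + (δ j a′ * f 0 + V′ + δ j y′ * f (α′ + g′ * m))
        ≡⟨ cong (λ v → δ j x * f α + v + δ j c * f n + lo f n α′ e′ g′ h′ j) (step α g h) ⟨
      hi f n α e g h j + lo f n α′ e′ g′ h′ j
        ≡⟨ boundaries-agree sh sh′ same 1 (s<s z<s) 0 j ⟩
      hi f n α′ e′ g′ h′ j + lo f n α e g h j
        ≡⟨ cong (λ v → δ j x′ * f α′ + v + δ j c′ * f n + lo f n α e g h j) (step α′ g′ h′) ⟩
      δ j x′ * f α′ + (V′ + W′ j) + δ j c′ * f n + (δ j a * f 0 + V + δ j y * f (α + g * m))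
        ≡⟨ eq (δ j x′) (δ j c′) (δ j a) (δ j y) V′ V (W′ j) α′ n (α + g * m) ⟨
      α′ * δ j x′ + W′ j + n * δ j c′ + (α + g * m) * δ j y + (δ j x′ + δ j c′ + (δ j a + δ j y) + (V′ + V))
        ≡⟨ cong₂ (λ p q → α′ * δ j x′ + W′ j + n * δ j c′ + (α + g * m) * δ j y + (p + q)) (sym (zeroth j)) (+-comm V′ V) ⟩
      α′ * δ j x′ + W′ j + n * δ j c′ + (α + g * m) * δ j y + (δ j x + δ j c + (δ j a′ + δ j y′) + (V + V′)) ∎)
      where
      f = power 1 0
      V = mom j (λ k → f (α + k * m)) g (T ∘ (h +_))
      V′ = mom j (λ k → f (α′ + k * m)) g′ (T ∘ (h′ +_))
      step : ∀ α g h → mom j (λ k → f (α + k * m + m)) g (T ∘ (h +_)) ≡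
                       mom j (λ k → f (α + k * m)) g (T ∘ (h +_)) + m * count g (T ∘ (h +_)) j
      step α g h = trans (∑-cong g (λ k _ → eq₁ (δ j (T (h + k))) (α + k * m) m))
        (trans (∑-+ g _ _) (cong (mom j (λ k → f (α + k * m)) g (T ∘ (h +_)) +_) (∑-* g m (λ k → δ j (T (h + k))))))
        where
        eq₁ : ∀ d q m → d * ((q + m + 1) * 1) ≡ d * ((q + 1) * 1) + m * d
        eq₁ = solve-∀
      eq : ∀ x c a y V V′ W α n β → α * x + W + n * c + β * y + (x + c + (a + y) + (V + V′)) ≡
           x * ((α + 1) * 1) + (V + W) + c * ((n + 1) * 1) + (a * 1 + V′ + y * ((β + 1) * 1))
      eq = solve-∀

    -- Positions measured from the right end: n times `zeroth` minus `first`, with n = α + g * m +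
    -- e. It lets `cut-end` serve both ends.
    first-mirrored : ∀ j → e * δ j y + W j + n * δ j a + (e′ + g′ * m) * δ j x′ ≡
                           e′ * δ j y′ + W′ j + n * δ j a′ + (e + g * m) * δ j x
    first-mirrored j = +-cancelʳ-≡ common _ _ (begin
      e * δ j y + W j + n * δ j a + (e′ + g′ * m) * δ j x′ + common
        ≡⟨ eq₁ α e (g * m) α′ e′ (g′ * m) n (δ j x) (δ j y) (δ j c) (δ j a) (δ j x′) (δ j y′) (δ j c′) (W j) ⟩
      side + ((α′ + g′ * m + e′) * δ j x′ + n * δ j c′ + (n * δ j a + (α + g * m + e) * δ j y))
        ≡⟨ cong₂ (λ p q → side + (p * δ j x′ + n * δ j c′ + (n * δ j a + q * δ j y))) (sym (Shape.len sh′)) (sym (Shape.len sh)) ⟩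
      side + (n * δ j x′ + n * δ j c′ + (n * δ j a + n * δ j y))
        ≡⟨ cong₂ _+_ (first j) (trans (eq₂ n (δ j x′) (δ j c′) (δ j a) (δ j y)) (trans (cong (n *_) (sym (zeroth j))) (sym (eq₂ n (δ j x) (δ j c) (δ j a′) (δ j y′))))) ⟩
      side′ + (n * δ j x + n * δ j c + (n * δ j a′ + n * δ j y′))
        ≡⟨ cong₂ (λ p q → side′ + (p * δ j x + n * δ j c + (n * δ j a′ + q * δ j y′))) (Shape.len sh) (Shape.len sh′) ⟩
      side′ + ((α + g * m + e) * δ j x + n * δ j c + (n * δ j a′ + (α′ + g′ * m + e′) * δ j y′))
        ≡⟨ eq₃ α e (g * m) α′ e′ (g′ * m) n (δ j x) (δ j y) (δ j c) (δ j a′) (δ j x′) (δ j y′) (δ j c′) (W′ j) ⟩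
      e′ * δ j y′ + W′ j + n * δ j a′ + (e + g * m) * δ j x + common ∎)
      where
      side side′ common : ℕ
      side = α * δ j x + W j + n * δ j c + (α′ + g′ * m) * δ j y′
      side′ = α′ * δ j x′ + W′ j + n * δ j c′ + (α + g * m) * δ j y
      common = α * δ j x + n * δ j c + (α′ + g′ * m) * δ j y′ + (α′ * δ j x′ + n * δ j c′ + (α + g * m) * δ j y)
      eq₁ : ∀ α e G α′ e′ G′ n x y c a x′ y′ c′ W →
        e * y + W + n * a + (e′ + G′) * x′ + (α * x + n * c + (α′ + G′) * y′ + (α′ * x′ + n * c′ + (α + G) * y)) ≡
        α * x + W + n * c + (α′ + G′) * y′ + ((α′ + G′ + e′) * x′ + n * c′ + (n * a + (α + G + e) * y))
      eq₁ = solve-∀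
      eq₂ : ∀ n x c a y → n * x + n * c + (n * a + n * y) ≡ n * (x + c + (a + y))
      eq₂ = solve-∀
      eq₃ : ∀ α e G α′ e′ G′ n x y c a′ x′ y′ c′ W′ →
        α′ * x′ + W′ + n * c′ + (α + G) * y + ((α + G + e) * x + n * c + (n * a′ + (α′ + G′ + e′) * y′)) ≡
        e′ * y′ + W′ + n * a′ + (e + G) * x + (α * x + n * c + (α′ + G′) * y′ + (α′ * x′ + n * c′ + (α + G) * y))
      eq₃ = solve-∀

  *δ≤ : ∀ A j x → A * δ j x ≤ A
  *δ≤ A j x = ≤-trans (*-monoʳ-≤ A (δ-≤1 j x)) (≤-reflexive (*-identityʳ A))

  -- At j = y the right-hand side is too large for the left-hand side unless y ≈ y′.
  cut-end : ∀ {A G e A′ G′ e′ n x y c x′ y′ c′} (W W′ : ℕ → ℕ) → n ≡ A′ + G′ + e′ →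
    W y < G → (e ≢ 0 → c ≉ y) → (e′ ≡ 0 → c′ ≈ y′) →
    A * δ y x + W y + n * δ y c + (A′ + G′) * δ y y′ ≡ A′ * δ y x′ + W′ y + n * δ y c′ + (A + G) * δ y y →
    e ≢ 0 → e′ ≢ 0 × y ≈ y′
  cut-end {A} {G} {e} {A′} {G′} {e′} {n} {x} {y} {c} {x′} {y′} {c′} W W′ len W<G c≉y c′≈y′ eq e≢0 with y′ ≈? y
  ... | yes y′≈y = (λ e′≡0 → <⇒≢ (smaller e′≡0) eq) , sym y′≈y
    where
    -- If e′ = 0, then c′ ≈ y′ ≈ y, so the right-hand side also contains n = A′ + G′, which matches
    -- the term of y′ on the left.
    smaller : e′ ≡ 0 → A * δ y x + W y + n * δ y c + (A′ + G′) * δ y y′ < A′ * δ y x′ + W′ y + n * δ y c′ + (A + G) * δ y y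
    smaller e′≡0 = begin-strict
      A * δ y x + W y + n * δ y c + (A′ + G′) * δ y y′
        ≤⟨ ≤-reflexive (cong (λ d → A * δ y x + W y + d + (A′ + G′) * δ y y′) (trans (cong (n *_) (δ-no {y} {c} (c≉y e≢0))) (*-zeroʳ n))) ⟩
      A * δ y x + W y + 0 + (A′ + G′) * δ y y′
        ≤⟨ +-mono-≤ (≤-reflexive (+-identityʳ _)) (*δ≤ (A′ + G′) y y′) ⟩
      A * δ y x + W y + (A′ + G′)
        <⟨ +-monoˡ-< (A′ + G′) (+-mono-≤-< (*δ≤ A y x) W<G) ⟩
      A + G + (A′ + G′)
        ≤⟨ ≤-reflexive (trans (+-comm (A + G) _) (cong₂ _+_ (sym n≡) (sym (trans (cong ((A + G) *_) (δ-yes {y} {y} refl)) (*-identityʳ _))))) ⟩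
      n + (A + G) * δ y y
        ≤⟨ ≤-reflexive (sym (cong (_+ (A + G) * δ y y) (trans (cong (n *_) (δ-yes {y} {c′} (trans (c′≈y′ e′≡0) y′≈y))) (*-identityʳ n)))) ⟩
      n * δ y c′ + (A + G) * δ y y
        ≤⟨ +-monoˡ-≤ ((A + G) * δ y y) (m≤n+m (n * δ y c′) (A′ * δ y x′ + W′ y)) ⟩
      A′ * δ y x′ + W′ y + n * δ y c′ + (A + G) * δ y y □
      where
      n≡ : n ≡ A′ + G′
      n≡ = trans len (trans (cong (A′ + G′ +_) e′≡0) (+-identityʳ _))
  ... | no y′≉y = ⊥-elim (<⇒≢ smaller eq)
    where
    smaller : A * δ y x + W y + n * δ y c + (A′ + G′) * δ y y′ < A′ * δ y x′ + W′ y + n * δ y c′ + (A + G) * δ y y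
    smaller = begin-strict
      A * δ y x + W y + n * δ y c + (A′ + G′) * δ y y′
        ≤⟨ ≤-reflexive (cong₂ (λ d d′ → A * δ y x + W y + d + d′) (trans (cong (n *_) (δ-no {y} {c} (c≉y e≢0))) (*-zeroʳ n))
                 (trans (cong ((A′ + G′) *_) (δ-no {y} {y′} y′≉y)) (*-zeroʳ (A′ + G′))))  ⟩
      A * δ y x + W y + 0 + 0
        ≤⟨ ≤-reflexive (trans (+-identityʳ _) (+-identityʳ _)) ⟩
      A * δ y x + W y
        <⟨ +-mono-≤-< (*δ≤ A y x) W<G ⟩
      A + G
        ≤⟨ ≤-reflexive (sym (trans (cong ((A + G) *_) (δ-yes {y} {y} refl)) (*-identityʳ _))) ⟩
      (A + G) * δ y y
        ≤⟨ m≤n+m _ _ ⟩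
      A′ * δ y x′ + W′ y + n * δ y c′ + (A + G) * δ y y □

  suc-≉ : ∀ a → suc a ≉ a
  suc-≉ a p = case small-≈ 2≤m 0<m (+-cancelʳ-≈ a {1} {0} p) of λ ()

  -- Of two consecutive steps at least one stays inside a σ-block, where the letter grows by 1
  -- modulo m; so no letter occurs three times in a row.
  T-increase : ∀ h → T (suc h) ≉ T h ⊎ T (suc (suc h)) ≉ T (suc h)
  T-increase h with divMod m h
  ... | q , s , refl , s<m with suc s <? m
  ... | yes s+1<m = inj₁ λ p → suc-≉ (T q + s) (begin
      suc (T q + s) % m          ≡⟨ ≈-reflexive (+-suc (T q) s) ⟨
      (T q + suc s) % m          ≡⟨ T-block-≈ q (suc s) s+1<m ⟨
      T (q * m + suc s) % m      ≡⟨ ≈-reflexive (cong T (+-suc (q * m) s)) ⟩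
      T (suc (q * m + s)) % m    ≡⟨ p ⟩
      T (q * m + s) % m          ≡⟨ T-block-≈ q s s<m ⟩
      (T q + s) % m              ∎)
  ... | no s+1≮m = inj₂ λ p → suc-≉ (T (suc q)) (begin
      suc (T (suc q)) % m        ≡⟨ ≈-reflexive (+-comm (T (suc q)) 1) ⟨
      (T (suc q) + 1) % m        ≡⟨ T-block-≈ (suc q) 1 2≤m ⟨
      T (suc q * m + 1) % m      ≡⟨ ≈-reflexive (cong T (trans (+-comm (suc q * m) 1) (cong suc (sym next)))) ⟩
      T (suc (suc (q * m + s))) % m ≡⟨ p ⟩
      T (suc (q * m + s)) % m    ≡⟨ ≈-reflexive (cong T (trans next (sym (+-identityʳ (suc q * m))))) ⟩
      T (suc q * m + 0) % m      ≡⟨ T-block-≈ (suc q) 0 0<m ⟩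
      (T (suc q) + 0) % m        ≡⟨ ≈-reflexive (+-identityʳ (T (suc q))) ⟩
      T (suc q) % m              ∎)
    where
    next : suc (q * m + s) ≡ suc q * m
    next = trans (sym (+-suc (q * m) s)) (trans (cong (q * m +_) (≤-antisym s<m (≮⇒≥ s+1≮m))) (+-comm (q * m) m))

  count≤ : ∀ g z j → count g z j ≤ g
  count≤ zero    z j = z≤n
  count≤ (suc g) z j = +-mono-≤ (δ-≤1 j (z 0)) (count≤ g (z ∘ suc) j)

  δ-pair : ∀ j {a b} → b ≉ a → δ j a + δ j b ≤ 1
  δ-pair j {a} {b} b≉a with a ≈? j
  ... | no ¬p = ≤-trans (≤-reflexive (cong (_+ δ j b) (δ-no {j} {a} ¬p))) (δ-≤1 j b)
  ... | yes p = +-mono-≤ (δ-≤1 j a) (≤-reflexive (δ-no {j} {b} (λ q → b≉a (trans q (sym p)))))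

  count< : ∀ {g} → 3 ≤ g → ∀ h j → count g (T ∘ (h +_)) j < g
  count< {suc (suc (suc g))} (s≤s (s≤s (s≤s z≤n))) h j = s≤s (begin-≤
    δ j (T (h + 0)) + (δ j (T (h + 1)) + (δ j (T (h + 2)) + R))
      ≤⟨ ≤-reflexive (eq (δ j (T (h + 0))) (δ j (T (h + 1))) (δ j (T (h + 2))) R) ⟩
    δ j (T (h + 0)) + δ j (T (h + 1)) + δ j (T (h + 2)) + R
      ≤⟨ +-mono-≤ three (count≤ g _ j) ⟩
    2 + g □)
    where
    R = count g (λ k → T (h + suc (suc (suc k)))) j
    eq : ∀ a b c d → a + (b + (c + d)) ≡ a + b + c + d
    eq = solve-∀
    three : δ j (T (h + 0)) + δ j (T (h + 1)) + δ j (T (h + 2)) ≤ 2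
    three rewrite +-identityʳ h | +-comm h 1 | +-comm h 2 with T-increase h
    ... | inj₁ p = +-mono-≤ (δ-pair j {T h} {T (suc h)} p) (δ-≤1 j (T (suc (suc h))))
    ... | inj₂ p = ≤-trans (≤-reflexive (+-assoc (δ j (T h)) _ _)) (+-mono-≤ (δ-≤1 j (T h)) (δ-pair j {T (suc h)} {T (suc (suc h))} p))

  module FirstLevel {n α e g i h α′ e′ g′ i′ h′} (sh : Shape m n α e g i h) (sh′ : Shape m n α′ e′ g′ i′ h′)
    (3≤g : 3 ≤ g) (3≤g′ : 3 ≤ g′) (same : MomentsAgree 2 n (T ∘ (i +_)) (T ∘ (i′ +_))) where
    open TwoShapes sh sh′ same
    open Shape

    +≈⇒0 : ∀ y {e} → e < m → y + e ≈ y → e ≡ 0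
    +≈⇒0 y {e} e<m p = small-≈ e<m 0<m (+-cancelˡ-≈ y {e} {0} (trans p (≈-reflexive (sym (+-identityʳ y)))))

    c≉y : ∀ {n α e g i h} → Shape m n α e g i h → e ≢ 0 → letter-c e g h ≉ T (h + g)
    c≉y {g = g} {h = h} s e≢0 p = e≢0 (+≈⇒0 (T (h + g)) (b< s) p)

    c≈y : ∀ {e g h} → e ≡ 0 → letter-c e g h ≈ T (h + g)
    c≈y refl = ≈-reflexive (+-identityʳ _)

    a≉x : ∀ {n α e g i h} → Shape m n α e g i h → α ≢ 0 → letter-a α h ≉ T (pred h)
    a≉x {α = α} {h = h} s α≢0 p = α≢0 (+≈⇒0 (letter-a α h) (ā< s) (trans (a+α≈x (ā< s) h) (sym p)))

    a≈x : ∀ {α h} → α ≡ 0 → letter-a α h ≈ T (pred h)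
    a≈x refl = +m-≈ _

    W<G : ∀ {g} → 3 ≤ g → ∀ h j → m * count g (T ∘ (h +_)) j < g * m
    W<G {g} 3≤g h j = <-≤-trans (*-monoʳ-< m (count< 3≤g h j)) (≤-reflexive (*-comm m g))

    len-mirrored : ∀ {α e g} → n ≡ α + g * m + e → n ≡ e + g * m + α
    len-mirrored {α} {e} {g} p = trans p (eq α (g * m) e)
      where
      eq : ∀ a b c → a + b + c ≡ c + b + a
      eq = solve-∀

    end-cut : e ≢ 0 → e′ ≢ 0 × y ≈ y′
    end-cut = cut-end {α} {g * m} {e} {α′} {g′ * m} {e′} {n} {x} {y} {c} {x′} {y′} {c′} W W′ (len sh′) (W<G 3≤g h y) (c≉y sh) (c≈y {e′} {g′} {h′}) (first y)

    end-cut′ : e′ ≢ 0 → e ≢ 0 × y′ ≈ y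
    end-cut′ = cut-end {α′} {g′ * m} {e′} {α} {g * m} {e} {n} {x′} {y′} {c′} {x} {y} {c} W′ W (len sh) (W<G 3≤g′ h′ y′) (c≉y sh′) (c≈y {e} {g} {h}) (sym (first y′))

    start-cut : α ≢ 0 → α′ ≢ 0 × x ≈ x′
    start-cut = cut-end {e} {g * m} {α} {e′} {g′ * m} {α′} {n} {y} {x} {a} {y′} {x′} {a′} W W′ (len-mirrored {α′} {e′} {g′} (len sh′)) (W<G 3≤g h x) (a≉x sh) (a≈x {α′} {h′}) (first-mirrored x)

    start-cut′ : α′ ≢ 0 → α ≢ 0 × x′ ≈ x
    start-cut′ = cut-end {e′} {g′ * m} {α′} {e} {g * m} {α} {n} {y′} {x′} {a′} {y} {x} {a} W′ W (len-mirrored {α} {e} {g} (len sh)) (W<G 3≤g′ h′ x′) (a≉x sh′) (a≈x {α} {h}) (sym (first-mirrored x′))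

    α+e : α + e ≈ α′ + e′
    α+e = trans (sym (reduce α g e (len sh))) (reduce α′ g′ e′ (len sh′))
      where
      reduce : ∀ α g e → n ≡ α + g * m + e → n ≈ α + e
      reduce α g e p = trans (≈-reflexive (trans p (eq α (g * m) e))) (+k*m-≈ (α + e) g)
        where
        eq : ∀ a b c → a + b + c ≡ a + c + b
        eq = solve-∀

    outer : x ≈ x′ → y ≈ y′ → ∀ j → δ j c + δ j a′ ≡ δ j c′ + δ j a
    outer x≈x′ y≈y′ j = +-cancelʳ-≡ (δ j x + δ j y) _ _ (begin
      δ j c + δ j a′ + (δ j x + δ j y)     ≡⟨ cong (λ d → δ j c + δ j a′ + (δ j x + d)) (δ-congʳ {j} {y} {y′} y≈y′) ⟩
      δ j c + δ j a′ + (δ j x + δ j y′)    ≡⟨ eq (δ j c) (δ j a′) (δ j x) (δ j y′) ⟩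
      δ j x + δ j c + (δ j a′ + δ j y′)    ≡⟨ zeroth j ⟩
      δ j x′ + δ j c′ + (δ j a + δ j y)    ≡⟨ eq (δ j c′) (δ j a) (δ j x′) (δ j y) ⟨
      δ j c′ + δ j a + (δ j x′ + δ j y)    ≡⟨ cong (λ d → δ j c′ + δ j a + (d + δ j y)) (δ-congʳ {j} {x} {x′} x≈x′) ⟨
      δ j c′ + δ j a + (δ j x + δ j y)     ∎)
      where
      eq : ∀ c a x y → c + a + (x + y) ≡ x + c + (a + y)
      eq = solve-∀

    -- `outer` also permits c ≈ a and c′ ≈ a′. In that case `first` at the letter a has a full n on
    -- one side and only W′ a < g′ * m ≤ n on the other.
    a≈a′ : α ≢ 0 → e ≢ 0 → a ≈ a′
    a≈a′ α≢0 e≢0 with a ≈? a′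
    ... | yes p = p
    ... | no a≉a′ = ⊥-elim (<⇒≢ smaller (sym (first a)))
      where
      x≈x′ = proj₂ (start-cut α≢0)
      y≈y′ = proj₂ (end-cut e≢0)
      bal : δ a c + 0 ≡ δ a c′ + 1
      bal = subst₂ (λ p q → δ a c + p ≡ δ a c′ + q) (δ-no {a} {a′} (a≉a′ ∘ sym)) (δ-yes {a} {a} refl) (outer x≈x′ y≈y′ a)
      c≈a : c ≈ a
      c≈a with c ≈? a
      ... | yes p = p
      ... | no ¬p = case trans (sym (cong (_+ 0) (δ-no {a} {c} ¬p))) (trans bal (+-comm _ 1)) of λ ()
      c′≉a : c′ ≉ a
      c′≉a p = case subst₂ (λ p q → p + 0 ≡ q + 1) (δ-yes {a} {c} c≈a) (δ-yes {a} {c′} p) bal of λ ()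
      zero* : ∀ A {z} → z ≉ a → A * δ a z ≡ 0
      zero* A {z} z≉a = trans (cong (A *_) (δ-no {a} {z} z≉a)) (*-zeroʳ A)
      smaller : α′ * δ a x′ + W′ a + n * δ a c′ + (α + g * m) * δ a y < α * δ a x + W a + n * δ a c + (α′ + g′ * m) * δ a y′
      smaller = begin-strict
        α′ * δ a x′ + W′ a + n * δ a c′ + (α + g * m) * δ a y
          ≤⟨ ≤-reflexive (cong₂ _+_ (cong₂ (λ p q → p + W′ a + q) (zero* α′ (λ p → a≉x sh α≢0 (sym (trans x≈x′ p)))) (zero* n c′≉a))
                                    (zero* (α + g * m) (λ p → c≉y sh e≢0 (trans c≈a (sym p))))) ⟩
        W′ a + 0 + 0
          ≤⟨ ≤-reflexive (trans (+-identityʳ _) (+-identityʳ _)) ⟩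
        W′ a
          <⟨ W<G 3≤g′ h′ a ⟩
        g′ * m
          ≤⟨ ≤-trans (≤-trans (m≤n+m (g′ * m) α′) (m≤m+n _ e′)) (≤-reflexive (sym (len sh′))) ⟩
        n
          ≤⟨ ≤-reflexive (sym (trans (cong (n *_) (δ-yes {a} {c} c≈a)) (*-identityʳ n))) ⟩
        n * δ a c
          ≤⟨ ≤-trans (m≤n+m (n * δ a c) (α * δ a x + W a)) (m≤m+n _ ((α′ + g′ * m) * δ a y′)) ⟩
        α * δ a x + W a + n * δ a c + (α′ + g′ * m) * δ a y′ □

    -- If an end is uncut, it is uncut in both factors, and the length modulo m settles the other;
    -- if both are cut, α is the distance from the letter a to the letter x, which the two factors
    -- share.
    α≡α′ : α ≡ α′
    α≡α′ with α ≟ 0 | e ≟ 0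
    ... | yes refl | _ with α′ ≟ 0
    ...   | yes refl = refl
    ...   | no α′≢0  = ⊥-elim (proj₁ (start-cut′ α′≢0) refl)
    α≡α′ | no α≢0 | yes refl = small-≈ (ā< sh) (ā< sh′)
      (trans (≈-reflexive (sym (+-identityʳ α))) (trans α+e (≈-reflexive (trans (cong (α′ +_) e′≡0) (+-identityʳ α′)))))
      where
      e′≡0 : e′ ≡ 0
      e′≡0 with e′ ≟ 0
      ... | yes p = p
      ... | no p  = ⊥-elim (proj₁ (end-cut′ p) refl)
    α≡α′ | no α≢0 | no e≢0 = small-≈ (ā< sh) (ā< sh′) (+-cancelˡ-≈ a {α} {α′} (begin
      (a + α) % m    ≡⟨ a+α≈x (ā< sh) h ⟩
      x % m          ≡⟨ proj₂ (start-cut α≢0) ⟩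
      x′ % m         ≡⟨ a+α≈x (ā< sh′) h′ ⟨
      (a′ + α′) % m  ≡⟨ +-cong-≈ {a′} {a} {α′} (sym (a≈a′ α≢0 e≢0)) refl ⟩
      (a + α′) % m   ∎))

    ge : g ≡ g′ × e ≡ e′
    ge = divMod-unique (b< sh) (b< sh′) (+-cancelˡ-≡ α _ _
      (trans (sym (+-assoc α (g * m) e)) (trans (sym (len sh)) (trans (len sh′) (trans (+-assoc α′ _ _) (cong (_+ (g′ * m + e′)) (sym α≡α′)))))))

    x≡x′ : α ≢ 0 → T (pred h) ≡ T (pred h′)
    x≡x′ α≢0 = T-cong (pred h) (pred h′) (proj₂ (start-cut α≢0))

    y≡y′ : e ≢ 0 → T (h + g) ≡ T (h′ + g′)
    y≡y′ e≢0 = T-cong (h + g) (h′ + g′) (proj₂ (end-cut e≢0))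

  -- Moments of the desubstituted factor.

  low-agree : ∀ {d F} → Low d F → ∀ j c g z z′ → (∀ i → i < d → mom j (power i c) g z ≡ mom j (power i c) g z′) →
    mom j (λ k → F (k + suc c)) g z ≡ mom j (λ k → F (k + suc c)) g z′
  low-agree low-0 j c g z z′ h = trans (vanish z) (sym (vanish z′))
    where
    vanish : ∀ z → mom j (λ _ → 0) g z ≡ 0
    vanish z = trans (∑-cong g (λ k _ → *-zeroʳ (δ j (z k)))) (∑-zero g)
  low-agree (low-^ i<d) j c g z z′ h = h _ i<d
  low-agree (low-+ {F} {G} p q) j c g z z′ h = trans (split z) (trans (cong₂ _+_ (low-agree p j c g z z′ h) (low-agree q j c g z z′ h)) (sym (split z′)))
    where
    split : ∀ z → mom j (λ k → F (k + suc c) + G (k + suc c)) g z ≡ mom j (λ k → F (k + suc c)) g z + mom j (λ k → G (k + suc c)) g z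
    split z = trans (∑-cong g (λ k _ → *-distribˡ-+ (δ j (z k)) _ _)) (∑-+ g _ _)
  low-agree (low-* a {F} p) j c g z z′ h = trans (pull z) (trans (cong (a *_) (low-agree p j c g z z′ h)) (sym (pull z′)))
    where
    pull : ∀ z → mom j (λ k → a * F (k + suc c)) g z ≡ a * mom j (λ k → F (k + suc c)) g z
    pull z = trans (∑-cong g (λ k _ → eq (δ j (z k)) a (F (k + suc c)))) (∑-* g a _)
      where
      eq : ∀ d a f → d * (a * f) ≡ a * (d * f)
      eq = solve-∀
  low-agree (low-ext {F} {G} e p) j c g z z′ h = trans (change z) (trans (low-agree p j c g z z′ h) (sym (change z′)))
    where
    change : ∀ z → mom j (λ k → G (k + suc c)) g z ≡ mom j (λ k → F (k + suc c)) g z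
    change z = ∑-cong g (λ k _ → cong (δ j (z k) *_) (sym (e (k + suc c))))

  -- The difference of H^(e+1) is (e + 1) H^e plus terms of lower degree, whose moments agree by
  -- induction; cancelling e + 1 gives degree e, one less than the degree used.
  differences⇒MomentsAgree : ∀ k g z z′ →
    (∀ E → E < suc k → ∀ c j → mom j (λ s → suc (s + suc c) ^ E) g z + mom j (power E c) g z′ ≡
                               mom j (λ s → suc (s + suc c) ^ E) g z′ + mom j (power E c) g z) →
    MomentsAgree k g z z′
  differences⇒MomentsAgree k g z z′ D e e<k c j = below (suc e) e<k e ≤-refl
    where
    expansion : ∀ e z → mom j (λ s → suc (s + suc c) ^ suc e) g z ≡
      mom j (power (suc e) c) g z + (suc e * mom j (power e c) g z + mom j (λ s → pow-tail e (s + suc c)) g z)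
    expansion e z = begin
      mom j (λ s → suc (s + suc c) ^ suc e) g z
        ≡⟨ ∑-cong g (λ s _ → trans (cong (δ j (z s) *_) (suc-^ e (s + suc c))) (eq (δ j (z s)) _ (suc e) _ _)) ⟩
      ∑ g (λ s → δ j (z s) * (s + suc c) ^ suc e + (suc e * (δ j (z s) * (s + suc c) ^ e) + δ j (z s) * pow-tail e (s + suc c)))
        ≡⟨ trans (∑-+ g _ _) (cong (mom j (power (suc e) c) g z +_) (trans (∑-+ g _ _)
             (cong (_+ mom j (λ s → pow-tail e (s + suc c)) g z) (∑-* g (suc e) _)))) ⟩
      mom j (power (suc e) c) g z + (suc e * mom j (power e c) g z + mom j (λ s → pow-tail e (s + suc c)) g z) ∎
      where
      eq : ∀ d p a q r → d * (p + (a * q + r)) ≡ d * p + (a * (d * q) + d * r)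
      eq = solve-∀
    below : ∀ e → e ≤ k → ∀ i → i < e → mom j (power i c) g z ≡ mom j (power i c) g z′
    below (suc e) e<k i i<1+e with i ≟ e
    ... | no i≢e = below e (<⇒≤ e<k) i (≤∧≢⇒< (s≤s⁻¹ i<1+e) i≢e)
    ... | yes refl = *-cancelˡ-≡ _ _ (suc e) (+-cancelʳ-≡ L _ _ (+-cancelˡ-≡ (S + S′) _ _ (begin
      S + S′ + (suc e * P + L)       ≡⟨ eq₁ S S′ (suc e * P) L ⟩
      S + (suc e * P + L) + S′       ≡⟨ cong (_+ S′) (expansion e z) ⟨
      mom j (λ s → suc (s + suc c) ^ suc e) g z + S′   ≡⟨ D (suc e) (s≤s e<k) c j ⟩
      mom j (λ s → suc (s + suc c) ^ suc e) g z′ + S   ≡⟨ cong (_+ S) (expansion e z′) ⟩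
      S′ + (suc e * P′ + L′) + S     ≡⟨ cong (λ x → S′ + (suc e * P′ + x) + S) (low-agree (pow-tail-low e) j c g z z′ (below e (<⇒≤ e<k))) ⟨
      S′ + (suc e * P′ + L) + S      ≡⟨ eq₂ S S′ (suc e * P′) L ⟩
      S + S′ + (suc e * P′ + L)      ∎)))
      where
      S = mom j (power (suc e) c) g z ; S′ = mom j (power (suc e) c) g z′
      P = mom j (power e c) g z ; P′ = mom j (power e c) g z′
      L = mom j (λ s → pow-tail e (s + suc c)) g z ; L′ = mom j (λ s → pow-tail e (s + suc c)) g z′
      eq₁ : ∀ a b c d → a + b + (c + d) ≡ a + (c + d) + b
      eq₁ = solve-∀
      eq₂ : ∀ a b c d → b + (c + d) + a ≡ a + b + (c + d)
      eq₂ = solve-∀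

  -- The end terms cancel and (Q^m - 1) W remains. Measured with the shift `c₀`, the block
  -- boundaries lie at multiples of m, and m ^ E factors out.
  descend : ∀ {k n α e g i h i′ h′} → Shape m n α e g i h → Shape m n α e g i′ h′ →
    (α ≢ 0 → T (pred h) ≡ T (pred h′)) → (e ≢ 0 → T (h + g) ≡ T (h′ + g)) →
    MomentsAgree (suc k) n (T ∘ (i +_)) (T ∘ (i′ +_)) → MomentsAgree k g (T ∘ (h +_)) (T ∘ (h′ +_))
  descend {k} {n} {α} {e} {g} {i} {h} {i′} {h′} sh sh′ x≡x′ y≡y′ same = differences⇒MomentsAgree k g (T ∘ (h +_)) (T ∘ (h′ +_)) D
    where
    D : ∀ E → E < suc k → ∀ c j → mom j (λ s → suc (s + suc c) ^ E) g (T ∘ (h +_)) + mom j (power E c) g (T ∘ (h′ +_)) ≡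
                                  mom j (λ s → suc (s + suc c) ^ E) g (T ∘ (h′ +_)) + mom j (power E c) g (T ∘ (h +_))
    D E E<k c j = *-cancelˡ-≡ _ _ (m ^ E) {{m^n≢0 m E}} (begin
      m ^ E * (mom j (λ s → suc (s + suc c) ^ E) g (T ∘ (h +_)) + mom j (power E c) g (T ∘ (h′ +_)))
        ≡⟨ trans (*-distribˡ-+ (m ^ E) _ _) (sym (cong₂ _+_ (scale⁺ h) (scale h′))) ⟩
      W⁺ h + W h′     ≡⟨ cancel (left , right) ⟩
      W⁺ h′ + W h     ≡⟨ trans (*-distribˡ-+ (m ^ E) _ _) (sym (cong₂ _+_ (scale⁺ h′) (scale h))) ⟨
      m ^ E * (mom j (λ s → suc (s + suc c) ^ E) g (T ∘ (h′ +_)) + mom j (power E c) g (T ∘ (h +_))) ∎)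
      where
      c₀ : ℕ
      -- Chosen so that the position α + s * m plus the shift `suc c₀` is m * (s + suc c).
      c₀ = m * suc c ∸ suc α
      c₀+α : c₀ + suc α ≡ m * suc c
      c₀+α = m∸n+n≡m (≤-trans (Shape.ā< sh) (m≤m*n m (suc c)))
      f : ℕ → ℕ
      f = power E c₀
      W⁺ W X A C Y : ℕ → ℕ
      W⁺ h = mom j (λ k → f (α + k * m + m)) g (T ∘ (h +_))
      W h = mom j (λ k → f (α + k * m)) g (T ∘ (h +_))
      X h = δ j (T (pred h)) * f α
      A h = δ j (letter-a α h) * f 0
      C h = δ j (letter-c e g h) * f n
      Y h = δ j (T (h + g)) * f (α + g * m)
      scale⁺ : ∀ h → W⁺ h ≡ m ^ E * mom j (λ s → suc (s + suc c) ^ E) g (T ∘ (h +_))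
      scale⁺ h = trans (∑-cong g (λ s _ → trans (cong (δ j (T (h + s)) *_) (trans (cong (_^ E) (arg s)) (^-distribʳ-* E m (suc (s + suc c)))))
                                           (eq (δ j (T (h + s))) (m ^ E) _))) (∑-* g (m ^ E) _)
        where
        arg : ∀ s → α + s * m + m + suc c₀ ≡ m * suc (s + suc c)
        arg s = trans (eq₁ α s m c₀) (trans (cong (λ x → m * suc s + x) c₀+α) (eq₂ s m c))
          where
          eq₁ : ∀ α s m c₀ → α + s * m + m + suc c₀ ≡ m * suc s + (c₀ + suc α)
          eq₁ = solve-∀
          eq₂ : ∀ s m c → m * suc s + m * suc c ≡ m * suc (s + suc c)
          eq₂ = solve-∀
        eq : ∀ d p q → d * (p * q) ≡ p * (d * q)
        eq = solve-∀
      scale : ∀ h → W h ≡ m ^ E * mom j (power E c) g (T ∘ (h +_))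
      scale h = trans (∑-cong g (λ s _ → trans (cong (δ j (T (h + s)) *_) (trans (cong (_^ E) (arg s)) (^-distribʳ-* E m (s + suc c))))
                                           (eq (δ j (T (h + s))) (m ^ E) _))) (∑-* g (m ^ E) _)
        where
        arg : ∀ s → α + s * m + suc c₀ ≡ m * (s + suc c)
        arg s = trans (eq₁ α s m c₀) (trans (cong (λ x → m * s + x) c₀+α) (sym (*-distribˡ-+ m s (suc c))))
          where
          eq₁ : ∀ α s m c₀ → α + s * m + suc c₀ ≡ m * s + (c₀ + suc α)
          eq₁ = solve-∀
        eq : ∀ d p q → d * (p * q) ≡ p * (d * q)
        eq = solve-∀
      left : X h + A h′ ≡ X h′ + A h
      left with α ≟ 0
      ... | no α≢0   = cong₂ (λ p q → δ j p * f α + δ j q * f 0) (x≡x′ α≢0) (cong (_+ (m ∸ α)) (sym (x≡x′ α≢0)))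
      -- An uncut end contributes the same term to `hi` and to `lo`, whatever its letter.
      ... | yes refl = trans (cong₂ _+_ (X≡A h) (sym (X≡A h′))) (+-comm _ (X h′))
        where
        X≡A : ∀ h → δ j (T (pred h)) * f 0 ≡ δ j (letter-a 0 h) * f 0
        X≡A h = cong (_* f 0) (δ-congʳ {j} {T (pred h)} {letter-a 0 h} (sym (+m-≈ (T (pred h)))))
      right : C h + Y h′ ≡ C h′ + Y h
      right with e ≟ 0
      ... | no e≢0   = cong₂ (λ p q → δ j (p + e) * f n + δ j q * f (α + g * m)) (y≡y′ e≢0) (sym (y≡y′ e≢0))
      ... | yes refl = trans (cong₂ _+_ (C≡Y h) (sym (C≡Y h′))) (+-comm _ (δ j (letter-c 0 g h′) * f n))
        where
        C≡Y : ∀ h → δ j (letter-c 0 g h) * f n ≡ δ j (T (h + g)) * f (α + g * m)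
        C≡Y h = cong₂ (λ p q → δ j p * f q) (+-identityʳ (T (h + g))) (trans (Shape.len sh) (+-identityʳ (α + g * m)))
      cancel : (X h + A h′ ≡ X h′ + A h) × (C h + Y h′ ≡ C h′ + Y h) → W⁺ h + W h′ ≡ W⁺ h′ + W h
      cancel (l , r) = +-cancelˡ-≡ ((X h + A h′) + (C h + Y h′)) _ _ (begin
        X h + A h′ + (C h + Y h′) + (W⁺ h + W h′)       ≡⟨ eq (X h) (A h′) (C h) (Y h′) (W⁺ h) (W h′) ⟩
        X h + W⁺ h + C h + (A h′ + W h′ + Y h′)         ≡⟨ boundaries-agree sh sh′ same E E<k c₀ j ⟩
        X h′ + W⁺ h′ + C h′ + (A h + W h + Y h)         ≡⟨ eq (X h′) (A h) (C h′) (Y h) (W⁺ h′) (W h) ⟨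
        X h′ + A h + (C h′ + Y h) + (W⁺ h′ + W h)       ≡⟨ cong₂ (λ p q → p + q + (W⁺ h′ + W h)) l r ⟨
        X h + A h′ + (C h + Y h′) + (W⁺ h′ + W h)       ∎)
        where
        eq : ∀ X A C Y W⁺ W → X + A + (C + Y) + (W⁺ + W) ≡ X + W⁺ + C + (A + W + Y)
        eq = solve-∀

  -- Induction over the σ-levels.

  ceiling : ∀ M .{{_ : NonZero M}} i → ∃₂ λ ā q → i + ā ≡ q * M × ā < M
  ceiling M i with divMod M i
  ... | q , zero  , refl , _   = 0 , q , trans (+-identityʳ _) (+-identityʳ _) , >-nonZero⁻¹ M
  ... | q , suc r , refl , r<M = M ∸ suc r , suc q ,
    trans (+-assoc (q * M) (suc r) _) (trans (cong (q * M +_) (m+[n∸m]≡n (<⇒≤ r<M))) (+-comm (q * M) M)) ,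
    ∸-monoʳ-< {M} {suc r} {0} z<s (<⇒≤ r<M)

  lengths : ∀ M .{{_ : NonZero M}} {n} ā → ā ≤ n → ∃₂ λ g b → n ≡ ā + g * M + b × b < M
  lengths M {n} ā ā≤n with divMod M (n ∸ ā)
  ... | g , b , eq , b<M = g , b , trans (sym (m+[n∸m]≡n ā≤n)) (trans (cong (ā +_) eq) (sym (+-assoc ā (g * M) b))) , b<M

  shape-exists : ∀ M .{{_ : NonZero M}} {n} → M ≤ n → ∀ i → ∃₂ λ ā b → ∃₂ λ g q → Shape M n ā b g i q
  shape-exists M M≤n i with ceiling M i
  ... | ā , q , st , ā<M with lengths M ā (<⇒≤ (<-≤-trans ā<M M≤n))
  ... | g , b , len , b<M = ā , b , g , q , shape st ā<M len b<M

  ceiling-unique : ∀ M .{{_ : NonZero M}} {i ā q ā′ q′} → i + ā ≡ q * M → ā < M → i + ā′ ≡ q′ * M → ā′ < M → ā ≡ ā′ × q ≡ q′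
  ceiling-unique M {i} {ā} {q} {ā′} {q′} st ā<M st′ ā′<M = ā≡ā′ , *-cancelʳ-≡ q q′ M (trans (sym st) (trans (cong (i +_) ā≡ā′) st′))
    where
    module R = Residues M
    vanish : ∀ q → q * M R.≈ 0
    vanish q = R.+k*m-≈ 0 q
    ā≡ā′ : ā ≡ ā′
    ā≡ā′ = R.small-≈ ā<M ā′<M (R.+-cancelˡ-≈ i {ā} {ā′}
      (trans (R.≈-reflexive st) (trans (vanish q) (trans (sym (vanish q′)) (R.≈-reflexive (sym st′))))))

  lengths-unique : ∀ M .{{_ : NonZero M}} {n ā g b g′ b′} → n ≡ ā + g * M + b → b < M → n ≡ ā + g′ * M + b′ → b′ < M → g ≡ g′ × b ≡ b′
  lengths-unique M {n} {ā} {g} {b} {g′} {b′} l b<M l′ b′<M = Residues.divMod-unique M b<M b′<M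
    (+-cancelˡ-≡ ā _ _ (trans (sym (+-assoc ā (g * M) b)) (trans (sym l) (trans l′ (+-assoc ā (g′ * M) b′)))))

  MomentsAgree⇒count : ∀ {n z z′} → MomentsAgree 1 n z z′ → ∀ j → count n z j ≡ count n z′ j
  MomentsAgree⇒count {n} {z} {z′} h j = trans (sym (unit z)) (trans (h 0 z<s 0 j) (unit z′))
    where
    unit : ∀ z → mom j (λ _ → 1) n z ≡ count n z j
    unit z = ∑-cong n (λ s _ → *-identityʳ (δ j (z s)))

  whole : ∀ n i → Shape 1 n 0 0 n i i
  whole n i = shape (trans (+-identityʳ i) (sym (*-identityʳ i))) z<s (sym (trans (+-identityʳ _) (*-identityʳ n))) z<s

  Same₀ : ∀ n i i′ → MomentsAgree 1 n (T ∘ (i +_)) (T ∘ (i′ +_)) → Same 0 n i i′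
  Same₀ n i i′ same = 0 , 0 , n , i , i′ , whole n i , whole n i′ ,
    agree (λ 0≢0 → ⊥-elim (0≢0 refl)) (λ 0≢0 → ⊥-elim (0≢0 refl)) (MomentsAgree⇒count {n} {T ∘ (i +_)} {T ∘ (i′ +_)} same)

  -- Each letter of the desubstituted factor stands for m letters, so its cut lengths ā and b are
  -- scaled by m and the ends α and e are added.
  refine : ∀ {K n α e g i h ā b g′ q} → Shape m n α e g i h → Shape (m ^ K) g ā b g′ h q →
    Shape (m ^ suc K) n (α + ā * m) (b * m + e) g′ i q
  refine {K} {n} {α} {e} {g} {i} {h} {ā} {b} {g′} {q} (shape st α< len e<) (shape st′ ā< len′ b<) = shape
    (trans (sym (+-assoc i α (ā * m))) (trans (cong (_+ ā * m) st) (trans (sym (*-distribʳ-+ m h ā)) (trans (cong (_* m) st′) (eq₁ q M m)))))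
    (<-≤-trans (+-monoˡ-< (ā * m) α<) (≤-trans (*-monoˡ-≤ m ā<) (≤-reflexive (*-comm M m))))
    (trans len (trans (cong (λ x → α + x * m + e) len′) (eq₂ α e ā b g′ M m)))
    (<-≤-trans (+-monoʳ-< (b * m) e<) (≤-trans (≤-reflexive (+-comm (b * m) m)) (≤-trans (*-monoˡ-≤ m b<) (≤-reflexive (*-comm M m)))))
    where
    M = m ^ K
    eq₁ : ∀ q M m → q * M * m ≡ q * (m * M)
    eq₁ = solve-∀
    eq₂ : ∀ α e ā b g′ M m → α + (ā + g′ * M + b) * m + e ≡ α + ā * m + g′ * (m * M) + (b * m + e)
    eq₂ = solve-∀

  -- When ā = 0 but α is nonzero, σ-block number h - 1 is the last one of the σ^(K+1)-block that is
  -- cut, so the letters of the two differ by the constant T (M - 1). On the right, when b = 0,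
  -- σ-block number h + g is the first one, with constant T 0.
  refine-agree : ∀ {K n α e g i h i′ h′ ā b g′ q q′} → Shape m n α e g i h → Shape m n α e g i′ h′ →
    Shape (m ^ K) g ā b g′ h q → Shape (m ^ K) g ā b g′ h′ q′ →
    (α ≢ 0 → T (pred h) ≡ T (pred h′)) → (e ≢ 0 → T (h + g) ≡ T (h′ + g)) →
    Agree ā b g′ q q′ → Agree (α + ā * m) (b * m + e) g′ q q′
  refine-agree {K} {n} {α} {e} {g} {i} {h} {i′} {h′} {ā} {b} {g′} {q} {q′} sh sh′ sh₁ sh₁′ x≡x′ y≡y′ (agree left right mid) = agree left⁺ right⁺ mid
    where
    M = m ^ K
    instance
      M≢0 : NonZero M
      M≢0 = m^n≢0 m K
    left⁺ : α + ā * m ≢ 0 → T (pred q) ≡ T (pred q′)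
    left⁺ nz with ā ≟ 0
    ... | no ā≢0 = left ā≢0
    ... | yes refl = T-cong (pred q) (pred q′) (+-cancelʳ-≈ (T (pred M)) {T (pred q)} {T (pred q′)}
      (trans (sym (value h q (Shape.start sh₁) (Shape.start sh))) (trans (cong (_% m) (x≡x′ α≢0)) (value h′ q′ (Shape.start sh₁′) (Shape.start sh′)))))
      where
      α≢0 : α ≢ 0
      α≢0 refl = nz refl
      value : ∀ {i} h q → h + 0 ≡ q * M → i + α ≡ h * m → T (pred h) ≈ T (pred q) + T (pred M)
      value {i} h zero    st st₀ = ⊥-elim (α≢0 (m+n≡0⇒n≡0 i (trans st₀ (cong (_* m) (trans (sym (+-identityʳ h)) st)))))
      value h (suc q) st _ = trans (≈-reflexive (cong T pred-h)) (T-level K q (pred M) (≤-reflexive (suc-pred M)))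
        where
        pred-h : pred h ≡ q * M + pred M
        pred-h = trans (cong pred (trans (sym (+-identityʳ h)) (trans st (trans (+-comm M (q * M)) (trans (cong (q * M +_) (sym (suc-pred M))) (+-suc (q * M) (pred M))))))) refl
    right⁺ : b * m + e ≢ 0 → T (q + g′) ≡ T (q′ + g′)
    right⁺ nz with b ≟ 0
    ... | no b≢0 = right b≢0
    ... | yes refl = T-cong (q + g′) (q′ + g′) (+-cancelʳ-≈ (T 0) {T (q + g′)} {T (q′ + g′)}
      (trans (sym (value h q (Shape.start sh₁))) (trans (cong (_% m) (y≡y′ (λ { refl → nz refl }))) (value h′ q′ (Shape.start sh₁′)))))
      where
      value : ∀ h q → h + ā ≡ q * M → T (h + g) ≈ T (q + g′) + T 0
      value h q st = trans (≈-reflexive (cong T (begin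
        h + g                      ≡⟨ cong (h +_) (Shape.len sh₁) ⟩
        h + (ā + g′ * M + 0)       ≡⟨ eq₁ h ā (g′ * M) ⟩
        h + ā + g′ * M + 0         ≡⟨ cong (λ x → x + g′ * M + 0) st ⟩
        q * M + g′ * M + 0         ≡⟨ cong (_+ 0) (*-distribʳ-+ M q g′) ⟨
        (q + g′) * M + 0           ∎))) (T-level K (q + g′) 0 (>-nonZero⁻¹ M))
        where
        eq₁ : ∀ h ā G → h + (ā + G + 0) ≡ h + ā + G + 0
        eq₁ = solve-∀

  -- The form with `suc n` is the one that survives descent: α and e are at most m - 1, so n + 1 <
  -- (g + 2) * m.
  length-bound : ∀ K {n α e g i h} → Shape m n α e g i h → 2 * m ^ suc (suc K) ≤ suc n → 2 * m ^ suc K ≤ suc g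
  length-bound K {n} {α} {e} {g} (shape _ α< len e<) bound = s≤s⁻¹ (*-cancelʳ-< _ _ _ (begin-strict
    2 * m ^ suc K * m       ≤⟨ ≤-reflexive (eq₁ m (m ^ suc K)) ⟩
    2 * m ^ suc (suc K)     ≤⟨ bound ⟩
    suc n                   ≤⟨ ≤-reflexive (trans (cong suc len) (eq₂ α (g * m) e)) ⟩
    suc α + (g * m + e)     <⟨ +-mono-≤-< α< (+-monoʳ-< (g * m) e<) ⟩
    m + (g * m + m)         ≤⟨ ≤-reflexive (eq₃ m g) ⟩
    suc (suc g) * m         □))
    where
    eq₁ : ∀ m M → 2 * M * m ≡ 2 * (m * M)
    eq₁ = solve-∀
    eq₂ : ∀ α G e → suc (α + G + e) ≡ suc α + (G + e)
    eq₂ = solve-∀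
    eq₃ : ∀ m g → m + (g * m + m) ≡ (suc (suc g)) * m
    eq₃ = solve-∀

  m≤m^suc : ∀ K → m ≤ m ^ suc K
  m≤m^suc K = m≤m*n m (m ^ K) {{m^n≢0 m K}}

  MomentsAgree⇒Same : ∀ K n i i′ → 2 * m ^ suc K ≤ suc n → MomentsAgree (suc K) n (T ∘ (i +_)) (T ∘ (i′ +_)) → Same K n i i′
  MomentsAgree⇒Same zero    n i i′ _ same = Same₀ n i i′ same
  MomentsAgree⇒Same (suc K) n i i′ bound same with shape-exists m m≤n i | shape-exists m m≤n i′
    where
    m≤n : m ≤ n
    m≤n = s≤s⁻¹ (≤-trans (+-mono-≤ (<⇒≤ 2≤m) (m≤m^suc (suc K)))
      (≤-trans (+-mono-≤ (m≤m^suc (suc K)) (≤-reflexive (sym (+-identityʳ _)))) bound))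
  ... | α , e , g , h , sh | α′ , e′ , g′ , h′ , sh′ =
    conclude F.α≡α′ F.ge sh′ F.x≡x′ F.y≡y′
    where
    three : ∀ {α e g i h} → Shape m n α e g i h → 3 ≤ g
    -- 2 * m ^ suc K is at least 4, so `suc g` is.
    three s = s≤s⁻¹ (≤-trans (*-monoʳ-≤ 2 (≤-trans 2≤m (m≤m^suc K))) (length-bound K s bound))
    low : MomentsAgree 2 n (T ∘ (i +_)) (T ∘ (i′ +_))
    low E E<2 = same E (≤-trans E<2 (s≤s (s≤s z≤n)))
    module F = FirstLevel sh sh′ (three sh) (three sh′) low
    combine : ∀ {h h′} → Shape m n α e g i h → Shape m n α e g i′ h′ →
      (α ≢ 0 → T (pred h) ≡ T (pred h′)) → (e ≢ 0 → T (h + g) ≡ T (h′ + g)) → Same K g h h′ → Same (suc K) n i i′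
    combine sh sh′ x≡x′ y≡y′ (ā , b , g₁ , q , q′ , sh₁ , sh₁′ , ag) =
      α + ā * m , b * m + e , g₁ , q , q′ , refine {K} sh sh₁ , refine {K} sh′ sh₁′ , refine-agree {K} sh sh′ sh₁ sh₁′ x≡x′ y≡y′ ag
    -- Stated for arbitrary α′, e′ and g′ so that the equalities found by `FirstLevel` can be
    -- matched with `refl`.
    conclude : ∀ {α′ e′ g′ h′} → α ≡ α′ → g ≡ g′ × e ≡ e′ → Shape m n α′ e′ g′ i′ h′ →
      (α ≢ 0 → T (pred h) ≡ T (pred h′)) → (e ≢ 0 → T (h + g) ≡ T (h′ + g′)) → Same (suc K) n i i′
    conclude {h′ = h′} refl (refl , refl) sh′ x≡x′ y≡y′ = combine sh sh′ x≡x′ y≡y′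
      (MomentsAgree⇒Same K g h h′ (length-bound K sh bound) (descend sh sh′ x≡x′ y≡y′ same))

  ∼⇒Same : ∀ K n i i′ → 2 * m ^ suc K ≤ suc n → factor m i n ∼[ suc K ] factor m i′ n → Same K n i i′
  ∼⇒Same K n i i′ bound h = MomentsAgree⇒Same K n i i′ bound (∼⇒MomentsAgree (suc K) n i i′ h)

  ∼₁⇒Same : ∀ n i i′ → factor m i n ∼[ 1 ] factor m i′ n → Same 0 n i i′
  ∼₁⇒Same n i i′ h = Same₀ n i i′ (∼⇒MomentsAgree 1 n i i′ h)

  -- Windows of t_m with prescribed neighbouring letters.

  +neg-≈ : ∀ a c → a + neg c + c ≈ a
  +neg-≈ a c = trans (≈-reflexive (eq a (neg c) c)) (+-neg a c)
    where
    eq : ∀ a b c → a + b + c ≡ a + c + b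
    eq = solve-∀

  -- m^β - 1 has β digits m - 1, each congruent to -1.
  T-max-digits : ∀ β → T (pred (m ^ β)) + β ≈ 0
  T-max-digits zero    = ≈-reflexive (trans (+-identityʳ (T 0)) (T-small 0 0<m))
  T-max-digits (suc β) = begin
    (T (pred (m * m ^ β)) + suc β) % m                 ≡⟨ ≈-reflexive (cong (λ x → T x + suc β) digits) ⟩
    (T (pred (m ^ β) * m + pred m) + suc β) % m        ≡⟨ +-cong-≈ {b = suc β} (T-block-≈ (pred (m ^ β)) (pred m) (≤-reflexive (suc-pred m))) refl ⟩
    (T (pred (m ^ β)) + pred m + suc β) % m            ≡⟨ ≈-reflexive (eq (T (pred (m ^ β))) (pred m) β) ⟩
    (T (pred (m ^ β)) + β + suc (pred m)) % m          ≡⟨ ≈-reflexive (cong (T (pred (m ^ β)) + β +_) (suc-pred m)) ⟩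
    (T (pred (m ^ β)) + β + m) % m                     ≡⟨ +m-≈ _ ⟩
    (T (pred (m ^ β)) + β) % m                         ≡⟨ T-max-digits β ⟩
    0 % m                                              ∎
    where
    instance
      _ = m^n≢0 m β
    eq : ∀ a b c → a + b + suc c ≡ a + c + suc b
    eq = solve-∀
    digits : pred (m * m ^ β) ≡ pred (m ^ β) * m + pred m
    digits = cong pred (begin
      m * m ^ β                          ≡⟨ *-comm m (m ^ β) ⟩
      m ^ β * m                          ≡⟨ cong (_* m) (suc-pred (m ^ β)) ⟨
      m + pred (m ^ β) * m               ≡⟨ +-comm m _ ⟩
      pred (m ^ β) * m + m               ≡⟨ cong (pred (m ^ β) * m +_) (suc-pred m) ⟨
      pred (m ^ β) * m + suc (pred m)    ≡⟨ +-suc _ (pred m) ⟩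
      suc (pred (m ^ β) * m + pred m)    ∎)

  -- The number of trailing digits m - 1 of v controls T (v + 1) - T v.
  two-letters : ∀ P R → ∃ λ v → T v ≈ P × T (suc v) ≈ R
  two-letters P R = v , Tv , Tv+1
    where
    β y v : ℕ
    -- v has the digits y, 0 and then β times m - 1; v + 1 has y, 1 and then β zeros. The digit sums
    -- y - β and y + 1 have to be P and R, whence β ≈ R - P - 1 and y ≈ P + β.
    β = R + neg (suc P)
    y = (P + β) % m
    v = y * m * m ^ β + pred (m ^ β)
    instance
      _ = m^n≢0 m β
    y<m : y < m
    y<m = m%n<n (P + β) m
    Tym : ∀ s → s < m → T (y * m + s) ≈ P + β + s
    Tym s s<m = begin
      T (y * m + s) % m    ≡⟨ T-block-≈ y s s<m ⟩
      (T y + s) % m        ≡⟨ ≈-reflexive (cong (_+ s) (T-small y y<m)) ⟩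
      (y + s) % m          ≡⟨ +-cong-≈ {b = s} (%-≈ (P + β)) refl ⟩
      (P + β + s) % m      ∎
    Tv : T v ≈ P
    Tv = begin
      T v % m                              ≡⟨ T-level β (y * m) (pred (m ^ β)) (≤-reflexive (suc-pred (m ^ β))) ⟩
      (T (y * m) + T (pred (m ^ β))) % m   ≡⟨ +-cong-≈ {b = T (pred (m ^ β))} (trans (≈-reflexive (cong T (sym (+-identityʳ (y * m))))) (Tym 0 0<m)) refl ⟩
      (P + β + 0 + T (pred (m ^ β))) % m   ≡⟨ ≈-reflexive (eq P β (T (pred (m ^ β)))) ⟩
      (P + (T (pred (m ^ β)) + β)) % m     ≡⟨ +-cong-≈ {P} refl (T-max-digits β) ⟩
      (P + 0) % m                          ≡⟨ ≈-reflexive (+-identityʳ P) ⟩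
      P % m                                ∎
      where
      eq : ∀ P β n → P + β + 0 + n ≡ P + (n + β)
      eq = solve-∀
    Tv+1 : T (suc v) ≈ R
    Tv+1 = begin
      T (suc v) % m                     ≡⟨ ≈-reflexive (cong T suc-v) ⟩
      T ((y * m + 1) * m ^ β + 0) % m   ≡⟨ T-level β (y * m + 1) 0 (>-nonZero⁻¹ (m ^ β)) ⟩
      (T (y * m + 1) + T 0) % m         ≡⟨ +-cong-≈ {b = T 0} (Tym 1 2≤m) (≈-reflexive (T-small 0 0<m)) ⟩
      (P + β + 1 + 0) % m               ≡⟨ ≈-reflexive (eq P R (neg (suc P))) ⟩
      (R + neg (suc P) + suc P) % m     ≡⟨ +neg-≈ R (suc P) ⟩
      R % m                             ∎
      where
      eq : ∀ P R n → P + (R + n) + 1 + 0 ≡ R + n + suc P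
      eq = solve-∀
      suc-v : suc v ≡ (y * m + 1) * m ^ β + 0
      suc-v = begin
        suc (y * m * m ^ β + pred (m ^ β))  ≡⟨ +-suc (y * m * m ^ β) _ ⟨
        y * m * m ^ β + suc (pred (m ^ β))  ≡⟨ cong (y * m * m ^ β +_) (suc-pred (m ^ β)) ⟩
        y * m * m ^ β + m ^ β               ≡⟨ eq′ (y * m) (m ^ β) ⟩
        (y * m + 1) * m ^ β + 0             ∎
        where
        eq′ : ∀ a b → a * b + b ≡ (a + 1) * b + 0
        eq′ = solve-∀

  record Triple : Set where
    constructor triple
    field
      A α B : ℕ
  open Triple public

  module _ (g : ℕ) where

    -- A window of g letters starting at q: α letters remain in the σ-block of the first one,
    -- A - 1 precedes the window and B + g follows it.
    record Param (q A α B : ℕ) : Set where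
      constructor param
      field
        α<     : α < m
        block  : ∃ λ h → q + α ≡ h * m
        before : suc (T (pred q)) ≈ A
        after  : T (q + g) ≈ B + g

    -- (1 - X) times the letter-count polynomial of the window is `gained` - `lost`, that is X^A +
    -- X^(B+α) - X^(A+α) - X^(B+g).
    gained lost : ℕ → ℕ → ℕ → ℕ → ℕ
    gained A α B j = δ j A + δ j (B + α)
    lost   A α B j = δ j (A + α) + δ j (B + g)

    param-exists : ∀ q → ∃₂ λ A α → ∃ λ B → Param q A α B
    param-exists q with ceiling m q
    ... | α , h , st , α< = suc (T (pred q)) , α , T (q + g) + neg g , param α< (h , st) refl (sym (+neg-≈ (T (q + g)) g))

    -- The window is laid across a multiple of m^g, which exceeds g; so its neighbours lie in the
    -- adjacent blocks v and v + 1, and their letters are `T v` and `T (suc v)` up to constants.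
    -- `two-letters` prescribes these freely.
    realise : m ≤ g → ∀ A α B → α < m → ∃ λ q → q ≢ 0 × Param q A α B
    realise m≤g A α B α<m with two-letters (A + neg (suc (T (m ^ g ∸ suc α)))) (B + g + neg (T (g ∸ α)))
    ... | v , Tv , Tv+1 = q , q≢0 , param α<m (suc v * m ^ pred g , block) before after
      where
      L q : ℕ
      L = m ^ g
      q = v * L + (L ∸ α)
      α<L : α < L
      α<L = <-≤-trans α<m (≤-trans m≤g (<⇒≤ (n<m^n g)))
      L∸α : L ∸ α ≡ suc (L ∸ suc α)
      L∸α = sym (trans (sym (+-∸-assoc 1 α<L)) refl)
      q≢0 : q ≢ 0
      q≢0 q≡0 = case trans (sym (trans (cong (v * L +_) L∸α) (+-suc (v * L) _))) q≡0 of λ ()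
      pred-q : pred q ≡ v * L + (L ∸ suc α)
      pred-q = cong pred (trans (cong (v * L +_) L∸α) (+-suc (v * L) (L ∸ suc α)))
      q+α : q + α ≡ suc v * L
      q+α = trans (+-assoc (v * L) (L ∸ α) α) (trans (cong (v * L +_) (m∸n+n≡m (<⇒≤ α<L))) (+-comm (v * L) L))
      block : q + α ≡ suc v * m ^ pred g * m
      block = trans q+α (trans (cong (suc v *_) (trans (cong (m ^_) (sym suc-g)) (*-comm m (m ^ pred g)))) (sym (*-assoc (suc v) (m ^ pred g) m)))
        where
        suc-g : suc (pred g) ≡ g
        suc-g = suc-pred g {{>-nonZero (<-≤-trans 0<m m≤g)}}
      before : suc (T (pred q)) ≈ A
      before = begin
        suc (T (pred q)) % m                        ≡⟨ ≈-reflexive (cong (λ x → suc (T x)) pred-q) ⟩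
        suc (T (v * L + (L ∸ suc α))) % m           ≡⟨ +-cong-≈ {1} refl (T-level g v (L ∸ suc α) (∸-monoʳ-< {L} {suc α} {0} z<s α<L)) ⟩
        (1 + (T v + T (L ∸ suc α))) % m             ≡⟨ +-cong-≈ {1} refl (+-cong-≈ {b = T (L ∸ suc α)} Tv refl) ⟩
        (1 + (A + neg (suc N) + N)) % m             ≡⟨ ≈-reflexive (sym (+-suc (A + neg (suc N)) N)) ⟩
        (A + neg (suc N) + suc N) % m               ≡⟨ +neg-≈ A (suc N) ⟩
        A % m                                       ∎
        where
        N = T (L ∸ suc α)
      after : T (q + g) ≈ B + g
      after = begin
        T (q + g) % m                       ≡⟨ ≈-reflexive (cong T q+g) ⟩
        T (suc v * L + (g ∸ α)) % m         ≡⟨ T-level g (suc v) (g ∸ α) (≤-<-trans (m∸n≤m g α) (n<m^n g)) ⟩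
        (T (suc v) + T (g ∸ α)) % m         ≡⟨ +-cong-≈ {b = T (g ∸ α)} Tv+1 refl ⟩
        (B + g + neg (T (g ∸ α)) + T (g ∸ α)) % m ≡⟨ +neg-≈ (B + g) (T (g ∸ α)) ⟩
        (B + g) % m                         ∎
        where
        q+g : q + g ≡ suc v * L + (g ∸ α)
        q+g = trans (cong (q +_) (sym (m+[n∸m]≡n (<⇒≤ (<-≤-trans α<m m≤g))))) (trans (sym (+-assoc q α (g ∸ α))) (cong (_+ (g ∸ α)) q+α))

    -- The boundary identity in degree 0, with its end terms rewritten through A and B.
    count-step : m ≤ g → ∀ {q A α B} → Param q A α B → ∀ j →
      count g (T ∘ (q +_)) (suc j) + lost A α B (suc j) ≡ count g (T ∘ (q +_)) j + gained A α B (suc j)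
    count-step m≤g {q} {A} {α} {B} (param α< (h , st) before after) j with lengths m α (<⇒≤ (<-≤-trans α< m≤g))
    ... | g′ , e , len , e< = +-cancelʳ-≡ (U + (δ j′ x + δ j′ a)) _ _ (begin
      count g z j′ + (δ j′ (A + α) + δ j′ (B + g)) + (U + (δ j′ x + δ j′ a))
        ≡⟨ cong₂ (λ p q → p + (δ j′ (A + α) + q) + (U + (δ j′ x + δ j′ a))) (sym (unit j′)) (δ-congʳ {j′} {B + g} {c} (sym c≈)) ⟩
      mom j′ (λ _ → 1) g z + (δ j′ (A + α) + δ j′ c) + (U + (δ j′ x + δ j′ a))
        ≡⟨ eq₁ (mom j′ (λ _ → 1) g z) (δ j′ (A + α)) (δ j′ c) U (δ j′ x) (δ j′ a) ⟩
      mom j′ (λ _ → 1) g z + (δ j′ x * 1 + U + δ j′ c * 1) + (δ j′ (A + α) + δ j′ a)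
        ≡⟨ cong₂ _+_ (boundary-T sh {j} {j′} refl (λ _ → 1)) (sym start) ⟩
      mom j (λ _ → 1) g z + (δ j′ a * 1 + U + δ j′ y * 1) + (δ j′ x + δ j′ A)
        ≡⟨ eq₂ (mom j (λ _ → 1) g z) (δ j′ a) U (δ j′ y) (δ j′ x) (δ j′ A) ⟩
      mom j (λ _ → 1) g z + (δ j′ A + δ j′ y) + (U + (δ j′ x + δ j′ a))
        ≡⟨ cong₂ (λ p q → p + (δ j′ A + q) + (U + (δ j′ x + δ j′ a))) (unit j) (δ-congʳ {j′} {y} {B + α} y≈) ⟩
      count g z j + (δ j′ A + δ j′ (B + α)) + (U + (δ j′ x + δ j′ a)) ∎)
      where
      j′ = suc j
      z = T ∘ (q +_)
      sh : Shape m g α e g′ q h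
      sh = shape st α< len e<
      U = mom j′ (λ _ → 1) g′ (T ∘ (h +_))
      x = T (pred h) ; a = letter-a α h ; y = T (h + g′) ; c = letter-c e g′ h
      unit : ∀ j → mom j (λ _ → 1) g z ≡ count g z j
      unit j = ∑-cong g (λ s _ → *-identityʳ (δ j (z s)))
      c≈ : c ≈ B + g
      c≈ = trans (sym (T-block-≈ (h + g′) e e<)) (trans (≈-reflexive (cong T (sym q+g))) after)
        where
        q+g : q + g ≡ (h + g′) * m + e
        q+g = begin
          q + g                       ≡⟨ cong (q +_) len ⟩
          q + (α + g′ * m + e)        ≡⟨ eq q α (g′ * m) e ⟩
          q + α + g′ * m + e          ≡⟨ cong (λ x → x + g′ * m + e) st ⟩
          h * m + g′ * m + e          ≡⟨ cong (_+ e) (*-distribʳ-+ m h g′) ⟨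
          (h + g′) * m + e            ∎
          where
          eq : ∀ q α G e → q + (α + G + e) ≡ q + α + G + e
          eq = solve-∀
      y≈ : y ≈ B + α
      y≈ = +-cancelʳ-≈ e {y} {B + α} (trans c≈ (trans (≈-reflexive (trans (cong (B +_) len) (eq B α (g′ * m) e))) (+k*m-≈ (B + α + e) g′)))
        where
        eq : ∀ B α G e → B + (α + G + e) ≡ B + α + e + G
        eq = solve-∀
      -- For α = 0 the terms X^A and X^(A+α) cancel; otherwise the window starts inside a block and
      -- A is its first letter.
      start : δ j′ x + δ j′ A ≡ δ j′ (A + α) + δ j′ a
      start with α ≟ 0
      ... | yes refl = trans (+-comm (δ j′ x) (δ j′ A)) (cong₂ _+_ (cong (δ j′) (sym (+-identityʳ A))) (δ-congʳ {j′} {x} {a} (sym (+m-≈ x))))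
      ... | no α≢0 = cong₂ _+_ (δ-congʳ {j′} {x} {A + α} (trans (sym (a+α≈x α< h)) (+-cong-≈ {a} {A} {α} a≈A refl))) (δ-congʳ {j′} {A} {a} (sym a≈A))
        where
        pred-q : ∀ h → q + α ≡ h * m → pred q ≡ pred h * m + (m ∸ suc α)
        pred-q zero    st = ⊥-elim (α≢0 (m+n≡0⇒n≡0 q st))
        pred-q (suc h) st = cong pred (+-cancelʳ-≡ α q _ (trans st (trans (+-comm m (h * m)) (trans (cong (h * m +_) (sym (m∸n+n≡m α<))) (eq (h * m) (m ∸ suc α) α)))))
          where
          eq : ∀ a b c → a + (b + suc c) ≡ suc (a + b) + c
          eq = solve-∀
        a≈A : a ≈ A
        a≈A = begin
          (T (pred h) + (m ∸ α)) % m             ≡⟨ ≈-reflexive (trans (cong (T (pred h) +_) (+-∸-assoc 1 α<)) (+-suc (T (pred h)) (m ∸ suc α))) ⟩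
          suc (T (pred h) + (m ∸ suc α)) % m     ≡⟨ +-cong-≈ {1} refl (T-block-≈ (pred h) (m ∸ suc α) (∸-monoʳ-< {m} {suc α} {0} z<s α<)) ⟨
          suc (T (pred h * m + (m ∸ suc α))) % m ≡⟨ ≈-reflexive (cong (λ x → suc (T x)) (pred-q h st)) ⟨
          suc (T (pred q)) % m                   ≡⟨ before ⟩
          A % m                                  ∎
      eq₁ : ∀ n A c U x a → n + (A + c) + (U + (x + a)) ≡ n + (x * 1 + U + c * 1) + (A + a)
      eq₁ = solve-∀
      eq₂ : ∀ n a U y x A → n + (a * 1 + U + y * 1) + (x + A) ≡ n + (A + y) + (U + (x + a))
      eq₂ = solve-∀

    SameCounts : Triple → Triple → Set
    SameCounts (triple A α B) (triple A′ α′ B′) = ∀ j → gained A α B j + lost A′ α′ B′ j ≡ gained A′ α′ B′ j + lost A α B j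

    count⇒SameCounts : m ≤ g → ∀ {q q′ A α B A′ α′ B′} → Param q A α B → Param q′ A′ α′ B′ →
      (∀ j → count g (T ∘ (q +_)) j ≡ count g (T ∘ (q′ +_)) j) → SameCounts (triple A α B) (triple A′ α′ B′)
    count⇒SameCounts m≤g {q} {q′} {A} {α} {B} {A′} {α′} {B′} p p′ same j = begin
      gained A α B j + lost A′ α′ B′ j            ≡⟨ cong₂ _+_ (gained-≈ A α B) (lost-≈ A′ α′ B′) ⟩
      gained A α B j⁺ + lost A′ α′ B′ j⁺          ≡⟨ cross (count g (T ∘ (q +_)) j₀) (count g (T ∘ (q +_)) j⁺) (sym (count-step m≤g p j₀))
                                                   (subst₂ (λ u v → u + gained A′ α′ B′ j⁺ ≡ v + lost A′ α′ B′ j⁺) (sym (same j₀)) (sym (same j⁺)) (sym (count-step m≤g p′ j₀))) ⟩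
      gained A′ α′ B′ j⁺ + lost A α B j⁺          ≡⟨ cong₂ _+_ (gained-≈ A′ α′ B′) (lost-≈ A α B) ⟨
      gained A′ α′ B′ j + lost A α B j            ∎
      where
      j₀ = j + pred m
      j⁺ = suc j₀
      j≈ : j ≈ j⁺
      j≈ = sym (trans (≈-reflexive (trans (sym (+-suc j (pred m))) (cong (j +_) (suc-pred m)))) (+m-≈ j))
      gained-≈ : ∀ A α B → gained A α B j ≡ gained A α B j⁺
      gained-≈ A α B = cong₂ _+_ (δ-congˡ {j} {j⁺} {A} j≈) (δ-congˡ {j} {j⁺} {B + α} j≈)
      lost-≈ : ∀ A α B → lost A α B j ≡ lost A α B j⁺
      lost-≈ A α B = cong₂ _+_ (δ-congˡ {j} {j⁺} {A + α} j≈) (δ-congˡ {j} {j⁺} {B + g} j≈)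

    -- The counts of two windows differ by the same amount for all letters, hence not at all.
    SameCounts⇒count : m ≤ g → ∀ {q q′ A α B A′ α′ B′} → Param q A α B → Param q′ A′ α′ B′ →
      SameCounts (triple A α B) (triple A′ α′ B′) → ∀ j → count g (T ∘ (q +_)) j ≡ count g (T ∘ (q′ +_)) j
    SameCounts⇒count m≤g {q} {q′} {A} {α} {B} {A′} {α′} {B′} p p′ same j =
      +-cancelʳ-≡ (N 0) _ _ (trans (cong (N j +_) N₀) (const j))
      where
      N N′ : ℕ → ℕ
      N  = count g (T ∘ (q +_))
      N′ = count g (T ∘ (q′ +_))
      step : ∀ j → N (suc j) + N′ j ≡ N′ (suc j) + N j
      step j = +-cancelʳ-≡ (R′ + P) _ _ (begin
        N (suc j) + N′ j + (R′ + P)        ≡⟨ cong (N (suc j) + N′ j +_) (trans (+-comm R′ P) (same (suc j))) ⟩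
        N (suc j) + N′ j + (P′ + R)        ≡⟨ eq (N (suc j)) (N′ j) P′ R ⟩
        (N (suc j) + R) + (N′ j + P′)      ≡⟨ cong₂ _+_ (count-step m≤g p j) (sym (count-step m≤g p′ j)) ⟩
        (N j + P) + (N′ (suc j) + R′)      ≡⟨ eq′ (N j) P (N′ (suc j)) R′ ⟩
        N′ (suc j) + N j + (R′ + P)        ∎)
        where
        P = gained A α B (suc j) ; P′ = gained A′ α′ B′ (suc j)
        R = lost A α B (suc j) ; R′ = lost A′ α′ B′ (suc j)
        eq : ∀ a b c d → a + b + (c + d) ≡ (a + d) + (b + c)
        eq = solve-∀
        eq′ : ∀ a b c d → (a + b) + (c + d) ≡ c + a + (d + b)
        eq′ = solve-∀
      const : ∀ j → N j + N′ 0 ≡ N′ j + N 0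
      const zero    = +-comm (N 0) (N′ 0)
      const (suc j) = +-cancelʳ-≡ (N j + N′ j) _ _ (begin
        N (suc j) + N′ 0 + (N j + N′ j)     ≡⟨ eq (N (suc j)) (N′ 0) (N j) (N′ j) ⟩
        (N (suc j) + N′ j) + (N j + N′ 0)   ≡⟨ cong₂ _+_ (step j) (const j) ⟩
        (N′ (suc j) + N j) + (N′ j + N 0)   ≡⟨ eq′ (N′ (suc j)) (N j) (N′ j) (N 0) ⟩
        N′ (suc j) + N 0 + (N j + N′ j)     ∎)
        where
        eq : ∀ a b c d → a + b + (c + d) ≡ (a + d) + (c + b)
        eq = solve-∀
        eq′ : ∀ a b c d → (a + b) + (c + d) ≡ a + d + (b + c)
        eq′ = solve-∀
      total : ∀ z → ∑ m (count g z) ≡ ∑ g (λ _ → 1)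
      total z = sym (trans (∑-by-letters (λ _ → 1) (λ _ → refl) g z) (∑-cong m (λ j _ → *-identityˡ (count g z j))))
      ∑-const : ∀ n c → ∑ n (λ _ → c) ≡ n * c
      ∑-const zero    c = refl
      ∑-const (suc n) c = cong (c +_) (∑-const n c)
      -- Both windows have g letters in total, so m times the common difference is 0.
      N₀ : N 0 ≡ N′ 0
      N₀ = sym (*-cancelˡ-≡ (N′ 0) (N 0) m (+-cancelˡ-≡ (∑ m N) _ _ (begin
        ∑ m N + m * N′ 0           ≡⟨ cong (∑ m N +_) (∑-const m (N′ 0)) ⟨
        ∑ m N + ∑ m (λ _ → N′ 0)   ≡⟨ ∑-+ m N (λ _ → N′ 0) ⟨
        ∑ m (λ j → N j + N′ 0)     ≡⟨ ∑-cong m (λ j _ → const j) ⟩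
        ∑ m (λ j → N′ j + N 0)     ≡⟨ ∑-+ m N′ (λ _ → N 0) ⟩
        ∑ m N′ + ∑ m (λ _ → N 0)   ≡⟨ cong₂ _+_ (trans (total (T ∘ (q′ +_))) (sym (total (T ∘ (q +_))))) (∑-const m (N 0)) ⟩
        ∑ m N + m * N 0            ∎)))

    TripleAgree : ℕ → ℕ → Triple → Triple → Set
    TripleAgree ā b s s′ = (ā ≢ 0 → A s ≈ A s′) × (b ≢ 0 → B s ≈ B s′) × SameCounts s s′

    ParamT : ℕ → Triple → Set
    ParamT q s = Param q (A s) (α s) (B s)

    Agree⇒TripleAgree : m ≤ g → ∀ {ā b q q′ s s′} → ParamT q s → ParamT q′ s′ → Agree ā b g q q′ → TripleAgree ā b s s′
    Agree⇒TripleAgree m≤g {s = s} {s′} p p′ (agree left right mid) =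
      (λ ā≢0 → trans (sym (Param.before p)) (trans (≈-reflexive (cong suc (left ā≢0))) (Param.before p′))) ,
      (λ b≢0 → +-cancelʳ-≈ g {B s} {B s′} (trans (sym (Param.after p)) (trans (≈-reflexive (right b≢0)) (Param.after p′)))) ,
      count⇒SameCounts m≤g p p′ mid

    TripleAgree⇒Agree : m ≤ g → ∀ {ā b q q′ s s′} → ParamT q s → ParamT q′ s′ → TripleAgree ā b s s′ → Agree ā b g q q′
    TripleAgree⇒Agree m≤g {q = q} {q′} {s} {s′} p p′ (left , right , mid) = agree
      (λ ā≢0 → T-cong (pred q) (pred q′) (+-cancelˡ-≈ 1 {T (pred q)} {T (pred q′)} (trans (Param.before p) (trans (left ā≢0) (sym (Param.before p′))))))
      (λ b≢0 → T-cong (q + g) (q′ + g) (trans (Param.after p) (trans (+-cong-≈ {B s} {B s′} {g} (right b≢0) refl) (sym (Param.after p′)))))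
      (SameCounts⇒count m≤g p p′ mid)

  -- Pairs of residues up to exchange.

  δ-shift : ∀ O j a → δ (O + j) (O + a) ≡ δ j a
  δ-shift O j a = δ-cong {O + j} {j} {O + a} {a} (+-cancelˡ-≈ O {a} {j}) (+-cong-≈ {O} {O} {a} {j} refl)

  +-cancel-neg : ∀ O j → O + (j + neg O) ≈ j
  +-cancel-neg O j = trans (≈-reflexive (eq O j (neg O))) (+-neg j O)
    where
    eq : ∀ a b c → a + (b + c) ≡ b + a + c
    eq = solve-∀

  -- Compares the coefficients of X^O (X^γ + X^α - X^(γ+α)). The bracket is 1 - (1 - X^γ) (1 - X^α),
  -- symmetric in γ and α.
  PairEqAt : ℕ → ℕ × ℕ → ℕ × ℕ → Set
  PairEqAt O (γ , α) (γ′ , α′) = ∀ j →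
    δ j (O + γ) + δ j (O + α) + δ j (O + (γ′ + α′)) ≡ δ j (O + γ′) + δ j (O + α′) + δ j (O + (γ + α))

  PairEq : ℕ × ℕ → ℕ × ℕ → Set
  PairEq = PairEqAt 0

  PairEqAt-shift : ∀ O O′ {x y} → PairEqAt O x y → PairEqAt O′ x y
  PairEqAt-shift O O′ {γ , α} {γ′ , α′} h j = begin
    δ j (O′ + γ) + δ j (O′ + α) + δ j (O′ + (γ′ + α′))
      ≡⟨ cong₂ _+_ (cong₂ _+_ (move γ) (move α)) (move (γ′ + α′)) ⟩
    δ i (O + γ) + δ i (O + α) + δ i (O + (γ′ + α′))
      ≡⟨ h i ⟩
    δ i (O + γ′) + δ i (O + α′) + δ i (O + (γ + α))
      ≡⟨ cong₂ _+_ (cong₂ _+_ (move γ′) (move α′)) (move (γ + α)) ⟨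
    δ j (O′ + γ′) + δ j (O′ + α′) + δ j (O′ + (γ + α)) ∎
    where
    i = O + (j + neg O′)
    move : ∀ a → δ j (O′ + a) ≡ δ i (O + a)
    move a = trans (δ-congˡ {j} {O′ + (j + neg O′)} {O′ + a} (sym (+-cancel-neg O′ j)))
                   (trans (δ-shift O′ (j + neg O′) a) (sym (δ-shift O (j + neg O′) a)))

  _⋈_ : ℕ × ℕ → ℕ × ℕ → Set
  (γ , α) ⋈ (γ′ , α′) = (γ ≈ γ′ × α ≈ α′) ⊎ (γ ≈ α′ × α ≈ γ′)

  ⋈-sym : ∀ {x y} → x ⋈ y → y ⋈ x
  ⋈-sym (inj₁ (p , q)) = inj₁ (sym p , sym q)
  ⋈-sym (inj₂ (p , q)) = inj₂ (sym q , sym p)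

  ⋈-trans : ∀ {x y z} → x ⋈ y → y ⋈ z → x ⋈ z
  ⋈-trans (inj₁ (p , q)) (inj₁ (r , s)) = inj₁ (trans p r , trans q s)
  ⋈-trans (inj₁ (p , q)) (inj₂ (r , s)) = inj₂ (trans p r , trans q s)
  ⋈-trans (inj₂ (p , q)) (inj₁ (r , s)) = inj₂ (trans p s , trans q r)
  ⋈-trans (inj₂ (p , q)) (inj₂ (r , s)) = inj₁ (trans p s , trans q r)

  ⋈⇒PairEq : ∀ {x y} → x ⋈ y → PairEq x y
  ⋈⇒PairEq {γ , α} {γ′ , α′} (inj₁ (p , q)) j =
    cong₂ _+_ (cong₂ _+_ (δ-congʳ {j} {γ} {γ′} p) (δ-congʳ {j} {α} {α′} q)) (δ-congʳ {j} {γ′ + α′} {γ + α} (sym (+-cong-≈ {γ} {γ′} p q)))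
  ⋈⇒PairEq {γ , α} {γ′ , α′} (inj₂ (p , q)) j =
    cong₂ _+_ (trans (cong₂ _+_ (δ-congʳ {j} {γ} {α′} p) (δ-congʳ {j} {α} {γ′} q)) (+-comm (δ j α′) (δ j γ′)))
      (δ-congʳ {j} {γ′ + α′} {γ + α} (trans (≈-reflexive (+-comm γ′ α′)) (sym (+-cong-≈ {γ} {α′} p q))))

  -- If γ or α is 0, then (1 - X^γ) (1 - X^α) vanishes, so all such pairs fall into one class.
  Nonzero Zero : ℕ × ℕ → Set
  Nonzero (γ , α) = γ ≉ 0 × α ≉ 0
  Zero (γ , α) = γ ≈ 0 ⊎ α ≈ 0

  +≉ : ∀ γ {α} → α ≉ 0 → γ + α ≉ γ
  +≉ γ {α} α≉0 p = α≉0 (+-cancelˡ-≈ γ {α} {0} (trans p (≈-reflexive (sym (+-identityʳ γ)))))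

  δ-witness : ∀ a {b c r s} → c ≉ a → δ a a + r ≡ δ a b + δ a c + s → s ≡ 0 → b ≈ a
  δ-witness a {b} {c} {r} {s} c≉a eq refl with b ≈? a
  ... | yes p = p
  ... | no b≉a = case trans (sym (cong (_+ r) (δ-yes {a} {a} refl))) (trans eq (cong₂ (λ u v → u + v + 0) (δ-no {a} {b} b≉a) (δ-no {a} {c} c≉a))) of λ ()

  -- The coefficient of X^γ shows that γ is one of γ′ and α′, as γ + α ≉ γ; after cancelling it, the
  -- coefficient of X^α identifies the other.
  PairEq⇒⋈ : ∀ {x y} → Nonzero x → Nonzero y → PairEq x y → x ⋈ y
  PairEq⇒⋈ {γ , α} {γ′ , α′} (γ≉0 , α≉0) (γ′≉0 , α′≉0) h with γ′ ≈? γ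
  ... | yes p = inj₁ (sym p , sym (δ-witness α {α′} {0 + (γ + α)} {δ α (γ′ + α′)} {0} γ+α≉α eq refl))
    where
    γ+α≉α : γ + α ≉ α
    γ+α≉α q = +≉ α γ≉0 (trans (≈-reflexive (+-comm α γ)) q)
    eq : δ α α + δ α (γ′ + α′) ≡ δ α α′ + δ α (γ + α) + 0
    eq = +-cancelˡ-≡ (δ α γ) _ _ (begin
      δ α γ + (δ α α + δ α (γ′ + α′))      ≡⟨ +-assoc (δ α γ) _ _ ⟨
      δ α γ + δ α α + δ α (γ′ + α′)        ≡⟨ h α ⟩
      δ α γ′ + δ α α′ + δ α (γ + α)        ≡⟨ cong (λ d → d + δ α α′ + δ α (γ + α)) (δ-congʳ {α} {γ′} {γ} p) ⟩
      δ α γ + δ α α′ + δ α (γ + α)         ≡⟨ r (δ α γ) (δ α α′) (δ α (γ + α)) ⟩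
      δ α γ + (δ α α′ + δ α (γ + α) + 0)   ∎)
      where
      r : ∀ a b c → a + b + c ≡ a + (b + c + 0)
      r = solve-∀
  ... | no γ′≉γ = inj₂ (sym α′≈γ , sym (δ-witness α {γ′} {0 + (γ + α)} {δ α (γ′ + α′)} {0} γ+α≉α eq refl))
    where
    γ+α≉α : γ + α ≉ α
    γ+α≉α q = +≉ α γ≉0 (trans (≈-reflexive (+-comm α γ)) q)
    α′≈γ : α′ ≈ γ
    α′≈γ = δ-witness γ {α′} {γ′} {δ γ α + δ γ (γ′ + α′)} {δ γ (γ + α)} γ′≉γ
      (trans (sym (+-assoc (δ γ γ) _ _)) (trans (h γ) (cong (_+ δ γ (γ + α)) (+-comm (δ γ γ′) (δ γ α′))))) (δ-no {γ} {γ + α} (+≉ γ α≉0))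
    eq : δ α α + δ α (γ′ + α′) ≡ δ α γ′ + δ α (γ + α) + 0
    eq = +-cancelˡ-≡ (δ α γ) _ _ (begin
      δ α γ + (δ α α + δ α (γ′ + α′))      ≡⟨ +-assoc (δ α γ) _ _ ⟨
      δ α γ + δ α α + δ α (γ′ + α′)        ≡⟨ h α ⟩
      δ α γ′ + δ α α′ + δ α (γ + α)        ≡⟨ cong (λ d → δ α γ′ + d + δ α (γ + α)) (δ-congʳ {α} {α′} {γ} α′≈γ) ⟩
      δ α γ′ + δ α γ + δ α (γ + α)         ≡⟨ r (δ α γ) (δ α γ′) (δ α (γ + α)) ⟩
      δ α γ + (δ α γ′ + δ α (γ + α) + 0)   ∎)
      where
      r : ∀ a b c → b + a + c ≡ a + (b + c + 0)
      r = solve-∀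

  Zero-PairEq : ∀ x → Zero x → PairEq x (0 , 0)
  Zero-PairEq (γ , α) (inj₁ p) j = begin
    δ j γ + δ j α + δ j 0      ≡⟨ cong₂ (λ u v → u + v + δ j 0) (δ-congʳ {j} {γ} {0} p) (δ-congʳ {j} {α} {γ + α} (sym (+-cong-≈ {γ} {0} {α} p refl))) ⟩
    δ j 0 + δ j (γ + α) + δ j 0 ≡⟨ eq (δ j 0) (δ j (γ + α)) ⟩
    δ j 0 + δ j 0 + δ j (γ + α) ∎
    where
    eq : ∀ a b → a + b + a ≡ a + a + b
    eq = solve-∀
  Zero-PairEq (γ , α) (inj₂ p) j = begin
    δ j γ + δ j α + δ j 0      ≡⟨ cong₂ (λ u v → u + v + δ j 0)
                                    (δ-congʳ {j} {γ} {γ + α} (sym (trans (+-cong-≈ {γ} {γ} {α} {0} refl p) (≈-reflexive (+-identityʳ γ))))) (δ-congʳ {j} {α} {0} p) ⟩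
    δ j (γ + α) + δ j 0 + δ j 0 ≡⟨ eq (δ j 0) (δ j (γ + α)) ⟩
    δ j 0 + δ j 0 + δ j (γ + α) ∎
    where
    eq : ∀ a b → b + a + a ≡ a + a + b
    eq = solve-∀

  -- The coefficient of X^0 in X^γ + X^α - X^(γ+α) is 1 when γ or α is 0, and at most 0 when both
  -- are nonzero.
  Zero-apart : ∀ x y → Zero x → Nonzero y → ¬ PairEq x y
  Zero-apart x@(γ , α) (γ′ , α′) z (γ′≉0 , α′≉0) h = m≢1+m+n S (trans (sym e₂) (cong (_+ δ 0 (γ′ + α′)) e₁))
    where
    S = δ 0 (γ + α)
    e₁ : δ 0 γ + δ 0 α ≡ suc S
    e₁ = +-cancelʳ-≡ 1 _ _ (trans (subst (λ d → δ 0 γ + δ 0 α + d ≡ d + d + S) (δ-yes {0} {0} refl) (Zero-PairEq x z 0)) (+-comm 1 (suc S)))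
    e₂ : δ 0 γ + δ 0 α + δ 0 (γ′ + α′) ≡ S
    e₂ = trans (h 0) (cong₂ (λ u v → u + v + S) (δ-no {0} {γ′} γ′≉0) (δ-no {0} {α′} α′≉0))

  zero-or-not : ∀ x → Zero x ⊎ Nonzero x
  zero-or-not (γ , α) with γ ≈? 0 | α ≈? 0
  ... | yes p | _     = inj₁ (inj₁ p)
  ... | no p  | yes q = inj₁ (inj₂ q)
  ... | no p  | no q  = inj₂ (p , q)

  %-nonzero : ∀ {a} → a ≉ 0 → 1 ≤ a % m
  %-nonzero a≉0 = n≢0⇒n>0 (λ p → a≉0 (trans p (sym (m<n⇒m%n≡m 0<m))))

  pred-bound : ∀ {a} → a < m → a ≤ pred m
  pred-bound a<m = s≤s⁻¹ (subst (_ <_) (sym (suc-pred m)) a<m)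

  bound-pred : ∀ {a} → a ≤ pred m → a < m
  bound-pred a≤ = subst (_ <_) (suc-pred m) (s≤s a≤)

  small-nonzero : ∀ {a} → 1 ≤ a → a < m → a ≉ 0
  small-nonzero 1≤a a<m p = <⇒≢ 1≤a (sym (small-≈ a<m 0<m p))

  ⋈-sorted : ∀ {x y} → Sorted (pred m) x → Sorted (pred m) y → x ⋈ y → x ≡ y
  ⋈-sorted (_ , γ≤α , α<) (_ , γ′≤α′ , α′<) (inj₁ (p , q)) =
    cong₂ _,_ (small-≈ (bound-pred (≤-trans γ≤α α<)) (bound-pred (≤-trans γ′≤α′ α′<)) p) (small-≈ (bound-pred α<) (bound-pred α′<) q)
  ⋈-sorted {γ , α} {γ′ , α′} (_ , γ≤α , α<) (_ , γ′≤α′ , α′<) (inj₂ (p , q)) =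
    cong₂ _,_ (≤-antisym γ≤γ′ γ′≤γ) (≤-antisym (≤-trans (≤-reflexive α≡γ′) γ′≤α′) (≤-trans (≤-reflexive (sym γ≡α′)) γ≤α))
    where
    γ≡α′ : γ ≡ α′
    γ≡α′ = small-≈ (bound-pred (≤-trans γ≤α α<)) (bound-pred α′<) p
    α≡γ′ : α ≡ γ′
    α≡γ′ = small-≈ (bound-pred α<) (bound-pred (≤-trans γ′≤α′ α′<)) q
    γ≤γ′ : γ ≤ γ′
    γ≤γ′ = ≤-trans γ≤α (≤-reflexive α≡γ′)
    γ′≤γ : γ′ ≤ γ
    γ′≤γ = ≤-trans γ′≤α′ (≤-reflexive (sym γ≡α′))

  nonzero-pair-count : ClassCount Nonzero PairEq (triangle (pred m))
  nonzero-pair-count = transfer (λ x z → Sorted (pred m) x × Nonzero z × x ⋈ z)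
    (λ { x@(γ , α) s@(1≤γ , γ≤α , α≤) →
      let nz = small-nonzero 1≤γ (bound-pred (≤-trans γ≤α α≤)) , small-nonzero (≤-trans 1≤γ γ≤α) (bound-pred α≤)
      in x , nz , s , nz , inj₁ (refl , refl) })
    sort
    (λ { {x} {x′} {z} {z′} (_ , _ , r) (_ , _ , r′) refl → ⋈⇒PairEq {z} {z′} (⋈-trans {z} {x} {z′} (⋈-sym {x} {z} r) r′) })
    (λ { {x} {x′} {z} {z′} (s , nz , r) (s′ , nz′ , r′) h →
      ⋈-sorted s s′ (⋈-trans {x} {z} {x′} r (⋈-trans {z} {z′} {x′} (PairEq⇒⋈ {z} {z′} nz nz′ h) (⋈-sym {x′} {z′} r′))) })
    (sorted-count (pred m))
    where
    sort : ∀ z → Nonzero z → ∃ λ x → Sorted (pred m) x × Sorted (pred m) x × Nonzero z × x ⋈ z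
    sort (γ , α) nz@(γ≉0 , α≉0) with ≤-total (γ % m) (α % m)
    ... | inj₁ le = (γ % m , α % m) , s , s , nz , inj₁ (%-≈ γ , %-≈ α)
      where s = %-nonzero {γ} γ≉0 , le , pred-bound (m%n<n α m)
    ... | inj₂ le = (α % m , γ % m) , s , s , nz , inj₂ (%-≈ α , %-≈ γ)
      where s = %-nonzero {α} α≉0 , le , pred-bound (m%n<n γ m)

  -- One class of pairs with a zero, and the unordered pairs of the m - 1 nonzero residues,
  -- repetition allowed.
  pair-count : ClassCount (λ _ → ⊤) PairEq (1 + triangle (pred m))
  pair-count = restrict (λ _ _ → tt) (λ x _ → zero-or-not x)
    (union (λ {x} {y} h j → sym (h j)) Zero-apart (single (0 , 0) (inj₁ refl) Zero-PairEq) nonzero-pair-count)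

  -- With both end letters known, γ = A - B is known, and α matters only through X^(B+α) - X^(A+α),
  -- which vanishes for γ ≈ 0.
  GenericEq : ℕ × ℕ → ℕ × ℕ → Set
  GenericEq (γ , α) (γ′ , α′) = γ ≈ γ′ × (γ ≈ 0 ⊎ α ≈ α′)

  generic-pair-count : ClassCount (λ _ → ⊤) GenericEq (1 + pred m * m)
  generic-pair-count = restrict (λ _ _ → tt) (λ x _ → decide x)
    (union (λ {x} {y} → GenericEq-sym {x} {y}) (λ { x y p q (r , _) → q (trans (sym r) p) })
      (single (0 , 0) refl (λ { x p → p , inj₁ p }))
      (from-index *↔× (λ (d , α) → suc (toℕ d) , toℕ α)
        (λ (d , α) → small-nonzero (s≤s z≤n) (bound-pred (toℕ<n d))) inj cov))
    where
    GenericEq-sym : ∀ {x y} → GenericEq x y → GenericEq y x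
    GenericEq-sym (p , inj₁ q) = sym p , inj₁ (trans (sym p) q)
    GenericEq-sym (p , inj₂ q) = sym p , inj₂ (sym q)
    decide : ∀ (x : ℕ × ℕ) → proj₁ x ≈ 0 ⊎ proj₁ x ≉ 0
    decide (γ , _) with γ ≈? 0
    ... | yes p = inj₁ p
    ... | no p  = inj₂ p
    inj : ∀ (y y′ : Fin (pred m) × Fin m) → _ → y ≡ y′
    inj (d , α) (d′ , α′) (p , inj₁ q) = ⊥-elim (small-nonzero (s≤s z≤n) (bound-pred (toℕ<n d)) q)
    inj (d , α) (d′ , α′) (p , inj₂ q) = cong₂ _,_
      (toℕ-injective (suc-injective (small-≈ (bound-pred (toℕ<n d)) (bound-pred (toℕ<n d′)) p)))
      (toℕ-injective (small-≈ (toℕ<n α) (toℕ<n α′) q))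
    cov : ∀ (x : ℕ × ℕ) → proj₁ x ≉ 0 → ∃ λ (y : Fin (pred m) × Fin m) → GenericEq x (suc (toℕ (proj₁ y)) , toℕ (proj₂ y))
    cov (γ , α) γ≉0 with γ % m | %-nonzero {γ} γ≉0 | m%n<n γ m
    ... | suc d | _ | d<m = (fromℕ< d<m-1 , fromℕ< (m%n<n α m)) ,
      sym (trans (cong (λ x → suc x % m) (toℕ-fromℕ< d<m-1)) (m<n⇒m%n≡m d<m)) ,
      inj₂ (trans (sym (%-≈ α)) (≈-reflexive (sym (toℕ-fromℕ< (m%n<n α m)))))
      where
      d<m-1 : d < pred m
      d<m-1 = pred-bound d<m

  -- A residue w that the relation reads off exactly, next to the class of y, multiplies the count
  -- by m.
  keyed : ∀ {X Y : Set} {_~_ : Y → Y → Set} {P : X → Set} {_≋_ : X → X → Set} {N} (build : ℕ → Y → X) →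
    (∀ w y → P (build w y)) →
    (∀ {w w′ y y′} → build w y ≋ build w′ y′ → w ≈ w′ × y ~ y′) →
    (∀ x → P x → ∃₂ λ w y → ∀ {w′ y′} → w ≈ w′ → y ~ y′ → x ≋ build w′ y′) →
    ClassCount (λ _ → ⊤) _~_ N → ClassCount P _≋_ (m * N)
  keyed build build∈ inj cov c = from-index *↔× (λ (w , a) → build (toℕ w) (rep c a)) (λ (w , a) → build∈ _ _)
    (λ { (w , a) (w′ , a′) h → let (p , q) = inj h in cong₂ _,_ (toℕ-injective (small-≈ (toℕ<n w) (toℕ<n w′) p)) (distinct c a a′ q) })
    (λ x px → let (w , y , h) = cov x px ; (a , r) = cover c y tt in
      (fromℕ< (m%n<n w m) , a) , h (trans (sym (%-≈ w)) (≈-reflexive (sym (toℕ-fromℕ< (m%n<n w m))))) r)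

  -- Classes of windows in terms of A, α and B.

  InBlock : Triple → Set
  InBlock s = α s < m

  module _ (g : ℕ) where

    -- After the terms of A and B cancel, X^(B+α) + X^(A′+α′) = X^(B′+α′) + X^(A+α); if α ≉ α′, then
    -- X^(B+α) can only be matched by X^(A+α).
    generic-SameCounts : ∀ {s s′} → A s ≈ A s′ → B s ≈ B s′ → SameCounts g s s′ → A s ≈ B s ⊎ α s ≈ α s′
    generic-SameCounts {triple A α B} {triple A′ α′ B′} a≈ b≈ h with α′ ≈? α
    ... | yes p = inj₂ (sym p)
    ... | no α′≉α = inj₁ (+-cancelʳ-≈ α {A} {B} (δ-witness (B + α) {A + α} {B′ + α′} {δ j (A′ + α′)} {0} B′+α′≉ eq refl))
      where
      j = B + α
      B′+α′≉ : B′ + α′ ≉ j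
      B′+α′≉ p = α′≉α (+-cancelˡ-≈ B {α′} {α} (trans (+-cong-≈ {B} {B′} {α′} b≈ refl) p))
      eq : δ j j + δ j (A′ + α′) ≡ δ j (A + α) + δ j (B′ + α′) + 0
      eq = +-cancelˡ-≡ (δ j A + δ j (B + g)) _ _ (begin
        δ j A + δ j (B + g) + (δ j j + δ j (A′ + α′))           ≡⟨ cong (λ x → δ j A + x + (δ j j + δ j (A′ + α′))) (δ-congʳ {j} {B + g} {B′ + g} (+-cong-≈ {B} {B′} {g} b≈ refl)) ⟩
        δ j A + δ j (B′ + g) + (δ j j + δ j (A′ + α′))          ≡⟨ r₁ (δ j A) (δ j (B′ + g)) (δ j j) (δ j (A′ + α′)) ⟩
        gained g A α B j + lost g A′ α′ B′ j                    ≡⟨ h j ⟩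
        gained g A′ α′ B′ j + lost g A α B j                    ≡⟨ cong (λ x → x + δ j (B′ + α′) + lost g A α B j) (δ-congʳ {j} {A} {A′} a≈) ⟨
        δ j A + δ j (B′ + α′) + (δ j (A + α) + δ j (B + g))     ≡⟨ r₂ (δ j A) (δ j (B′ + α′)) (δ j (A + α)) (δ j (B + g)) ⟩
        δ j A + δ j (B + g) + (δ j (A + α) + δ j (B′ + α′) + 0) ∎)
        where
        r₁ : ∀ a b c d → a + b + (c + d) ≡ a + c + (d + b)
        r₁ = solve-∀
        r₂ : ∀ a b c d → a + b + (c + d) ≡ a + d + (c + b + 0)
        r₂ = solve-∀

    SameCounts-generic : ∀ {s s′} → A s ≈ A s′ → B s ≈ B s′ → A s ≈ B s ⊎ α s ≈ α s′ → SameCounts g s s′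
    SameCounts-generic {triple A α B} {triple A′ α′ B′} a≈ b≈ cases j = begin
      δ j A + δ j (B + α) + (δ j (A′ + α′) + δ j (B′ + g))      ≡⟨ r (δ j A) (δ j (B + α)) (δ j (A′ + α′)) (δ j (B′ + g)) ⟩
      δ j A + (δ j (B + α) + δ j (A′ + α′)) + δ j (B′ + g)
        ≡⟨ cong₂ _+_ (cong₂ _+_ (δ-congʳ {j} {A} {A′} a≈) (inner cases)) (δ-congʳ {j} {B′ + g} {B + g} (sym (+-cong-≈ {B} {B′} {g} b≈ refl))) ⟩
      δ j A′ + (δ j (B′ + α′) + δ j (A + α)) + δ j (B + g)      ≡⟨ r (δ j A′) (δ j (B′ + α′)) (δ j (A + α)) (δ j (B + g)) ⟨
      δ j A′ + δ j (B′ + α′) + (δ j (A + α) + δ j (B + g))      ∎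
      where
      r : ∀ a b c d → a + b + (c + d) ≡ a + (b + c) + d
      r = solve-∀
      inner : A ≈ B ⊎ α ≈ α′ → δ j (B + α) + δ j (A′ + α′) ≡ δ j (B′ + α′) + δ j (A + α)
      inner (inj₁ p) = trans (+-comm (δ j (B + α)) _) (cong₂ _+_
        (δ-congʳ {j} {A′ + α′} {B′ + α′} (+-cong-≈ {A′} {B′} {α′} (trans (sym a≈) (trans p b≈)) refl))
        (δ-congʳ {j} {B + α} {A + α} (sym (+-cong-≈ {A} {B} {α} p refl))))
      inner (inj₂ p) = cong₂ _+_ (δ-congʳ {j} {B + α} {B′ + α′} (+-cong-≈ {B} {B′} b≈ p)) (δ-congʳ {j} {A′ + α′} {A + α} (sym (+-cong-≈ {A} {A′} a≈ p)))

    difference : Triple → Triple → ℕ → ℕ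
    difference (triple A α B) (triple A′ α′ B′) j = gained g A α B j + lost g A′ α′ B′ j

    -- For B = O and A = O + γ, `gained` - `lost` is X^O (X^γ + X^α - X^(γ+α)) - X^(O+g), where A -
    -- B and α are interchangeable.
    left-form : ∀ {O s s′ γ α₀ γ′ α₀′} → A s ≈ O + γ → α s ≈ α₀ → B s ≈ O → A s′ ≈ O + γ′ → α s′ ≈ α₀′ → B s′ ≈ O → ∀ j →
      difference s s′ j ≡ δ j (O + γ) + δ j (O + α₀) + δ j (O + (γ′ + α₀′)) + δ j (O + g)
    left-form {O} {triple A α B} {triple A′ α′ B′} {γ} {α₀} {γ′} {α₀′} a a₀ b a′ a₀′ b′ j = trans
      (cong₂ _+_ (cong₂ _+_ (δ-congʳ {j} {A} {O + γ} a) (δ-congʳ {j} {B + α} {O + α₀} (+-cong-≈ {B} {O} b a₀)))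
        (cong₂ _+_ (δ-congʳ {j} {A′ + α′} {O + (γ′ + α₀′)} (trans (+-cong-≈ {A′} {O + γ′} a′ a₀′) (≈-reflexive (+-assoc O γ′ α₀′))))
                   (δ-congʳ {j} {B′ + g} {O + g} (+-cong-≈ {B′} {O} {g} b′ refl))))
      (sym (+-assoc (δ j (O + γ) + δ j (O + α₀)) _ _))

    -- For A = O, B = O + d and α = g + ε, `gained` - `lost` is X^O - X^(O+g) (X^d + X^ε - X^(d+ε));
    -- the minus sign exchanges the roles of the two triples.
    right-form : ∀ {O s s′ d ε d′ ε′} → A s ≈ O → α s ≈ g + ε → B s ≈ O + d → A s′ ≈ O → α s′ ≈ g + ε′ → B s′ ≈ O + d′ → ∀ j →
      difference s s′ j ≡ δ j (O + g + d′) + δ j (O + g + ε′) + δ j (O + g + (d + ε)) + δ j O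
    right-form {O} {triple A α B} {triple A′ α′ B′} {d} {ε} {d′} {ε′} a a₀ b a′ a₀′ b′ j = trans
      (cong₂ _+_ (cong₂ _+_ (δ-congʳ {j} {A} {O} a)
          (δ-congʳ {j} {B + α} {O + g + (d + ε)} (trans (+-cong-≈ {B} {O + d} b a₀) (≈-reflexive (eq₁ O d g ε)))))
        (cong₂ _+_ (δ-congʳ {j} {A′ + α′} {O + g + ε′} (trans (+-cong-≈ {A′} {O} a′ a₀′) (≈-reflexive (sym (+-assoc O g ε′)))))
                   (δ-congʳ {j} {B′ + g} {O + g + d′} (trans (+-cong-≈ {B′} {O + d′} {g} b′ refl) (≈-reflexive (eq₂ O d′ g))))))
      (eq₃ (δ j O) (δ j (O + g + (d + ε))) (δ j (O + g + ε′)) (δ j (O + g + d′)))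
      where
      eq₁ : ∀ O d g ε → O + d + (g + ε) ≡ O + g + (d + ε)
      eq₁ = solve-∀
      eq₂ : ∀ O d g → O + d + g ≡ O + g + d
      eq₂ = solve-∀
      eq₃ : ∀ a b c d → a + b + (c + d) ≡ d + c + b + a
      eq₃ = solve-∀

    SameCounts-left : ∀ {O s s′ γ α₀ γ′ α₀′} → A s ≈ O + γ → α s ≈ α₀ → B s ≈ O → A s′ ≈ O + γ′ → α s′ ≈ α₀′ → B s′ ≈ O →
      (SameCounts g s s′ → PairEq (γ , α₀) (γ′ , α₀′)) × (PairEq (γ , α₀) (γ′ , α₀′) → SameCounts g s s′)
    SameCounts-left {O} {s} {s′} {γ} {α₀} {γ′} {α₀′} a a₀ b a′ a₀′ b′ =
      (λ h → PairEqAt-shift O 0 {γ , α₀} {γ′ , α₀′} λ j → +-cancelʳ-≡ (δ j (O + g)) _ _ (trans (sym (form j)) (trans (h j) (form′ j)))) ,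
      (λ h j → trans (form j) (trans (cong (_+ δ j (O + g)) (PairEqAt-shift 0 O {γ , α₀} {γ′ , α₀′} h j)) (sym (form′ j))))
      where
      form = left-form {O} {s} {s′} {γ} {α₀} {γ′} {α₀′} a a₀ b a′ a₀′ b′
      form′ = left-form {O} {s′} {s} {γ′} {α₀′} {γ} {α₀} a′ a₀′ b′ a a₀ b

    SameCounts-right : ∀ {O s s′ d ε d′ ε′} → A s ≈ O → α s ≈ g + ε → B s ≈ O + d → A s′ ≈ O → α s′ ≈ g + ε′ → B s′ ≈ O + d′ →
      (SameCounts g s s′ → PairEq (d , ε) (d′ , ε′)) × (PairEq (d , ε) (d′ , ε′) → SameCounts g s s′)
    SameCounts-right {O} {s} {s′} {d} {ε} {d′} {ε′} a a₀ b a′ a₀′ b′ =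
      (λ h → PairEqAt-shift (O + g) 0 {d , ε} {d′ , ε′} λ j → +-cancelʳ-≡ (δ j O) _ _ (trans (sym (form′ j)) (trans (sym (h j)) (form j)))) ,
      (λ h j → trans (form j) (trans (cong (_+ δ j O) (sym (PairEqAt-shift 0 (O + g) {d , ε} {d′ , ε′} h j))) (sym (form′ j))))
      where
      form = right-form {O} {s} {s′} {d} {ε} {d′} {ε′} a a₀ b a′ a₀′ b′
      form′ = right-form {O} {s′} {s} {d′} {ε′} {d} {ε} a′ a₀′ b′ a a₀ b

    buildˡ buildʳ : ℕ → ℕ × ℕ → Triple
    buildˡ w (γ , α) = triple (w + γ) (α % m) w
    buildʳ w (d , ε) = triple w ((g + ε) % m) (w + d)

    generic-count : ∀ {ā b} → ā ≢ 0 → b ≢ 0 → ClassCount InBlock (TripleAgree g ā b) (m * (1 + pred m * m))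
    generic-count {ā} {b} ā≢0 b≢0 = keyed buildˡ (λ w y → m%n<n (proj₂ y) m) inj cov generic-pair-count
      where
      inj : ∀ {w w′ y y′} → TripleAgree g ā b (buildˡ w y) (buildˡ w′ y′) → w ≈ w′ × GenericEq y y′
      inj {w} {w′} {γ , α} {γ′ , α′} (l , r , h) = w≈w′ , γ≈γ′ , last (generic-SameCounts {buildˡ w (γ , α)} {buildˡ w′ (γ′ , α′)} (l ā≢0) (r b≢0) h)
        where
        w≈w′ = r b≢0
        γ≈γ′ : γ ≈ γ′
        γ≈γ′ = +-cancelˡ-≈ w {γ} {γ′} (trans (l ā≢0) (+-cong-≈ {w′} {w} {γ′} (sym w≈w′) refl))
        last : w + γ ≈ w ⊎ α % m ≈ α′ % m → γ ≈ 0 ⊎ α ≈ α′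
        last (inj₁ p) = inj₁ (+-cancelˡ-≈ w {γ} {0} (trans p (≈-reflexive (sym (+-identityʳ w)))))
        last (inj₂ p) = inj₂ (trans (sym (%-≈ α)) (trans p (%-≈ α′)))
      cov : ∀ s → InBlock s → ∃₂ λ w y → ∀ {w′ y′} → w ≈ w′ → GenericEq y y′ → TripleAgree g ā b s (buildˡ w′ y′)
      cov s@(triple A α B) _ = B , (A + neg B , α) , λ { {w′} {γ′ , α′} p (q , c) →
        let a≈ = trans (sym (+-cancel-neg B A)) (+-cong-≈ {B} {w′} p q) in
        (λ _ → a≈) , (λ _ → p) , SameCounts-generic {s} {buildˡ w′ (γ′ , α′)} a≈ p (case c of λ where
          (inj₁ z) → inj₁ (trans (sym (+-cancel-neg B A)) (trans (+-cong-≈ {B} {B} {A + neg B} {0} refl z) (≈-reflexive (+-identityʳ B))))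
          (inj₂ z) → inj₂ (trans z (sym (%-≈ α′)))) }

    left-count : ∀ {b} → b ≢ 0 → ClassCount InBlock (TripleAgree g 0 b) (m * (1 + triangle (pred m)))
    left-count {b} b≢0 = keyed buildˡ (λ w y → m%n<n (proj₂ y) m) inj cov pair-count
      where
      inj : ∀ {w w′ y y′} → TripleAgree g 0 b (buildˡ w y) (buildˡ w′ y′) → w ≈ w′ × PairEq y y′
      inj {w} {w′} {γ , α} {γ′ , α′} (_ , r , h) = r b≢0 ,
        proj₁ (SameCounts-left {w} {buildˡ w (γ , α)} {buildˡ w′ (γ′ , α′)} {γ} {α} {γ′} {α′} refl (%-≈ α) refl
          (+-cong-≈ {w′} {w} {γ′} (sym (r b≢0)) refl) (%-≈ α′) (sym (r b≢0))) h
      cov : ∀ s → InBlock s → ∃₂ λ w y → ∀ {w′ y′} → w ≈ w′ → PairEq y y′ → TripleAgree g 0 b s (buildˡ w′ y′)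
      cov s@(triple A α B) _ = B , (A + neg B , α) , λ { {w′} {γ′ , α′} p h →
        (λ 0≢0 → ⊥-elim (0≢0 refl)) , (λ _ → p) ,
        proj₂ (SameCounts-left {B} {s} {buildˡ w′ (γ′ , α′)} {A + neg B} {α} {γ′} {α′} (sym (+-cancel-neg B A)) refl refl
          (+-cong-≈ {w′} {B} {γ′} (sym p) refl) (%-≈ α′) (sym p)) h }

    right-count : ∀ {ā} → ā ≢ 0 → ClassCount InBlock (TripleAgree g ā 0) (m * (1 + triangle (pred m)))
    right-count {ā} ā≢0 = keyed buildʳ (λ w y → m%n<n (g + proj₂ y) m) inj cov pair-count
      where
      inj : ∀ {w w′ y y′} → TripleAgree g ā 0 (buildʳ w y) (buildʳ w′ y′) → w ≈ w′ × PairEq y y′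
      inj {w} {w′} {d , ε} {d′ , ε′} (l , _ , h) = l ā≢0 ,
        proj₁ (SameCounts-right {w} {buildʳ w (d , ε)} {buildʳ w′ (d′ , ε′)} {d} {ε} {d′} {ε′} refl (%-≈ (g + ε)) refl
          (sym (l ā≢0)) (%-≈ (g + ε′)) (+-cong-≈ {w′} {w} {d′} (sym (l ā≢0)) refl)) h
      cov : ∀ s → InBlock s → ∃₂ λ w y → ∀ {w′ y′} → w ≈ w′ → PairEq y y′ → TripleAgree g ā 0 s (buildʳ w′ y′)
      cov s@(triple A α B) _ = A , (B + neg A , α + neg g) , λ { {w′} {d′ , ε′} p h →
        (λ _ → p) , (λ 0≢0 → ⊥-elim (0≢0 refl)) ,
        proj₂ (SameCounts-right {A} {s} {buildʳ w′ (d′ , ε′)} {B + neg A} {α + neg g} {d′} {ε′} refl (sym (+-cancel-neg g α)) (sym (+-cancel-neg A B))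
          (sym p) (%-≈ (g + ε′)) (+-cong-≈ {w′} {A} {d′} (sym p) refl)) h }

    SameCounts-trans : ∀ {s t u} → SameCounts g s t → SameCounts g t u → SameCounts g s u
    SameCounts-trans {triple A₁ α₁ B₁} {triple A₂ α₂ B₂} {triple A₃ α₃ B₃} h h′ j = +-cancelʳ-≡ (p₂ + n₂) _ _ (begin
      p₁ + n₃ + (p₂ + n₂)     ≡⟨ eq p₁ n₃ p₂ n₂ ⟩
      p₁ + n₂ + (p₂ + n₃)     ≡⟨ cong₂ _+_ (h j) (h′ j) ⟩
      p₂ + n₁ + (p₃ + n₂)     ≡⟨ eq′ p₂ n₁ p₃ n₂ ⟩
      p₃ + n₁ + (p₂ + n₂)     ∎)
      where
      p₁ = gained g A₁ α₁ B₁ j ; p₂ = gained g A₂ α₂ B₂ j ; p₃ = gained g A₃ α₃ B₃ j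
      n₁ = lost g A₁ α₁ B₁ j ; n₂ = lost g A₂ α₂ B₂ j ; n₃ = lost g A₃ α₃ B₃ j
      eq : ∀ a b c d → a + b + (c + d) ≡ a + d + (c + b)
      eq = solve-∀
      eq′ : ∀ a b c d → a + b + (c + d) ≡ c + b + (a + d)
      eq′ = solve-∀

    difference-≈ : ∀ s s′ {j j′ : ℕ} → j ≈ j′ → difference s s′ j ≡ difference s s′ j′
    difference-≈ (triple A α B) (triple A′ α′ B′) {j} {j′} p = cong₂ _+_ (cong₂ _+_ (c A) (c (B + α))) (cong₂ _+_ (c (A′ + α′)) (c (B′ + g)))
      where
      c : ∀ a → δ j a ≡ δ j′ a
      c a = δ-congˡ {j} {j′} {a} p

    SameCounts? : ∀ s s′ → Dec (SameCounts g s s′)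
    SameCounts? s s′ with all? (λ (a : Fin m) → difference s s′ (toℕ a) ≟ difference s′ s (toℕ a))
    ... | yes h = yes λ j → let j≈ = trans (sym (%-≈ j)) (≈-reflexive (sym (toℕ-fromℕ< (m%n<n j m)))) in
      trans (difference-≈ s s′ {j} j≈) (trans (h (fromℕ< (m%n<n j m))) (sym (difference-≈ s′ s {j} j≈)))
    ... | no ¬h = no λ h → ¬h (h ∘ toℕ)

    SameCounts-isDecEquivalence : IsDecEquivalence (SameCounts g)
    SameCounts-isDecEquivalence = record
      { isEquivalence = record
        { refl  = λ _ → refl
        ; sym   = λ h j → sym (h j)
        ; trans = λ {s} {t} {u} → SameCounts-trans {s} {t} {u}
        }
      ; _≟_ = SameCounts?
      }

    -- Reducing A, α and B modulo m leaves at most m^3 triples, which is enough for the count to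
    -- exist.
    abelian-count : ∃ λ N → ClassCount InBlock (SameCounts g) N
    abelian-count = let (N , c) = finite SameCounts-isDecEquivalence (m * (m * m)) f in N ,
      transfer (λ x z → InBlock z × SameCounts g x z)
        (λ { x (a , h) → f a , f∈ a , f∈ a , h })
        (λ { z z∈ → z , (index z , index-≈ z z∈) , z∈ , λ _ → refl })
        (λ { {x} {x′} {z} {z′} (_ , r) (_ , r′) h →
          SameCounts-trans {z} {x} {z′} (λ j → sym (r j)) (SameCounts-trans {x} {x′} {z′} h r′) })
        (λ { {x} {x′} {z} {z′} (_ , r) (_ , r′) h →
          SameCounts-trans {x} {z} {x′} r (SameCounts-trans {z} {z′} {x′} h (λ j → sym (r′ j))) })
        c
      where
      open Inverse
      f : Fin (m * (m * m)) → Triple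
      f i = let (a , r) = to *↔× i ; (b , c) = to *↔× r in triple (toℕ a) (toℕ b) (toℕ c)
      f∈ : ∀ i → InBlock (f i)
      f∈ i = toℕ<n (proj₁ (to (*↔× {m} {m}) (proj₂ (to (*↔× {m} {m * m}) i))))
      index : Triple → Fin (m * (m * m))
      index (triple A α B) = from *↔× (fromℕ< (m%n<n A m) , from *↔× (fromℕ< (m%n<n α m) , fromℕ< (m%n<n B m)))
      index-≈ : ∀ z → InBlock z → SameCounts g z (f (index z))
      index-≈ z@(triple A α B) _ = subst (SameCounts g z) (sym f-index) (SameCounts-generic {z} {reduced} (near A) (near B) (inj₂ (near α)))
        where
        near : ∀ a → a ≈ toℕ (fromℕ< (m%n<n a m))
        near a = trans (sym (%-≈ a)) (≈-reflexive (sym (toℕ-fromℕ< (m%n<n a m))))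
        reduced : Triple
        reduced = triple (toℕ (fromℕ< (m%n<n A m))) (toℕ (fromℕ< (m%n<n α m))) (toℕ (fromℕ< (m%n<n B m)))
        f-index : f (index z) ≡ reduced
        f-index = trans
          (cong (λ p → let (a , r) = p ; (b , c) = to *↔× r in triple (toℕ a) (toℕ b) (toℕ c)) (strictlyInverseˡ *↔× _))
          (cong (λ p → let (b , c) = p in triple (toℕ (fromℕ< (m%n<n A m))) (toℕ b) (toℕ c)) (strictlyInverseˡ *↔× _))

  -- Assembling the counts over all cut lengths.

  Equiv : ℕ → ℕ → ℕ → ℕ → Set
  Equiv k n i i′ = factor m i n ∼[ k ] factor m i′ n

  Equiv-sym : ∀ {k n i i′} → Equiv k n i i′ → Equiv k n i′ i
  Equiv-sym {k} {n} {i} {i′} = ∼-sym {k} {factor m i n} {factor m i′ n}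

  At : ℕ → ℕ → ℕ → Set
  At K ā i = ā < m ^ K × ∃ λ q → i + ā ≡ q * m ^ K

  At-unique : ∀ {K n} → (∀ i i′ → Equiv (suc K) n i i′ → Same K n i i′) →
    ∀ {ā ā′ i i′} → At K ā i → At K ā′ i′ → Equiv (suc K) n i i′ → ā ≡ ā′
  At-unique {K} complete {ā} {ā′} {i} {i′} (ā< , q , st) (ā′< , q′ , st′) h with complete i i′ h
  ... | ā₀ , _ , _ , q₀ , q₀′ , sh , sh′ , _ = trans
    (proj₁ (ceiling-unique (m ^ K) {i} {ā} {q} {ā₀} {q₀} st ā< (Shape.start sh) (Shape.ā< sh)))
    (sym (proj₁ (ceiling-unique (m ^ K) {i′} {ā′} {q′} {ā₀} {q₀′} st′ ā′< (Shape.start sh′) (Shape.ā< sh′))))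
    where
    instance
      _ = m^n≢0 m K

  -- Once ā is fixed, n determines g and b, so the classes of positions correspond to those of
  -- triples, each of which `realise` places somewhere in t_m.
  At-count : ∀ {K n ā b g N} → (∀ i i′ → Equiv (suc K) n i i′ → Same K n i i′) →
    ā < m ^ K → n ≡ ā + g * m ^ K + b → b < m ^ K → m ≤ g →
    ClassCount InBlock (TripleAgree g ā b) N → ClassCount (At K ā) (Equiv (suc K) n) N
  At-count {K} {n} {ā} {b} {g} complete ā< len b< m≤g = transfer Rel right left to from
    where
    M = m ^ K
    instance
      M≢0 : NonZero M
      M≢0 = m^n≢0 m K
    Rel : Triple → ℕ → Set
    Rel s i = ∃ λ q → i + ā ≡ q * M × ParamT g q s
    right : ∀ s → InBlock s → ∃ λ i → At K ā i × Rel s i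
    right s α<m with realise g m≤g (A s) (α s) (B s) α<m
    ... | q , q≢0 , p = q * M ∸ ā , (ā< , q , st) , q , st , p
      where
      st : q * M ∸ ā + ā ≡ q * M
      st = m∸n+n≡m (≤-trans (<⇒≤ ā<) (m≤n*m M q {{≢-nonZero q≢0}}))
    left : ∀ i → At K ā i → ∃ λ s → InBlock s × Rel s i
    left i (_ , q , st) with param-exists g q
    ... | A₀ , α₀ , B₀ , p = triple A₀ α₀ B₀ , Param.α< p , q , st , p
    to : ∀ {s s′ i i′} → Rel s i → Rel s′ i′ → TripleAgree g ā b s s′ → Equiv (suc K) n i i′
    to {s} {s′} {i} {i′} (q , st , p) (q′ , st′ , p′) h = Same⇒∼ {K} {n} {i} {i′}
      (ā , b , g , q , q′ , shape st ā< len b< , shape st′ ā< len b< , TripleAgree⇒Agree g m≤g {s = s} {s′} p p′ h)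
    from : ∀ {s s′ i i′} → Rel s i → Rel s′ i′ → Equiv (suc K) n i i′ → TripleAgree g ā b s s′
    from {s} {s′} {i} {i′} (q , st , p) (q′ , st′ , p′) h = unpack (complete i i′ h)
      where
      unpack : Same K n i i′ → TripleAgree g ā b s s′
      unpack (ā₀ , b₀ , g₀ , q₀ , q₀′ , sh , sh′ , ag)
        with ceiling-unique M {i} {ā} {q} {ā₀} {q₀} st ā< (Shape.start sh) (Shape.ā< sh)
      ... | refl , refl with ceiling-unique M {i′} {ā} {q′} {ā} {q₀′} st′ ā< (Shape.start sh′) (Shape.ā< sh′)
                           | lengths-unique M {n} {ā} {g} {b} {g₀} {b₀} len b< (Shape.len sh) (Shape.b< sh)
      ... | _ , refl | refl , refl = Agree⇒TripleAgree g m≤g {s = s} {s′} p p′ ag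

  toHasClassCount : ∀ {k n N} {P : ℕ → Set} → (∀ i → P i) → ClassCount P (Equiv k n) N → HasClassCount m k n N
  toHasClassCount all c = rep c , (λ a b a≢b h → a≢b (distinct c a b h)) , λ i → cover c i (all i)

  -- The window length enters only through X^(B+g), so only its residue matters; this ties Q whole
  -- blocks to the abelian complexity at length m + ν.
  SameCounts-length : ∀ {g g′ s s′} → g ≈ g′ → SameCounts g s s′ → SameCounts g′ s s′
  SameCounts-length {g} {g′} {triple A α B} {triple A′ α′ B′} p h j =
    subst₂ (λ x y → δ j A + δ j (B + α) + (δ j (A′ + α′) + x) ≡ δ j A′ + δ j (B′ + α′) + (δ j (A + α) + y)) (eq B′) (eq B) (h j)
    where
    eq : ∀ B → δ j (B + g) ≡ δ j (B + g′)
    eq B = δ-congʳ {j} {B + g} {B + g′} (+-cong-≈ {B} {B} refl p)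

  generic-total : ℕ
  generic-total = m * (1 + pred m * m)

  generic-total-formula : m ^ 3 ∸ m ^ 2 + m ≡ generic-total
  generic-total-formula = begin
    m ^ 3 ∸ m ^ 2 + m                      ≡⟨ cong (λ x → x * m ^ 2 ∸ m ^ 2 + m) (suc-pred m) ⟨
    m ^ 2 + pred m * m ^ 2 ∸ m ^ 2 + m     ≡⟨ cong (_+ m) (m+n∸m≡n (m ^ 2) (pred m * m ^ 2)) ⟩
    pred m * m ^ 2 + m                     ≡⟨ eq (pred m) m ⟩
    m * (1 + pred m * m)                   ∎
    where
    eq : ∀ p m → p * (m * (m * 1)) + m ≡ m * (1 + p * m)
    eq = solve-∀

  -- The cut lengths 0 and μ take the place of two generic ones; their counts together exceed one
  -- generic count by m, which is the final + m of the theorem.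
  special-formula : m * (1 + triangle (pred m)) + m * (1 + triangle (pred m)) ≡ generic-total + m
  special-formula = begin
    m * (1 + Δ) + m * (1 + Δ)                  ≡⟨ eq m Δ ⟩
    m * (2 * Δ) + (m + m)                      ≡⟨ cong (λ x → m * x + (m + m)) (trans (2*triangle (pred m)) (cong (pred m *_) (suc-pred m))) ⟩
    m * (pred m * m) + (m + m)                 ≡⟨ eq′ m (pred m * m) ⟩
    m * (1 + pred m * m) + m                   ∎
    where
    Δ = triangle (pred m)
    eq : ∀ m d → m * (1 + d) + m * (1 + d) ≡ m * (2 * d) + (m + m)
    eq = solve-∀
    eq′ : ∀ m x → m * x + (m + m) ≡ m * (1 + x) + m
    eq′ = solve-∀

  module _ (K n Q ν μ : ℕ) (bound : 2 * m ^ suc K ≤ n) (n≡ : n ≡ Q * m ^ K + μ) (μ<M : μ < m ^ K) (Q≈ν : Q ≈ ν) where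

    private
      M = m ^ K
      instance
        M≢0 : NonZero M
        M≢0 = m^n≢0 m K

      complete : ∀ i i′ → Equiv (suc K) n i i′ → Same K n i i′
      complete i i′ = ∼⇒Same K n i i′ (m≤n⇒m≤1+n bound)

      apart : ∀ {ā ā′ i i′} → At K ā i → At K ā′ i′ → Equiv (suc K) n i i′ → ā ≡ ā′
      apart = At-unique complete

      long : ∀ {ā b g} → ā < M → n ≡ ā + g * M + b → b < M → m ≤ g
      long {ā} {b} {g} ā< len b< = s≤s⁻¹ (≤-trans (+-mono-≤ (<⇒≤ 2≤m) ≤-refl) (≤-trans (≤-reflexive (cong (m +_) (sym (+-identityʳ m)))) (s≤s⁻¹
        (*-cancelʳ-< M (2 * m) (suc (suc g)) (begin-strict
          2 * m * M            ≤⟨ ≤-reflexive (*-assoc 2 m M) ⟩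
          2 * m ^ suc K        ≤⟨ bound ⟩
          n                    ≤⟨ ≤-reflexive len ⟩
          ā + g * M + b        <⟨ +-mono-< (+-monoˡ-< (g * M) ā<) b< ⟩
          M + g * M + M        ≤⟨ ≤-reflexive (+-comm (M + g * M) M) ⟩
          suc (suc g) * M      □)))))

      generic : ∀ ā → 1 ≤ ā → ā < M → ā ≢ μ → ClassCount (At K ā) (Equiv (suc K) n) generic-total
      generic ā 1≤ā ā<M ā≢μ with lengths M {n} ā (≤-trans (<⇒≤ ā<M) M≤n)
        where
        M≤n : M ≤ n
        M≤n = ≤-trans (≤-trans (m≤n*m M m) (m≤m+n (m * M) _)) bound
      ... | g , b , len , b< = At-count {K} {n} {ā} {b} {g} complete ā<M len b< (long ā<M len b<) (generic-count g (>⇒≢ 1≤ā) b≢0)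
        where
        b≢0 : b ≢ 0
        -- b = 0 would make ā the remainder of n modulo M, which is μ.
        b≢0 refl = ā≢μ (proj₂ (Residues.divMod-unique M {g} {Q} ā<M μ<M
          (trans (trans (+-comm (g * M) ā) (sym (+-identityʳ _))) (trans (sym len) n≡))))

      len₀ : n ≡ 0 + Q * M + μ
      len₀ = n≡

      lenμ : n ≡ μ + Q * M + 0
      lenμ = trans n≡ (trans (+-comm (Q * M) μ) (sym (+-identityʳ _)))

      0<M : 0 < M
      0<M = >-nonZero⁻¹ M

      locate : ∀ i → ∃ λ ā → At K ā i
      locate i with ceiling M i
      ... | ā , q , st , ā<M = ā , ā<M , q , st

    count-μ≡0 : μ ≡ 0 → ∃ λ N → HasClassCount m 1 (m + ν) N × HasClassCount m (suc K) n ((M ∸ 1) * generic-total + N)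
    count-μ≡0 μ≡0 with abelian-count Q
    ... | N , c = N ,
      -- The same N serves twice, for m + ν single letters and for Q whole σ^K-blocks, because Q ≈ m
      -- + ν.
      toHasClassCount (λ i → z<s , i , trans (+-identityʳ i) (sym (*-identityʳ i)))
        (At-count {0} {m + ν} {0} {0} {m + ν} (∼₁⇒Same (m + ν)) z<s (sym (trans (+-identityʳ _) (*-identityʳ (m + ν)))) z<s (m≤m+n m ν)
          (agreeing Q≈m+ν c)) ,
      subst (HasClassCount m (suc K) n) (+-comm N _)
        (toHasClassCount everywhere
          (union (λ {x} {y} → Equiv-sym {suc K} {n} {x} {y}) (λ { x y p (r , 1≤r , _ , q) h → <⇒≢ 1≤r (apart p q h) })
            (At-count {K} {n} {0} {0} {Q} complete 0<M lenQ 0<M (long 0<M lenQ 0<M) (agreeing refl c))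
            (range (At K) (λ {x} {y} → Equiv-sym {suc K} {n} {x} {y}) apart 1 (M ∸ 1)
              (λ r 1≤r r< → generic r 1≤r (subst (r <_) (m+[n∸m]≡n 0<M) r<) (λ r≡μ → >⇒≢ 1≤r (trans r≡μ μ≡0))))))
      where
      lenQ : n ≡ 0 + Q * M + 0
      lenQ = trans n≡ (cong (Q * M +_) μ≡0)
      Q≈m+ν : Q ≈ m + ν
      Q≈m+ν = trans Q≈ν (sym (trans (≈-reflexive (+-comm m ν)) (+m-≈ ν)))
      agreeing : ∀ {g N} → Q ≈ g → ClassCount InBlock (SameCounts Q) N → ClassCount InBlock (TripleAgree g 0 0) N
      agreeing {g} p = rerelate
        (λ s s′ h → (λ z → ⊥-elim (z refl)) , (λ z → ⊥-elim (z refl)) , SameCounts-length {Q} {g} {s} {s′} p h)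
        (λ s s′ (_ , _ , h) → SameCounts-length {g} {Q} {s} {s′} (sym p) h)
      everywhere : ∀ i → At K 0 i ⊎ (∃ λ r → 1 ≤ r × r < 1 + (M ∸ 1) × At K r i)
      everywhere i with locate i
      ... | zero  , at = inj₁ at
      ... | suc r , at@(r<M , _) = inj₂ (suc r , s≤s z≤n , subst (suc r <_) (sym (m+[n∸m]≡n 0<M)) r<M , at)

    count-μ≢0 : μ ≢ 0 → HasClassCount m (suc K) n ((M ∸ 1) * generic-total + m)
    count-μ≢0 μ≢0 = subst (HasClassCount m (suc K) n) total
      (toHasClassCount everywhere
        -- Cut lengths 0 and μ leave one end uncut; the generic ones run through 1, ..., μ - 1 and μ
        -- + 1, ..., M - 1.
        (union ~-sym special-apart
          (union ~-sym (λ x y p q h → μ≢0 (sym (apart p q h)))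
            (At-count {K} {n} {0} {μ} {Q} complete 0<M len₀ μ<M (long 0<M len₀ μ<M) (left-count Q μ≢0))
            (At-count {K} {n} {μ} {0} {Q} complete μ<M lenμ 0<M (long μ<M lenμ 0<M) (right-count Q μ≢0)))
          (union ~-sym (λ { x y (r , _ , r< , p) (r′ , r′> , _ , q) h → <⇒≢ (<-trans (subst (r <_) 1+μ-1 r<) r′>) (apart p q h) })
            (range (At K) ~-sym apart 1 (μ ∸ 1) (λ r 1≤r r< → let r<μ = subst (r <_) 1+μ-1 r< in generic r 1≤r (<-trans r<μ μ<M) (<⇒≢ r<μ)))
            (range (At K) ~-sym apart (suc μ) (M ∸ suc μ) (λ r r> r< → generic r (≤-trans (s≤s z≤n) r>) (subst (r <_) (m+[n∸m]≡n μ<M) r<) (>⇒≢ r>))))))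
      where
      ~-sym : ∀ {x y} → Equiv (suc K) n x y → Equiv (suc K) n y x
      ~-sym {x} {y} = Equiv-sym {suc K} {n} {x} {y}
      1+μ-1 : 1 + (μ ∸ 1) ≡ μ
      1+μ-1 = m+[n∸m]≡n (n≢0⇒n>0 μ≢0)
      Other : ℕ → Set
      Other i = (∃ λ r → 1 ≤ r × r < 1 + (μ ∸ 1) × At K r i) ⊎ (∃ λ r → suc μ ≤ r × r < suc μ + (M ∸ suc μ) × At K r i)
      special-apart : ∀ x y → At K 0 x ⊎ At K μ x → Other y → ¬ Equiv (suc K) n x y
      special-apart x y (inj₁ p) (inj₁ (r , 1≤r , _ , q)) h = <⇒≢ 1≤r (apart p q h)
      special-apart x y (inj₁ p) (inj₂ (r , r> , _ , q)) h  = <⇒≢ (≤-trans (s≤s z≤n) r>) (apart p q h)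
      special-apart x y (inj₂ p) (inj₁ (r , _ , r< , q)) h  = >⇒≢ (subst (r <_) 1+μ-1 r<) (apart p q h)
      special-apart x y (inj₂ p) (inj₂ (r , r> , _ , q)) h  = <⇒≢ r> (apart p q h)
      everywhere : ∀ i → (At K 0 i ⊎ At K μ i) ⊎ Other i
      everywhere i with locate i
      ... | ā , at@(ā<M , _) with ā ≟ 0 | <-cmp ā μ
      ...   | yes refl | _              = inj₁ (inj₁ at)
      ...   | no _     | tri≈ _ refl _  = inj₁ (inj₂ at)
      ...   | no ā≢0   | tri< ā<μ _ _   = inj₂ (inj₁ (ā , n≢0⇒n>0 ā≢0 , subst (ā <_) (sym 1+μ-1) ā<μ , at))
      ...   | no _     | tri> _ _ ā>μ   = inj₂ (inj₂ (ā , ā>μ , subst (ā <_) (sym (m+[n∸m]≡n μ<M)) ā<M , at))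
      S = m * (1 + triangle (pred m))
      total : S + S + ((μ ∸ 1) * generic-total + (M ∸ suc μ) * generic-total) ≡ (M ∸ 1) * generic-total + m
      total = begin
        S + S + ((μ ∸ 1) * generic-total + (M ∸ suc μ) * generic-total)         ≡⟨ cong (_+ ((μ ∸ 1) * generic-total + (M ∸ suc μ) * generic-total)) special-formula ⟩
        generic-total + m + ((μ ∸ 1) * generic-total + (M ∸ suc μ) * generic-total)   ≡⟨ eq generic-total m (μ ∸ 1) (M ∸ suc μ) ⟩
        (1 + (μ ∸ 1) + (M ∸ suc μ)) * generic-total + m                   ≡⟨ cong (λ x → x * generic-total + m) (trans (cong (_+ (M ∸ suc μ)) 1+μ-1) rest) ⟩
        (M ∸ 1) * generic-total + m                                       ∎
        where
        eq : ∀ c m a b → c + m + (a * c + b * c) ≡ (1 + a + b) * c + m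
        eq = solve-∀
        rest : μ + (M ∸ suc μ) ≡ M ∸ 1
        rest = trans (sym (m+n∸m≡n 1 (μ + (M ∸ suc μ)))) (cong (_∸ 1) (m+[n∸m]≡n μ<M))

theorem1p13 : (m k n : ℕ) → 2 ≤ m → 2 ≤ k → 2 * m ^ k ≤ n →
  let lam = n mod (m ^ k)
      ν = lam div (m ^ (k ∸ 1))
      μ = lam mod (m ^ (k ∸ 1))
      C = (m ^ (k ∸ 1) ∸ 1) * (m ^ 3 ∸ m ^ 2 + m)
  in (μ ≡ 0 → ∃ λ B → HasClassCount m 1 (m + ν) B × HasClassCount m k n (C + B))
     × (μ ≢ 0 → HasClassCount m k n (C + m))
theorem1p13 m@(suc _) (suc K) n 2≤m _ bound =
  (λ μ≡0 → let (N , h , h′) = count-μ≡0 K n Q ν μ bound n≡ μ<M Q≈ν μ≡0 in N , h , subst (λ c → HasClassCount m (suc K) n ((M ∸ 1) * c + N)) (sym generic-total-formula) h′) ,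
  (λ μ≢0 → subst (λ c → HasClassCount m (suc K) n ((M ∸ 1) * c + m)) (sym generic-total-formula) (count-μ≢0 K n Q ν μ bound n≡ μ<M Q≈ν μ≢0))
  where
  open ThueMorse m 2≤m
  M lam ν μ c Q : ℕ
  M = m ^ K
  lam = n mod (m ^ suc K)
  ν = lam div M
  μ = lam mod M
  c = n div (m ^ suc K)
  -- The quotient of n by M; the part of n above m^k contributes c * m, so Q ≈ ν.
  Q = c * m + ν
  mod-div : ∀ a b .{{_ : NonZero b}} → a ≡ (a div b) * b + a mod b
  mod-div a (suc b) = trans (m≡m%n+[m/n]*n a (suc b)) (+-comm (a % suc b) _)
  mod< : ∀ a b .{{_ : NonZero b}} → a mod b < b
  mod< a (suc b) = m%n<n a (suc b)
  instance
    M≢0 : NonZero M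
    M≢0 = m^n≢0 m K
    mM≢0 : NonZero (m ^ suc K)
    mM≢0 = m^n≢0 m (suc K)
  μ<M : μ < M
  μ<M = mod< lam M
  n≡ : n ≡ Q * M + μ
  n≡ = begin
    n                            ≡⟨ mod-div n (m ^ suc K) ⟩
    c * (m * M) + lam            ≡⟨ cong (c * (m * M) +_) (mod-div lam M) ⟩
    c * (m * M) + (ν * M + μ)    ≡⟨ eq c m M ν μ ⟩
    (c * m + ν) * M + μ          ∎
    where
    eq : ∀ c m M ν μ → c * (m * M) + (ν * M + μ) ≡ (c * m + ν) * M + μ
    eq = solve-∀
  Q≈ν : Q ≈ ν
  Q≈ν = trans (≈-reflexive (+-comm (c * m) ν)) (+k*m-≈ ν c)
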